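{- Let $r$ be a positive integer and $s=(r,r,\ldots,r)$ of length $n$. Then \[ d_n^s(z)=\sum_{\omega\in\mathcal{SW}(n+1,r)}z^{\mathrm{des}(\omega)}. \] Moreover, the local $h$-polynomial of the $r$-th edgewise subdivision of the $n$-simplex $2^{[n+1]}$ equals the local $h^\ast$-polynomial of the $s$-lecture hall simplex $P_n^s$.
   Context: $P_n^s=\{x\in\mathbb{R}^n:0\le x_1/s_1\le\cdots\le x_n/s_n\le1\}$; $d_n^s(z):=\ell^\ast(P_n^s;z)$ where for a lattice $d$-simplex $\Delta=\mathrm{conv}(v^{(0)},\ldots,v^{(d)})\subset\mathbb{R}^n$, $\ell^\ast(\Delta;z)=\sum_{x\in\Pi^\circ_\Delta\cap\mathbb{Z}^{n+1}}z^{x_{n+1}}$, $\Pi^\circ_\Delta=\{\sum_i\lambda_i(v^{(i)},1):0<\lambda_i<1\}$. $\mathcal{SW}(m,r)$ (Smirnoff words) is the set of strings $\omega_0\omega_1\cdots\omega_m$ with $\omega_i\in\{0,\ldots,r-1\}$, $\omega_0=\omega_m=0$, and $\omega_i\ne\omega_{i+1}$ for $0\le i<m$; $\mathrm{des}(\omega)=|\{i:\omega_i>\omega_{i+1}\}|$. The $r$-th edgewise subdivision of $2^{[n+1]}$: its vertices are the points $x\in\mathbb{Z}_{\ge0}^{n+1}$ with $x_1+\cdots+x_{n+1}=r$; with $\varphi(x)=(x_1,x_1+x_2,\ldots,x_1+\cdots+x_{n+1})$, a set $F$ of vertices is a face iff for all $x,y\in F$, $\varphi(x)-\varphi(y)\in\{0,1\}^{n+1}$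 or $\varphi(y)-\varphi(x)\in\{0,1\}^{n+1}$; a face $F$ lies over the face $\bigcup_{x\in F}\mathrm{supp}(x)$ of $2^{[n+1]}$. For a $(d-1)$-dimensional complex $\Omega$, $h(\Omega;z)=\sum_{i=0}^d f_{i-1}z^i(1-z)^{d-i}$; for a subdivision $\Omega$ of $2^V$, $|V|=m$, with restrictions $\Omega_F$ to faces $F\subseteq V$ ($h(\Omega_\emptyset;z)=1$), the local $h$-polynomial is $\ell_V(\Omega_V;z)=\sum_{F\subseteq V}(-1)^{m-|F|}h(\Omega_F;z)$. -}

module Defs where

open import Data.Bool.Base using (true; false; if_then_else_)
open import Data.Fin.Base using (Fin; zero; suc; toℕ; inject₁)
import Data.Fin.Properties as Fin
open import Data.Fin.Subset using (Subset; inside; outside; _∈_; _⊆_; ∣_∣; ⋃; _∪_; ⊥)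
open import Data.Fin.Subset.Properties using (_∈?_; _⊆?_; p⊆p∪q; q⊆p∪q; x∈p∪q⁻; ∉⊥)
open import Data.Integer.Base as ℤ using (ℤ; 0ℤ; 1ℤ; -1ℤ; +_; _⊖_)
import Data.Integer.Properties as ℤ
open import Data.List.Base as List using (List; []; _∷_; _++_; allFin; upTo; filter; foldr; length; cartesianProductWith; cartesianProduct)
open import Data.List.Membership.Propositional using () renaming (_∈_ to _∈ₗ_)
open import Data.List.Membership.Propositional.Properties using (∈-filter⁺; ∈-filter⁻; ∈-allFin; ∈-upTo⁺; ∈-map⁺; ∈-map⁻; ∈-cartesianProductWith⁺; ∈-cartesianProduct⁺)
open import Data.List.Relation.Unary.Any using (here; there)
import Data.List.Relation.Unary.All as All
open import Data.List.Relation.Unary.AllPairs using ([]; _∷_)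
open import Data.List.Relation.Unary.Unique.Propositional using (Unique)
import Data.List.Relation.Unary.Unique.Propositional.Properties as Unique
open import Data.Nat.Base as ℕ using (ℕ; zero; suc; NonZero; _⊔_; _∸_; _<ᵇ_; s≤s; z≤n)
import Data.Nat.Properties as ℕ
open import Data.Product.Base using (∃; _×_; _,_; proj₁; proj₂)
open import Data.Rational.Base as ℚ using (ℚ; 0ℚ; 1ℚ; _/_)
import Data.Rational.Properties as ℚ
import Data.Rational.Unnormalised.Base as ℚᵘ
import Data.Rational.Unnormalised.Properties as ℚᵘ
open import Data.Sum.Base using (_⊎_; inj₁; inj₂)
open import Data.Unit.Base using (⊤; tt)
open import Data.Vec.Base as Vec using (Vec; []; _∷_; _∷ʳ_; lookup; tabulate; head; last)
import Data.Vec.Properties as Vec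
open import Data.Vec.Relation.Unary.Linked using (Linked; [-]; _∷_)
open import Function.Base using (_∘_; id)
open import Level using (0ℓ)
open import Relation.Binary.PropositionalEquality using (_≡_; _≢_; refl; sym; trans; cong; cong₂; subst; module ≡-Reasoning)
open import Relation.Nullary.Decidable using (Dec; yes; no; map′; _×-dec_; _⊎-dec_; _→-dec_; ¬?; ⌊_⌋)
open import Relation.Nullary.Negation using (contradiction)
open import Relation.Unary using (Pred; Decidable; _≐_)

open import Algebra.Properties.CommutativeMonoid.Sum ℚ.+-0-commutativeMonoid using (sum; sum-cong-≗; sum-replicate-zero)

------------------------------------------------------------------------
-- Integer polynomials, as lists of coefficients from degree zero upwards.
-- Trailing zeros are allowed, so the equality of polynomials is _≈_.

Poly : Set
Poly = List ℤ

coeff : Poly → ℕ → ℤ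
coeff []      _       = 0ℤ
coeff (a ∷ _) zero    = a
coeff (_ ∷ p) (suc k) = coeff p k

infix 4 _≈_

_≈_ : Poly → Poly → Set
p ≈ q = ∀ k → coeff p k ≡ coeff q k

constant : ℤ → Poly
constant a = a ∷ []

infixl 6 _⊕_
infixl 7 _⊛_ _·_
infixr 8 _^^_ z^_

_⊕_ : Poly → Poly → Poly
[]      ⊕ q       = q
p       ⊕ []      = p
(a ∷ p) ⊕ (b ∷ q) = (a ℤ.+ b) ∷ (p ⊕ q)

_·_ : ℤ → Poly → Poly
a · p = List.map (a ℤ.*_) p

_⊛_ : Poly → Poly → Poly
[]      ⊛ q = []
(a ∷ p) ⊛ q = (a · q) ⊕ (0ℤ ∷ (p ⊛ q))

_^^_ : Poly → ℕ → Poly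
p ^^ zero  = constant 1ℤ
p ^^ suc k = p ⊛ (p ^^ k)

z^_ : ℕ → Poly
z^ k = (0ℤ ∷ 1ℤ ∷ []) ^^ k

1-z : Poly
1-z = 1ℤ ∷ -1ℤ ∷ []

∑ : {A : Set} → List A → (A → Poly) → Poly
∑ xs f = foldr (λ x p → f x ⊕ p) [] xs

infix 5 ∑
syntax ∑ xs (λ x → p) = ∑[ x ∈ xs ] p

------------------------------------------------------------------------
-- Finite sets, listed without repetition

record Enumeration {A : Set} (P : Pred A 0ℓ) : Set where
  field
    elements : List A
    unique   : Unique elements
    sound    : ∀ {x} → x ∈ₗ elements → P x
    complete : ∀ {x} → P x → x ∈ₗ elements

open Enumeration public

filtered : {A : Set} {P : Pred A 0ℓ} (xs : List A) → Unique xs →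
           Decidable P → (∀ {x} → P x → x ∈ₗ xs) → Enumeration P
filtered xs u P? c = record
  { elements = filter P? xs
  ; unique   = Unique.filter⁺ P? u
  ; sound    = λ x∈ → proj₂ (∈-filter⁻ P? {xs = xs} x∈)
  ; complete = λ Px → ∈-filter⁺ P? (c Px) Px
  }

choices : {A : Set} {n : ℕ} → Vec (List A) n → List (Vec A n)
choices []         = [] ∷ []
choices (xs ∷ xss) = cartesianProductWith _∷_ xs (choices xss)

choices-unique : {A : Set} {n : ℕ} (xss : Vec (List A) n) →
                 (∀ i → Unique (lookup xss i)) → Unique (choices xss)
choices-unique []         u = All.[] ∷ []
choices-unique (xs ∷ xss) u =
  Unique.cartesianProductWith⁺ _∷_ Vec.∷-injective (u zero) (choices-unique xss (u ∘ suc))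

choices-complete : {A : Set} {n : ℕ} (xss : Vec (List A) n) {x : Vec A n} →
                   (∀ i → lookup x i ∈ₗ lookup xss i) → x ∈ₗ choices xss
choices-complete []         {[]}    _ = here refl
choices-complete (xs ∷ xss) {a ∷ x} h =
  ∈-cartesianProductWith⁺ _∷_ (h zero) (choices-complete xss (h ∘ suc))

vectors : {A : Set} → List A → (n : ℕ) → List (Vec A n)
vectors xs n = choices (Vec.replicate n xs)

vectors-unique : {A : Set} {xs : List A} → Unique xs → ∀ n → Unique (vectors xs n)
vectors-unique {xs = xs} u n =
  choices-unique (Vec.replicate n xs) (λ i → subst Unique (sym (Vec.lookup-replicate i xs)) u)

vectors-complete : {A : Set} {xs : List A} {n : ℕ} {x : Vec A n} →
                   (∀ i → lookup x i ∈ₗ xs) → x ∈ₗ vectors xs n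
vectors-complete {xs = xs} {n} {x} h =
  choices-complete (Vec.replicate n xs)
    (λ i → subst (lookup x i ∈ₗ_) (sym (Vec.lookup-replicate i xs)) (h i))

subsets : (n : ℕ) → Enumeration {Subset n} (λ _ → ⊤)
subsets n = record
  { elements = vectors (inside ∷ outside ∷ []) n
  ; unique   = vectors-unique (((λ ()) All.∷ All.[]) ∷ All.[] ∷ []) n
  ; sound    = λ _ → tt
  ; complete = λ _ → vectors-complete (λ i → side _)
  }
  where
  side : ∀ b → b ∈ₗ (inside ∷ outside ∷ [])
  side true  = here refl
  side false = there (here refl)

------------------------------------------------------------------------
-- Lattice simplices and local h*-polynomials.
-- Real points are replaced by rational points.  This does not change the
-- set of lattice points: the vectors (v⁽ⁱ⁾, 1) are integral and linearly
-- independent, so if a real combination of them is an integral vector, its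
-- coefficients are rational.

toℚ : ℤ → ℚ
toℚ i = i / 1

combination : {k n : ℕ} → (Fin k → ℚ) → (Fin k → Vec ℤ n) → Vec ℚ n
combination c v = tabulate λ i → sum λ j → c j ℚ.* toℚ (lookup (v j) i)

conv : {k n : ℕ} → (Fin k → Vec ℤ n) → Pred (Vec ℚ n) 0ℓ
conv v x = ∃ λ c → (∀ j → 0ℚ ℚ.≤ c j) × sum c ≡ 1ℚ × x ≡ combination c v

record IsLatticeSimplex {n : ℕ} (Δ : Pred (Vec ℚ n) 0ℓ) (d : ℕ) : Set where
  field
    vertex      : Fin (suc d) → Vec ℤ n
    independent : ∀ c → sum c ≡ 0ℚ → combination c vertex ≡ Vec.replicate n 0ℚ →
                  ∀ j → c j ≡ 0ℚ
    hull        : Δ ≐ conv vertex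

open IsLatticeSimplex public

-- The points of n+1 dimensional space are pairs of a vector and a last
-- coordinate.
Π° : {n d : ℕ} {Δ : Pred (Vec ℚ n) 0ℓ} → IsLatticeSimplex Δ d → Pred (Vec ℚ n × ℚ) 0ℓ
Π° S (x , h) = ∃ λ c → (∀ j → 0ℚ ℚ.< c j × c j ℚ.< 1ℚ) ×
                       x ≡ combination c (vertex S) × h ≡ sum c

Π°-lattice : {n d : ℕ} {Δ : Pred (Vec ℚ n) 0ℓ} → IsLatticeSimplex Δ d → Pred (Vec ℤ n × ℤ) 0ℓ
Π°-lattice S (x , h) = Π° S (Vec.map toℚ x , toℚ h)

-- The last coordinate of a point of Π° is positive, so that taking the
-- absolute value only changes its type.
ℓ* : {n d : ℕ} {Δ : Pred (Vec ℚ n) 0ℓ} (S : IsLatticeSimplex Δ d) →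
     Enumeration (Π°-lattice S) → Poly
ℓ* S points = ∑[ xh ∈ elements points ] z^ ℤ.∣ proj₂ xh ∣

------------------------------------------------------------------------
-- Lecture hall simplices

module _ {n : ℕ} (s : Fin n → ℕ) .{{s>0 : ∀ {i} → NonZero (s i)}} where

  ratios : Vec ℚ n → Vec ℚ n
  ratios x = tabulate λ i → lookup x i ℚ.* (1ℤ / s i)

  LectureHall : Pred (Vec ℚ n) 0ℓ
  LectureHall x = Linked ℚ._≤_ (0ℚ ∷ (ratios x ∷ʳ 1ℚ))

-- The vertex with j leading zeros, (0, …, 0, s_{j+1}, …, s_n).
lectureHallVertex : {n : ℕ} → (Fin n → ℕ) → Fin (suc n) → Vec ℤ n
lectureHallVertex s j = tabulate λ i → if toℕ i <ᵇ toℕ j then 0ℤ else + s i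

-- The coefficients of a point in terms of the lecture hall vertices are the
-- successive differences of its ratios.

differences : {n : ℕ} → ℚ → Vec ℚ n → ℚ → Fin (suc n) → ℚ
differences a []       h zero    = h ℚ.- a
differences a (m ∷ ms) h zero    = m ℚ.- a
differences a (m ∷ ms) h (suc i) = differences m ms h i

partial : {n : ℕ} → (Fin (suc n) → ℚ) → Fin n → ℚ
partial f zero    = f zero
partial f (suc i) = f zero ℚ.+ partial (f ∘ suc) i

shift : ∀ m a p → (m ℚ.- a ℚ.+ p) ℚ.+ a ≡ p ℚ.+ m
shift m a p = begin
  (m ℚ.- a ℚ.+ p) ℚ.+ a       ≡⟨ cong (ℚ._+ a) (ℚ.+-comm (m ℚ.- a) p) ⟩
  (p ℚ.+ (m ℚ.- a)) ℚ.+ a     ≡⟨ ℚ.+-assoc p (m ℚ.- a) a ⟩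
  p ℚ.+ (m ℚ.- a ℚ.+ a)       ≡⟨ cong (p ℚ.+_) (ℚ.+-assoc m (ℚ.- a) a) ⟩
  p ℚ.+ (m ℚ.+ (ℚ.- a ℚ.+ a)) ≡⟨ cong (λ t → p ℚ.+ (m ℚ.+ t)) (ℚ.+-inverseˡ a) ⟩
  p ℚ.+ (m ℚ.+ 0ℚ)            ≡⟨ cong (p ℚ.+_) (ℚ.+-identityʳ m) ⟩
  p ℚ.+ m                     ∎
  where open ≡-Reasoning

cancel : ∀ m a → m ℚ.- a ℚ.+ a ≡ m
cancel m a = trans (cong (ℚ._+ a) (sym (ℚ.+-identityʳ (m ℚ.- a)))) (trans (shift m a 0ℚ) (ℚ.+-identityˡ m))

move : ∀ {p a m} → p ℚ.+ a ≡ m → p ≡ m ℚ.- a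
move {p} {a} refl = sym (begin
  p ℚ.+ a ℚ.- a     ≡⟨ ℚ.+-assoc p a (ℚ.- a) ⟩
  p ℚ.+ (a ℚ.- a)   ≡⟨ cong (p ℚ.+_) (ℚ.+-inverseʳ a) ⟩
  p ℚ.+ 0ℚ          ≡⟨ ℚ.+-identityʳ p ⟩
  p                 ∎)
  where open ≡-Reasoning

partial-differences : ∀ {n} a (ms : Vec ℚ n) h i →
                      partial (differences a ms h) i ℚ.+ a ≡ lookup ms i
partial-differences a (m ∷ ms) h zero    = cancel m a
partial-differences a (m ∷ ms) h (suc i) =
  trans (shift m a (partial (differences m ms h) i)) (partial-differences m ms h i)

sum-differences : ∀ {n} a (ms : Vec ℚ n) h → sum (differences a ms h) ℚ.+ a ≡ h
sum-differences a []       h = trans (cong (ℚ._+ a) (ℚ.+-identityʳ (h ℚ.- a))) (cancel h a)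
sum-differences a (m ∷ ms) h =
  trans (shift m a (sum (differences m ms h))) (sum-differences m ms h)

rotate : ∀ x y a → x ℚ.+ y ℚ.+ a ≡ y ℚ.+ (x ℚ.+ a)
rotate x y a = trans (cong (ℚ._+ a) (ℚ.+-comm x y)) (ℚ.+-assoc y x a)

differences-unique : ∀ {n} (f : Fin (suc n) → ℚ) a (ms : Vec ℚ n) h →
                     (∀ i → partial f i ℚ.+ a ≡ lookup ms i) → sum f ℚ.+ a ≡ h →
                     ∀ j → f j ≡ differences a ms h j
differences-unique f a []       h _ e zero    =
  move (trans (cong (ℚ._+ a) (sym (ℚ.+-identityʳ (f zero)))) e)
differences-unique f a (m ∷ ms) h p e zero    = move (p zero)
differences-unique f a (m ∷ ms) h p e (suc j) =
  differences-unique (f ∘ suc) m ms h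
    (λ i → trans (sym (step (partial (f ∘ suc) i))) (p (suc i)))
    (trans (sym (step (sum (f ∘ suc)))) e) j
  where
  step : ∀ y → f zero ℚ.+ y ℚ.+ a ≡ y ℚ.+ m
  step y = trans (rotate (f zero) y a) (cong (y ℚ.+_) (p zero))

differences-zero : ∀ n j → differences 0ℚ (Vec.replicate n 0ℚ) 0ℚ j ≡ 0ℚ
differences-zero zero    zero    = refl
differences-zero (suc n) zero    = refl
differences-zero (suc n) (suc j) = differences-zero n j

0≤difference : ∀ {a m} → a ℚ.≤ m → 0ℚ ℚ.≤ m ℚ.- a
0≤difference {a} {m} a≤m = subst (ℚ._≤ m ℚ.- a) (ℚ.+-inverseʳ a) (ℚ.+-monoˡ-≤ (ℚ.- a) a≤m)

≤-from-difference : ∀ {a m} → 0ℚ ℚ.≤ m ℚ.- a → a ℚ.≤ m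
≤-from-difference {a} {m} p =
  subst (ℚ._≤ m) (ℚ.+-identityˡ a) (subst (0ℚ ℚ.+ a ℚ.≤_) (cancel m a) (ℚ.+-monoˡ-≤ a p))

linked⇒differences : ∀ {n} a (ms : Vec ℚ n) h → Linked ℚ._≤_ (a ∷ (ms ∷ʳ h)) →
                     ∀ j → 0ℚ ℚ.≤ differences a ms h j
linked⇒differences a []       h (a≤h ∷ _) zero    = 0≤difference a≤h
linked⇒differences a (m ∷ ms) h (a≤m ∷ _) zero    = 0≤difference a≤m
linked⇒differences a (m ∷ ms) h (_ ∷ l)   (suc j) = linked⇒differences m ms h l j

differences⇒linked : ∀ {n} a (ms : Vec ℚ n) h → (∀ j → 0ℚ ℚ.≤ differences a ms h j) →
                     Linked ℚ._≤_ (a ∷ (ms ∷ʳ h))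
differences⇒linked a []       h p = ≤-from-difference (p zero) ∷ [-]
differences⇒linked a (m ∷ ms) h p = ≤-from-difference (p zero) ∷ differences⇒linked m ms h (p ∘ suc)

sum-vertex : ∀ {n} (f : Fin (suc n) → ℚ) (i : Fin n) (a : ℤ) →
             sum (λ j → f j ℚ.* toℚ (if toℕ i <ᵇ toℕ j then 0ℤ else a)) ≡ toℚ a ℚ.* partial f i
sum-vertex {suc n} f zero a = begin
  f zero ℚ.* toℚ a ℚ.+ sum (λ j → f (suc j) ℚ.* 0ℚ)
    ≡⟨ cong (f zero ℚ.* toℚ a ℚ.+_) (sum-cong-≗ {suc n} {λ j → f (suc j) ℚ.* 0ℚ} {λ _ → 0ℚ} (λ j → ℚ.*-zeroʳ (f (suc j)))) ⟩
  f zero ℚ.* toℚ a ℚ.+ sum {suc n} (λ _ → 0ℚ)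
    ≡⟨ cong (f zero ℚ.* toℚ a ℚ.+_) (sum-replicate-zero (suc n)) ⟩
  f zero ℚ.* toℚ a ℚ.+ 0ℚ
    ≡⟨ ℚ.+-identityʳ _ ⟩
  f zero ℚ.* toℚ a
    ≡⟨ ℚ.*-comm (f zero) (toℚ a) ⟩
  toℚ a ℚ.* f zero ∎
  where open ≡-Reasoning
sum-vertex f (suc i) a =
  trans (cong₂ ℚ._+_ (ℚ.*-comm (f zero) (toℚ a)) (sum-vertex (f ∘ suc) i a))
        (sym (ℚ.*-distribˡ-+ (toℚ a) (f zero) (partial (f ∘ suc) i)))

lookup-combination : ∀ {n} (s : Fin n → ℕ) c i →
                     lookup (combination c (lectureHallVertex s)) i ≡ toℚ (+ s i) ℚ.* partial c i
lookup-combination s c i =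
  trans (Vec.lookup∘tabulate (λ i → sum λ j → c j ℚ.* toℚ (lookup (lectureHallVertex s j) i)) i)
  (trans (sum-cong-≗ (λ j → cong (λ a → c j ℚ.* toℚ a)
            (Vec.lookup∘tabulate (λ i → if toℕ i <ᵇ toℕ j then 0ℤ else + s i) i)))
         (sum-vertex c i (+ s i)))

toℚᵘ-toℚ : ∀ i → ℚ.toℚᵘ (toℚ i) ℚᵘ.≃ ℚᵘ.mkℚᵘ i 0
toℚᵘ-toℚ i = ℚ.toℚᵘ-fromℚᵘ (ℚᵘ.mkℚᵘ i 0)

toℚ-inverse : ∀ k .{{_ : NonZero k}} → toℚ (+ k) ℚ.* (1ℤ / k) ≡ 1ℚ
toℚ-inverse k@(suc k-1) = ℚ.toℚᵘ-injective
  (ℚᵘ.≃-trans (ℚ.toℚᵘ-homo-* (toℚ (+ k)) (1ℤ / k))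
  (ℚᵘ.≃-trans (ℚᵘ.*-cong (toℚᵘ-toℚ (+ k)) (ℚ.toℚᵘ-fromℚᵘ (ℚᵘ.mkℚᵘ 1ℤ k-1)))
  (ℚᵘ.*≡* (trans (ℤ.*-identityʳ _) (trans (ℤ.*-identityʳ (+ k))
     (sym (trans (ℤ.*-identityˡ _) (cong (λ t → + suc t) (ℕ.+-identityʳ k-1)))))))))

toℚ-* : ∀ i j → toℚ i ℚ.* toℚ j ≡ toℚ (i ℤ.* j)
toℚ-* i j = ℚ.toℚᵘ-injective
  (ℚᵘ.≃-trans (ℚ.toℚᵘ-homo-* (toℚ i) (toℚ j))
  (ℚᵘ.≃-trans (ℚᵘ.*-cong (toℚᵘ-toℚ i) (toℚᵘ-toℚ j)) (ℚᵘ.≃-sym (toℚᵘ-toℚ (i ℤ.* j)))))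

toℚ-+ : ∀ i j → toℚ i ℚ.+ toℚ j ≡ toℚ (i ℤ.+ j)
toℚ-+ i j = ℚ.toℚᵘ-injective
  (ℚᵘ.≃-trans (ℚ.toℚᵘ-homo-+ (toℚ i) (toℚ j))
  (ℚᵘ.≃-trans (ℚᵘ.+-cong (toℚᵘ-toℚ i) (toℚᵘ-toℚ j))
  (ℚᵘ.≃-trans (ℚᵘ.*≡* (cong (ℤ._* 1ℤ) (cong₂ ℤ._+_ (ℤ.*-identityʳ i) (ℤ.*-identityʳ j))))
              (ℚᵘ.≃-sym (toℚᵘ-toℚ (i ℤ.+ j))))))

toℚ-mono-≤ : ∀ i j → i ℤ.≤ j → toℚ i ℚ.≤ toℚ j
toℚ-mono-≤ i j i≤j = ℚ.toℚᵘ-cancel-≤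
  (ℚᵘ.≤-trans (ℚᵘ.≤-reflexive (toℚᵘ-toℚ i))
  (ℚᵘ.≤-trans (ℚᵘ.*≤* (ℤ.*-monoʳ-≤-nonNeg 1ℤ i≤j)) (ℚᵘ.≤-reflexive (ℚᵘ.≃-sym (toℚᵘ-toℚ j)))))

toℚ-reflects-≤ : ∀ i j → toℚ i ℚ.≤ toℚ j → i ℤ.≤ j
toℚ-reflects-≤ i j p with
  ℚᵘ.≤-trans (ℚᵘ.≤-reflexive (ℚᵘ.≃-sym (toℚᵘ-toℚ i)))
  (ℚᵘ.≤-trans (ℚ.toℚᵘ-mono-≤ p) (ℚᵘ.≤-reflexive (toℚᵘ-toℚ j)))
... | ℚᵘ.*≤* q = ℤ.*-cancelʳ-≤-pos i j 1ℤ q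

sum-≥0 : ∀ {k} (c : Fin k → ℚ) → (∀ j → 0ℚ ℚ.≤ c j) → 0ℚ ℚ.≤ sum c
sum-≥0 {zero}  c p = ℚ.≤-refl
sum-≥0 {suc k} c p = ℚ.+-mono-≤ (p zero) (sum-≥0 (c ∘ suc) (p ∘ suc))

sum-≤ : ∀ {k} (c : Fin k → ℚ) → (∀ j → c j ℚ.≤ 1ℚ) → sum c ℚ.≤ toℚ (+ k)
sum-≤ {zero}  c p = ℚ.≤-refl
sum-≤ {suc k} c p =
  subst (sum c ℚ.≤_) (toℚ-+ 1ℤ (+ k)) (ℚ.+-mono-≤ (p zero) (sum-≤ (c ∘ suc) (p ∘ suc)))

partial-≥0 : ∀ {n} (c : Fin (suc n) → ℚ) → (∀ j → 0ℚ ℚ.≤ c j) → ∀ i → 0ℚ ℚ.≤ partial c i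
partial-≥0 c p zero    = p zero
partial-≥0 c p (suc i) = ℚ.+-mono-≤ (p zero) (partial-≥0 (c ∘ suc) (p ∘ suc) i)

partial-≤-sum : ∀ {n} (c : Fin (suc n) → ℚ) → (∀ j → 0ℚ ℚ.≤ c j) → ∀ i → partial c i ℚ.≤ sum c
partial-≤-sum c p zero    =
  subst (ℚ._≤ sum c) (ℚ.+-identityʳ (c zero)) (ℚ.+-monoʳ-≤ (c zero) (sum-≥0 (c ∘ suc) (p ∘ suc)))
partial-≤-sum c p (suc i) = ℚ.+-monoʳ-≤ (c zero) (partial-≤-sum (c ∘ suc) (p ∘ suc) i)

module _ {n : ℕ} (s : Fin n → ℕ) .{{s>0 : ∀ {i} → NonZero (s i)}} where

  lookup-ratios : ∀ x i → lookup x i ≡ toℚ (+ s i) ℚ.* lookup (ratios s x) i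
  lookup-ratios x i = sym (begin
    t ℚ.* lookup (ratios s x) i         ≡⟨ cong (t ℚ.*_) (Vec.lookup∘tabulate _ i) ⟩
    t ℚ.* (lookup x i ℚ.* u)            ≡⟨ cong (t ℚ.*_) (ℚ.*-comm (lookup x i) u) ⟩
    t ℚ.* (u ℚ.* lookup x i)            ≡⟨ sym (ℚ.*-assoc t u (lookup x i)) ⟩
    t ℚ.* u ℚ.* lookup x i              ≡⟨ cong (ℚ._* lookup x i) (toℚ-inverse (s i)) ⟩
    1ℚ ℚ.* lookup x i                   ≡⟨ ℚ.*-identityˡ (lookup x i) ⟩
    lookup x i                          ∎)
    where
    open ≡-Reasoning
    t = toℚ (+ s i)
    u = 1ℤ / s i

  divide : ∀ {i p q} → toℚ (+ s i) ℚ.* p ≡ toℚ (+ s i) ℚ.* q → p ≡ q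
  divide {i} {p} {q} e = trans (sym (undo p)) (trans (cong (u ℚ.*_) e) (undo q))
    where
    t = toℚ (+ s i)
    u = 1ℤ / s i
    undo : ∀ p → u ℚ.* (t ℚ.* p) ≡ p
    undo p = trans (sym (ℚ.*-assoc u t p))
             (trans (cong (ℚ._* p) (trans (ℚ.*-comm u t) (toℚ-inverse (s i)))) (ℚ.*-identityˡ p))

  combination⇒ratios : ∀ {x} c → x ≡ combination c (lectureHallVertex s) →
                       ∀ i → partial c i ≡ lookup (ratios s x) i
  combination⇒ratios {x} c refl i =
    divide (trans (sym (lookup-combination s c i)) (lookup-ratios x i))

  ratios⇒combination : ∀ {x} c → (∀ i → partial c i ≡ lookup (ratios s x) i) →
                       x ≡ combination c (lectureHallVertex s)
  ratios⇒combination {x} c p =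
    trans (sym (Vec.tabulate∘lookup x))
    (trans (Vec.tabulate-cong λ i →
              trans (lookup-ratios x i)
              (trans (cong (toℚ (+ s i) ℚ.*_) (sym (p i))) (sym (lookup-combination s c i))))
           (Vec.tabulate∘lookup _))

  coefficients : Vec ℚ n → ℚ → Fin (suc n) → ℚ
  coefficients x h = differences 0ℚ (ratios s x) h

  coefficients-combination : ∀ x h → x ≡ combination (coefficients x h) (lectureHallVertex s)
  coefficients-combination x h =
    ratios⇒combination (coefficients x h) (λ i → trans (sym (ℚ.+-identityʳ _)) (partial-differences 0ℚ (ratios s x) h i))

  coefficients-sum : ∀ x h → sum (coefficients x h) ≡ h
  coefficients-sum x h = trans (sym (ℚ.+-identityʳ _)) (sum-differences 0ℚ (ratios s x) h)

  coefficients-unique : ∀ {x h} c → x ≡ combination c (lectureHallVertex s) → sum c ≡ h →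
                        ∀ j → c j ≡ coefficients x h j
  coefficients-unique {x} {h} c e e′ =
    differences-unique c 0ℚ (ratios s x) h
      (λ i → trans (ℚ.+-identityʳ _) (combination⇒ratios c e i)) (trans (ℚ.+-identityʳ _) e′)

  lectureHall-isLatticeSimplex : IsLatticeSimplex (LectureHall s) n
  lectureHall-isLatticeSimplex = record
    { vertex      = lectureHallVertex s
    ; independent = independent′
    ; hull        = (λ {x} l → coefficients x 1ℚ , linked⇒differences 0ℚ (ratios s x) 1ℚ l
                               , coefficients-sum x 1ℚ , coefficients-combination x 1ℚ)
                  , (λ {x} (c , c≥0 , Σc , e) → differences⇒linked 0ℚ (ratios s x) 1ℚ
                       (λ j → subst (0ℚ ℚ.≤_) (coefficients-unique c e Σc j) (c≥0 j)))
    }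
    where
    zero-partial : ∀ c → combination c (lectureHallVertex s) ≡ Vec.replicate n 0ℚ →
                   ∀ i → partial c i ℚ.+ 0ℚ ≡ lookup (Vec.replicate n 0ℚ) i
    zero-partial c e i = trans (ℚ.+-identityʳ _)
      (trans (divide {i} (begin
        toℚ (+ s i) ℚ.* partial c i                   ≡⟨ sym (lookup-combination s c i) ⟩
        lookup (combination c (lectureHallVertex s)) i ≡⟨ cong (λ v → lookup v i) e ⟩
        lookup (Vec.replicate n 0ℚ) i                  ≡⟨ Vec.lookup-replicate i 0ℚ ⟩
        0ℚ                                             ≡⟨ sym (ℚ.*-zeroʳ (toℚ (+ s i))) ⟩
        toℚ (+ s i) ℚ.* 0ℚ                             ∎)) (sym (Vec.lookup-replicate i 0ℚ)))
      where open ≡-Reasoning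
    independent′ : ∀ c → sum c ≡ 0ℚ → combination c (lectureHallVertex s) ≡ Vec.replicate n 0ℚ →
                   ∀ j → c j ≡ 0ℚ
    independent′ c e e′ j =
      trans (differences-unique c 0ℚ (Vec.replicate n 0ℚ) 0ℚ (zero-partial c e′)
               (trans (ℚ.+-identityʳ _) e) j)
            (differences-zero n j)

  -- The lattice points of Π° lie in the box 0 ≤ xᵢ ≤ sᵢ (n+1), 0 ≤ h ≤ n+1.

  Π°-lattice? : Decidable (Π°-lattice lectureHall-isLatticeSimplex)
  Π°-lattice? (x , h) = map′
    (λ p → coefficients x′ h′ , p , coefficients-combination x′ h′ , sym (coefficients-sum x′ h′))
    (λ (c , p , e , e′) j → subst (λ t → 0ℚ ℚ.< t × t ℚ.< 1ℚ) (coefficients-unique c e (sym e′) j) (p j))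
    (Fin.all? λ j → (0ℚ ℚ.<? coefficients x′ h′ j) ×-dec (coefficients x′ h′ j ℚ.<? 1ℚ))
    where
    x′ = Vec.map toℚ x
    h′ = toℚ h

  interval : ℕ → List ℤ
  interval b = List.map +_ (upTo (suc b))

  interval-unique : ∀ b → Unique (interval b)
  interval-unique b = Unique.map⁺ ℤ.+-injective (Unique.upTo⁺ (suc b))

  interval-complete : ∀ {b i} → toℚ 0ℤ ℚ.≤ toℚ i → toℚ i ℚ.≤ toℚ (+ b) → i ∈ₗ interval b
  interval-complete {b} {i} 0≤i i≤b with toℚ-reflects-≤ 0ℤ i 0≤i | toℚ-reflects-≤ i (+ b) i≤b
  ... | ℤ.+≤+ _ | ℤ.+≤+ m≤b = ∈-map⁺ +_ (∈-upTo⁺ (s≤s m≤b))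

  sides : Vec (List ℤ) n
  sides = tabulate λ i → interval (s i ℕ.* suc n)

  box : List (Vec ℤ n × ℤ)
  box = cartesianProduct (choices sides) (interval (suc n))

  box-unique : Unique box
  box-unique = Unique.cartesianProduct⁺
    (choices-unique sides λ i →
       subst Unique (sym (Vec.lookup∘tabulate _ i)) (interval-unique (s i ℕ.* suc n)))
    (interval-unique (suc n))

  box-complete : ∀ {xh} → Π°-lattice lectureHall-isLatticeSimplex xh → xh ∈ₗ box
  box-complete {x , h} (c , p , e , e′) = ∈-cartesianProduct⁺
    (choices-complete sides λ i → subst (lookup x i ∈ₗ_) (sym (Vec.lookup∘tabulate _ i))
       (interval-complete (lower i) (upper i)))
    (interval-complete (subst (0ℚ ℚ.≤_) (sym e′) (sum-≥0 c c≥0))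
                       (subst (ℚ._≤ toℚ (+ suc n)) (sym e′) (sum-≤ c c≤1)))
    where
    c≥0 : ∀ j → 0ℚ ℚ.≤ c j
    c≥0 j = ℚ.<⇒≤ (proj₁ (p j))
    c≤1 : ∀ j → c j ℚ.≤ 1ℚ
    c≤1 j = ℚ.<⇒≤ (proj₂ (p j))
    s≥0 : ∀ i → ℚ.NonNegative (toℚ (+ s i))
    s≥0 i = ℚ.nonNegative (toℚ-mono-≤ 0ℤ (+ s i) (ℤ.+≤+ z≤n))
    value : ∀ i → toℚ (lookup x i) ≡ toℚ (+ s i) ℚ.* partial c i
    value i = trans (sym (Vec.lookup-map i toℚ x))
                    (trans (cong (λ v → lookup v i) e) (lookup-combination s c i))
    lower : ∀ i → 0ℚ ℚ.≤ toℚ (lookup x i)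
    lower i = subst (0ℚ ℚ.≤_) (sym (value i))
      (subst (ℚ._≤ toℚ (+ s i) ℚ.* partial c i) (ℚ.*-zeroʳ (toℚ (+ s i)))
         (ℚ.*-monoˡ-≤-nonNeg (toℚ (+ s i)) ⦃ s≥0 i ⦄ (partial-≥0 c c≥0 i)))
    upper : ∀ i → toℚ (lookup x i) ℚ.≤ toℚ (+ (s i ℕ.* suc n))
    upper i = subst (ℚ._≤ toℚ (+ (s i ℕ.* suc n))) (sym (value i))
      (subst (toℚ (+ s i) ℚ.* partial c i ℚ.≤_) (trans (toℚ-* (+ s i) (+ suc n))
                                                   (cong toℚ (sym (ℤ.pos-* (s i) (suc n)))))
         (ℚ.*-monoˡ-≤-nonNeg (toℚ (+ s i)) ⦃ s≥0 i ⦄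
            (ℚ.≤-trans (partial-≤-sum c c≥0 i) (sum-≤ c c≤1))))

  latticePoints : Enumeration (Π°-lattice lectureHall-isLatticeSimplex)
  latticePoints = filtered box box-unique Π°-lattice? box-complete

  d : Poly
  d = ℓ* lectureHall-isLatticeSimplex latticePoints

------------------------------------------------------------------------
-- Smirnoff words

record Smirnoff (m r : ℕ) (ω : Vec (Fin r) (suc m)) : Set where
  constructor smirnoff
  field
    first-zero : toℕ (head ω) ≡ 0
    last-zero  : toℕ (last ω) ≡ 0
    distinct   : ∀ (i : Fin m) → lookup ω (inject₁ i) ≢ lookup ω (suc i)

Smirnoff? : ∀ m r → Decidable (Smirnoff m r)
Smirnoff? m r ω = map′
  (λ (a , b , c) → smirnoff a b c)
  (λ (smirnoff a b c) → a , b , c)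
  ((toℕ (head ω) ℕ.≟ 0) ×-dec (toℕ (last ω) ℕ.≟ 0) ×-dec
   Fin.all? λ i → ¬? (lookup ω (inject₁ i) Fin.≟ lookup ω (suc i)))

SW : (m r : ℕ) → Enumeration (Smirnoff m r)
SW m r = filtered (vectors (allFin r) (suc m)) (vectors-unique (Unique.allFin⁺ r) (suc m))
           (Smirnoff? m r) (λ _ → vectors-complete λ i → ∈-allFin _)

des : {m r : ℕ} → Vec (Fin r) (suc m) → ℕ
des {m} ω = length (filter (λ i → lookup ω (suc i) Fin.<? lookup ω (inject₁ i)) (allFin m))

------------------------------------------------------------------------
-- Finite simplicial complexes, h-polynomials and local h-polynomials

record Complex (N : ℕ) : Set₁ where
  field
    Face        : Pred (Subset N) 0ℓ
    Face?       : Decidable Face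
    down-closed : ∀ {F G} → F ⊆ G → Face G → Face F

open Complex public

faces : {N : ℕ} → Complex N → List (Subset N)
faces {N} Ω = filter (Face? Ω) (elements (subsets N))

-- The number of faces with i vertices, i.e. f_{i-1}.
faceCount : {N : ℕ} → Complex N → ℕ → ℕ
faceCount Ω i = length (filter (λ F → ∣ F ∣ ℕ.≟ i) (faces Ω))

-- One more than the dimension.
rank : {N : ℕ} → Complex N → ℕ
rank Ω = foldr _⊔_ 0 (List.map ∣_∣ (faces Ω))

h : {N : ℕ} → Complex N → Poly
h Ω = ∑[ i ∈ upTo (suc (rank Ω)) ] (+ faceCount Ω i) · (z^ i ⊛ 1-z ^^ (rank Ω ∸ i))

-- The combinatorial data of a subdivision of the simplex 2^[m]: each face
-- of the complex lies over the face carrier F of the simplex.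
record Subdivision (m : ℕ) : Set₁ where
  field
    {N}          : ℕ
    complex      : Complex N
    carrier      : Subset N → Subset m
    carrier-mono : ∀ {F G} → F ⊆ G → carrier F ⊆ carrier G

open Subdivision public

restriction : {m : ℕ} (Ω : Subdivision m) → Subset m → Complex (N Ω)
restriction Ω F = record
  { Face        = λ G → Face (complex Ω) G × carrier Ω G ⊆ F
  ; Face?       = λ G → Face? (complex Ω) G ×-dec (carrier Ω G ⊆? F)
  ; down-closed = λ G⊆H (face , over) → down-closed (complex Ω) G⊆H face , over ∘ carrier-mono Ω G⊆H
  }

-- When only the empty face lies over ⊥, as for edgewise subdivisions with
-- r > 0, the summand for F = ⊥ has h-polynomial 1.
localH : {m : ℕ} → Subdivision m → Poly
localH {m} Ω = ∑[ F ∈ elements (subsets m) ] (-1ℤ ℤ.^ (m ∸ ∣ F ∣)) · h (restriction Ω F)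

------------------------------------------------------------------------
-- The edgewise subdivision of 2^[m]

EdgewiseVertex : (m r : ℕ) → Pred (Vec ℕ m) 0ℓ
EdgewiseVertex m r x = Vec.sum x ≡ r

lookup≤sum : {m : ℕ} (x : Vec ℕ m) (i : Fin m) → lookup x i ℕ.≤ Vec.sum x
lookup≤sum (a ∷ x) zero    = ℕ.m≤m+n a (Vec.sum x)
lookup≤sum (a ∷ x) (suc i) = ℕ.≤-trans (lookup≤sum x i) (ℕ.m≤n+m (Vec.sum x) a)

edgewiseVertices : (m r : ℕ) → Enumeration (EdgewiseVertex m r)
edgewiseVertices m r =
  filtered (vectors (upTo (suc r)) m) (vectors-unique (Unique.upTo⁺ (suc r)) m)
    (λ x → Vec.sum x ℕ.≟ r)
    (λ {x} e → vectors-complete λ i → ∈-upTo⁺ (s≤s (subst (lookup x i ℕ.≤_) e (lookup≤sum x i))))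

φ : {m : ℕ} → Vec ℕ m → Vec ℕ m
φ []      = []
φ (a ∷ x) = a ∷ Vec.map (a ℕ.+_) (φ x)

support : {m : ℕ} → Vec ℕ m → Subset m
support = Vec.map (0 <ᵇ_)

-- φ x - φ y ∈ {0,1}ᵐ
Step : {m : ℕ} → Vec ℕ m → Vec ℕ m → Set
Step x y = ∀ i → lookup (φ x) i ⊖ lookup (φ y) i ≡ 0ℤ ⊎ lookup (φ x) i ⊖ lookup (φ y) i ≡ 1ℤ

Step? : {m : ℕ} (x y : Vec ℕ m) → Dec (Step x y)
Step? x y = Fin.all? λ i → (_ ℤ.≟ 0ℤ) ⊎-dec (_ ℤ.≟ 1ℤ)

∈-⋃⁻ : {n : ℕ} {i : Fin n} (ps : List (Subset n)) → i ∈ ⋃ ps → ∃ λ p → p ∈ₗ ps × i ∈ p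
∈-⋃⁻ []       i∈ = contradiction i∈ ∉⊥
∈-⋃⁻ (p ∷ ps) i∈ with x∈p∪q⁻ p (⋃ ps) i∈
... | inj₁ i∈p = p , here refl , i∈p
... | inj₂ i∈⋃ = let q , q∈ , i∈q = ∈-⋃⁻ ps i∈⋃ in q , there q∈ , i∈q

∈-⋃⁺ : {n : ℕ} {i : Fin n} {p : Subset n} (ps : List (Subset n)) → p ∈ₗ ps → i ∈ p → i ∈ ⋃ ps
∈-⋃⁺ (p ∷ ps) (here refl) i∈p = p⊆p∪q (⋃ ps) i∈p
∈-⋃⁺ (q ∷ ps) (there p∈)  i∈p = q⊆p∪q q (⋃ ps) (∈-⋃⁺ ps p∈ i∈p)

-- Vertices are numbered by their position in edgewiseVertices m r.
module _ (m r : ℕ) where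

  edgewiseSize : ℕ
  edgewiseSize = length (elements (edgewiseVertices m r))

  point : Fin edgewiseSize → Vec ℕ m
  point = List.lookup (elements (edgewiseVertices m r))

  edgewiseComplex : Complex edgewiseSize
  edgewiseComplex = record
    { Face        = λ F → ∀ u v → u ∈ F → v ∈ F →
                      Step (point u) (point v) ⊎ Step (point v) (point u)
    ; Face?       = λ F → Fin.all? λ u → Fin.all? λ v → (u ∈? F) →-dec ((v ∈? F) →-dec
                      (Step? (point u) (point v) ⊎-dec Step? (point v) (point u)))
    ; down-closed = λ F⊆G face u v u∈F v∈F → face u v (F⊆G u∈F) (F⊆G v∈F)
    }

  supports : Subset edgewiseSize → List (Subset m)
  supports F = List.map (support ∘ point) (filter (_∈? F) (allFin edgewiseSize))

  supports-mono : ∀ {F G} → F ⊆ G → ⋃ (supports F) ⊆ ⋃ (supports G)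
  supports-mono {F} {G} F⊆G i∈ with ∈-⋃⁻ (supports F) i∈
  ... | p , p∈ , i∈p with ∈-map⁻ (support ∘ point) p∈
  ...   | v , v∈ , refl = ∈-⋃⁺ (supports G)
            (∈-map⁺ (support ∘ point)
              (∈-filter⁺ (_∈? G) (∈-allFin v)
                (F⊆G (proj₂ (∈-filter⁻ (_∈? F) {xs = allFin edgewiseSize} v∈))))) i∈p

  edgewise : Subdivision m
  edgewise = record
    { complex      = edgewiseComplex
    ; carrier      = λ F → ⋃ (supports F)
    ; carrier-mono = supports-mono
    }

{-# OPTIONS --safe #-}
module Submission where

-- All three polynomials enumerate the sequences δ of n + 1 nonzero steps modulo r whose sum is divisible
-- by r, with weight z^(Σδ / r). For lattice points (x , h) of the open parallelepiped, δ consists of the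
-- differences of 0, x₁, …, xₙ, r h; for a Smirnoff word, of the differences of consecutive letters modulo
-- r, so that Σδ is r times the number of descents.
--
-- For the local h-polynomial, a multiset of t vertices of the edgewise subdivision whose support is a
-- face has a sum y with Σy = t r, and every such y arises exactly once: the smallest vertex of the multiset
-- has as prefix sums those of y, divided by t and rounded down. So the face ring over a face F has the
-- Hilbert series of the points y supported on F; writing y = δ + r q with 0 ≤ δᵢ < r, the latter is
-- Σ_δ z^(Σδ / r) / (1 - z)^|F|. The numerator is the h-polynomial, because the rank of a complex is the
-- order of the pole at 1, and inclusion-exclusion over F leaves the δ without zero entries.

import Algebra.Properties.CommutativeSemigroup as CommutativeSemigroup
open import Data.Bool.Base using (true; false; if_then_else_)
import Data.Bool.Properties as Bool
open import Data.Fin.Base as Fin using (Fin; zero; suc; toℕ; inject₁; fromℕ<)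
import Data.Fin.Properties as Fin
open import Data.Fin.Subset using (Subset; inside; outside; ∣_∣; _⊆_; _∈_; ⊥; ⊤)
open import Data.Fin.Subset.Properties using (_∈?_; ∣p∣≤n; ∉⊥)
open import Data.Integer.Base as ℤ using (ℤ; 0ℤ; 1ℤ; -1ℤ; +_; _⊖_)
import Data.Integer.Properties as ℤ
open import Data.List.Base as List using (List; []; _∷_; _++_; allFin; concatMap; filter; foldr; length; map; upTo)
open import Data.List.Membership.Propositional using (find; lose) renaming (_∈_ to _∈ₗ_)
open import Data.List.Membership.Propositional.Properties
  using (∈-++⁺ˡ; ∈-++⁺ʳ; ∈-++⁻; ∈-allFin; ∈-concatMap⁺; ∈-concatMap⁻; ∈-filter⁺; ∈-filter⁻; ∈-lookup; ∈-map⁺; ∈-map⁻; ∈-upTo⁺)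
open import Data.List.Membership.Propositional.Properties.WithK using (unique∧set⇒bag)
import Data.List.Properties as List
open import Data.List.Relation.Binary.BagAndSetEquality using (∼bag⇒↭)
open import Data.List.Relation.Binary.Permutation.Propositional as Perm using (_↭_)
open import Data.List.Relation.Unary.All as All using (All; []; _∷_)
import Data.List.Relation.Unary.All.Properties as All
open import Data.List.Relation.Unary.AllPairs using ([]; _∷_)
open import Data.List.Relation.Unary.Any as Any using (here; there)
import Data.List.Relation.Unary.Any.Properties as Any
open import Data.List.Relation.Unary.Unique.Propositional using (Unique)
import Data.List.Relation.Unary.Unique.Propositional.Properties as Unique
open import Data.Nat.Base as ℕ using (ℕ; zero; suc; _⊔_; _∸_; z≤n; s≤s; NonZero)
import Data.Nat.Divisibility as Div
open import Data.Nat.DivMod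
  using (_/_; _%_; m≡m%n+[m/n]*n; [m+kn]%n≡m%n; m<n⇒m%n≡m; m%n<n; m/n*n≡m; m*n/n≡m; 0/n≡0; /-monoˡ-≤; m/n*n≤m; m/n≤m)
open import Data.Nat.GeneralisedArithmetic using (fold; fold-+)
import Data.Nat.Properties as ℕ
open import Data.Product.Base using (∃; _×_; _,_; proj₁; proj₂)
open import Data.Rational.Base as ℚ using (ℚ; 0ℚ; 1ℚ)
import Data.Rational.Properties as ℚ
open import Data.Sum.Base as Sum using (_⊎_; inj₁; inj₂)
open import Data.Vec.Base as Vec using (Vec; []; _∷_; head; last; lookup; tabulate; updateAt; zipWith)
import Data.Vec.Properties as Vec
open import Function.Base using (_∘_; id)
open import Function.Bundles using (mk⇔)
open import Level using (0ℓ)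
open import Relation.Binary.Definitions using (tri<; tri≈; tri>)
open import Relation.Binary.PropositionalEquality
open import Relation.Nullary.Decidable using (Dec; yes; no; _×-dec_; _→-dec_; ¬?)
open import Relation.Nullary.Negation using (¬_; contradiction)
open import Relation.Unary using (Pred; Decidable)

open import Defs

open CommutativeSemigroup ℤ.+-commutativeSemigroup using (interchange)
open CommutativeSemigroup ℤ.*-commutativeSemigroup using (x∙yz≈y∙xz)
open CommutativeSemigroup ℕ.+-commutativeSemigroup using () renaming (interchange to +-interchange)

-- Finite sums

-- `h` is defined through `rank Ω`, the largest size of a face, and for a restricted edgewise
-- subdivision this number cannot be read off the definition. The proof neither exhibits a face with
-- |F| vertices nor excludes larger ones: the face ring and the points y give the same power series,
-- and the exponent of 1 - z that leaves a finite nonzero value at 1 depends on the series alone.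
-- Rational functions never occur. A series is its coefficient function, multiplication by 1 - z is
-- the difference operator `D`, and the value at 1 is the limit of the partial sums `S`.
--
-- The face condition is exploited in prefix sums. There a face is a chain whose vertices differ by
-- at most one unit in each coordinate. So the members of a multiset on a face take only two values
-- in a coordinate, the average rounded down and that plus one, and the chain order fixes how the
-- coordinates are combined. This is why the sum determines the multiset.

total : {A : Set} → List A → (A → ℤ) → ℤ
total []       w = 0ℤ
total (x ∷ xs) w = w x ℤ.+ total xs w

total-cong : {A : Set} (xs : List A) {w w′ : A → ℤ} →
             (∀ {x} → x ∈ₗ xs → w x ≡ w′ x) → total xs w ≡ total xs w′
total-cong []       e = refl
total-cong (x ∷ xs) e = cong₂ ℤ._+_ (e (here refl)) (total-cong xs (e ∘ there))

total-++ : {A : Set} (xs ys : List A) (w : A → ℤ) → total (xs ++ ys) w ≡ total xs w ℤ.+ total ys w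
total-++ []       ys w = sym (ℤ.+-identityˡ _)
total-++ (x ∷ xs) ys w = trans (cong (ℤ._+_ (w x)) (total-++ xs ys w)) (sym (ℤ.+-assoc (w x) _ _))

total-map : {A B : Set} (f : A → B) (xs : List A) (w : B → ℤ) → total (map f xs) w ≡ total xs (w ∘ f)
total-map f []       w = refl
total-map f (x ∷ xs) w = cong (ℤ._+_ (w (f x))) (total-map f xs w)

total-concatMap : {A B : Set} (f : A → List B) (xs : List A) (w : B → ℤ) →
                  total (concatMap f xs) w ≡ total xs (λ x → total (f x) w)
total-concatMap f []       w = refl
total-concatMap f (x ∷ xs) w =
  trans (total-++ (f x) (concatMap f xs) w) (cong (ℤ._+_ (total (f x) w)) (total-concatMap f xs w))

total-zero : {A : Set} (xs : List A) → total xs (λ _ → 0ℤ) ≡ 0ℤ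
total-zero []       = refl
total-zero (x ∷ xs) = trans (ℤ.+-identityˡ _) (total-zero xs)

total-+ : {A : Set} (xs : List A) (w w′ : A → ℤ) →
          total xs (λ x → w x ℤ.+ w′ x) ≡ total xs w ℤ.+ total xs w′
total-+ []       w w′ = refl
total-+ (x ∷ xs) w w′ =
  trans (cong (ℤ._+_ (w x ℤ.+ w′ x)) (total-+ xs w w′)) (interchange (w x) (w′ x) (total xs w) (total xs w′))

total-*ˡ : {A : Set} (c : ℤ) (xs : List A) (w : A → ℤ) →
           total xs (λ x → c ℤ.* w x) ≡ c ℤ.* total xs w
total-*ˡ c []       w = sym (ℤ.*-zeroʳ c)
total-*ˡ c (x ∷ xs) w = trans (cong (ℤ._+_ (c ℤ.* w x)) (total-*ˡ c xs w)) (sym (ℤ.*-distribˡ-+ c (w x) _))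

total-swap : {A B : Set} (xs : List A) (ys : List B) (w : A → B → ℤ) →
             total xs (λ x → total ys (w x)) ≡ total ys (λ y → total xs (λ x → w x y))
total-swap []       ys w = sym (total-zero ys)
total-swap (x ∷ xs) ys w =
  trans (cong (ℤ._+_ (total ys (w x))) (total-swap xs ys w)) (sym (total-+ ys (w x) _))

total-↭ : {A : Set} {xs ys : List A} (w : A → ℤ) → xs ↭ ys → total xs w ≡ total ys w
total-↭ w Perm.refl         = refl
total-↭ w (Perm.prep x p)   = cong (ℤ._+_ (w x)) (total-↭ w p)
total-↭ w (Perm.swap {xs} {ys} x y p) = begin
  w x ℤ.+ (w y ℤ.+ total xs w) ≡⟨ ℤ.+-assoc (w x) (w y) _ ⟨
  w x ℤ.+ w y ℤ.+ total xs w   ≡⟨ cong₂ ℤ._+_ (ℤ.+-comm (w x) (w y)) (total-↭ w p) ⟩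
  w y ℤ.+ w x ℤ.+ total ys w   ≡⟨ ℤ.+-assoc (w y) (w x) _ ⟩
  w y ℤ.+ (w x ℤ.+ total ys w) ∎
  where open ≡-Reasoning
total-↭ w (Perm.trans p q)  = trans (total-↭ w p) (total-↭ w q)

indicator : {P : Set} → Dec P → ℤ
indicator (yes _) = 1ℤ
indicator (no  _) = 0ℤ

indicator-cong : {P Q : Set} (P? : Dec P) (Q? : Dec Q) → (P → Q) → (Q → P) → indicator P? ≡ indicator Q?
indicator-cong (yes p) (yes q) f g = refl
indicator-cong (yes p) (no ¬q) f g = contradiction (f p) ¬q
indicator-cong (no ¬p) (yes q) f g = contradiction (g q) ¬p
indicator-cong (no ¬p) (no ¬q) f g = refl

total-filter : {A : Set} {P : Pred A 0ℓ} (P? : Decidable P) (xs : List A) (w : A → ℤ) →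
               total (filter P? xs) w ≡ total xs (λ x → w x ℤ.* indicator (P? x))
total-filter P? []       w = refl
total-filter P? (x ∷ xs) w with P? x
... | yes _ = cong₂ ℤ._+_ (sym (ℤ.*-identityʳ (w x))) (total-filter P? xs w)
... | no  _ = trans (total-filter P? xs w)
                    (trans (sym (ℤ.+-identityˡ _)) (cong (ℤ._+ _) (sym (ℤ.*-zeroʳ (w x)))))

length-total : {A : Set} (xs : List A) → + length xs ≡ total xs (λ _ → 1ℤ)
length-total []       = refl
length-total (x ∷ xs) = cong (ℤ._+_ 1ℤ) (length-total xs)

-- Bijections between enumerated sets

map-unique : {A B : Set} (f : A → B) {xs : List A} →
             (∀ {x y} → x ∈ₗ xs → y ∈ₗ xs → f x ≡ f y → x ≡ y) → Unique xs → Unique (map f xs)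
map-unique f inj []       = []
map-unique f inj (x∉ ∷ u) =
  All.map⁺ (All.tabulate λ y∈ fx≡fy → All.lookup x∉ y∈ (inj (here refl) (there y∈) fx≡fy))
  ∷ map-unique f (λ x∈ y∈ → inj (there x∈) (there y∈)) u

record Bijective {A B : Set} (P : Pred A 0ℓ) (Q : Pred B 0ℓ) (f : A → B) : Set where
  field
    image      : ∀ {x} → P x → Q (f x)
    injective  : ∀ {x y} → P x → P y → f x ≡ f y → x ≡ y
    surjective : ∀ {y} → Q y → ∃ λ x → P x × f x ≡ y

open Bijective public

-- Lists without repetition that have the same members are permutations of each other, and `total`
-- ignores order. This is how bijections become equalities of sums.
total-bijective : {A B : Set} {P : Pred A 0ℓ} {Q : Pred B 0ℓ} {f : A → B}
                  (E : Enumeration P) (E′ : Enumeration Q) → Bijective P Q f →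
                  (w : B → ℤ) → total (elements E) (w ∘ f) ≡ total (elements E′) w
total-bijective {f = f} E E′ b w = trans (sym (total-map f (elements E) w)) (total-↭ w
  (∼bag⇒↭ (unique∧set⇒bag
    (map-unique f (λ x∈ y∈ → injective b (sound E x∈) (sound E y∈)) (unique E))
    (unique E′)
    (mk⇔ to from))))
  where
  to : ∀ {y} → y ∈ₗ map f (elements E) → y ∈ₗ elements E′
  to y∈ with x , x∈ , refl ← ∈-map⁻ f y∈ = complete E′ (image b (sound E x∈))
  from : ∀ {y} → y ∈ₗ elements E′ → y ∈ₗ map f (elements E)
  from y∈ with x , Px , refl ← surjective b (sound E′ y∈) = ∈-map⁺ f (complete E Px)

total-≐ : {A : Set} {P Q : Pred A 0ℓ} (E : Enumeration P) (E′ : Enumeration Q) →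
          (∀ {x} → P x → Q x) → (∀ {x} → Q x → P x) → (w : A → ℤ) →
          total (elements E) w ≡ total (elements E′) w
total-≐ E E′ to from = total-bijective E E′
  record { image = to ; injective = λ _ _ → id ; surjective = λ Qy → _ , from Qy , refl }

mapped : {A B : Set} {P : Pred A 0ℓ} {Q : Pred B 0ℓ} (f : A → B) →
         Enumeration P → Bijective P Q f → Enumeration Q
mapped {Q = Q} f E b = record
  { elements = map f (elements E)
  ; unique   = map-unique f (λ x∈ y∈ → injective b (sound E x∈) (sound E y∈)) (unique E)
  ; sound    = sound′
  ; complete = complete′
  }
  where
  sound′ : ∀ {y} → y ∈ₗ map f (elements E) → Q y
  sound′ y∈ with x , x∈ , refl ← ∈-map⁻ f y∈ = image b (sound E x∈)
  complete′ : ∀ {y} → Q y → y ∈ₗ map f (elements E)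
  complete′ Qy with x , Px , refl ← surjective b Qy = ∈-map⁺ f (complete E Px)

-- `κ` recovers the key from every member of its fibre, so fibres over different keys are disjoint
-- and their concatenation has no repetition. The keys will be the support of a multiset and the
-- residue of a point; the form of the list then gives the series fibre by fibre.
fibred : {A B : Set} {K : Pred A 0ℓ} {Q : A → Pred B 0ℓ} (κ : B → A) →
         (∀ {a b} → K a → Q a b → κ b ≡ a) → Enumeration K → (∀ a → Enumeration (Q a)) →
         Enumeration (λ b → K (κ b) × Q (κ b) b)
fibred {K = K} {Q} κ fibre E F = record
  { elements = concatMap (elements ∘ F) (elements E)
  ; unique   = unique′ (elements E) (sound E) (unique E)
  ; sound    = λ b∈ → sound′ (∈-key (elements E) (sound E) b∈)
  ; complete = λ (Kb , Qb) → ∈-concatMap⁺ (elements ∘ F) (lose (complete E Kb) (complete (F _) Qb))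
  }
  where
  ∈-key : ∀ as → (∀ {a} → a ∈ₗ as → K a) → ∀ {b} → b ∈ₗ concatMap (elements ∘ F) as →
          κ b ∈ₗ as × Q (κ b) b
  ∈-key as K-as b∈ with a , a∈ , b∈Fa ← find (∈-concatMap⁻ (elements ∘ F) {xs = as} b∈)
                   with refl ← fibre (K-as a∈) (sound (F a) b∈Fa) = a∈ , sound (F a) b∈Fa
  sound′ : ∀ {b} → κ b ∈ₗ elements E × Q (κ b) b → K (κ b) × Q (κ b) b
  sound′ (κ∈ , Qb) = sound E κ∈ , Qb
  unique′ : ∀ as → (∀ {a} → a ∈ₗ as → K a) → Unique as → Unique (concatMap (elements ∘ F) as)
  unique′ []       K-as []       = []
  unique′ (a ∷ as) K-as (a∉ ∷ u) = Unique.++⁺ (unique (F a)) (unique′ as (K-as ∘ there) u) λ (b∈ , b∈′) →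
    All.lookup a∉ (proj₁ (∈-key as (K-as ∘ there) b∈′)) (sym (fibre (K-as (here refl)) (sound (F a) b∈)))

appended : {A : Set} {P Q : Pred A 0ℓ} → Enumeration P → Enumeration Q →
           (∀ {x} → P x → ¬ Q x) → Enumeration (λ x → P x ⊎ Q x)
appended E E′ disjoint = record
  { elements = elements E ++ elements E′
  ; unique   = Unique.++⁺ (unique E) (unique E′) λ (x∈ , x∈′) → disjoint (sound E x∈) (sound E′ x∈′)
  ; sound    = λ x∈ → Sum.map (sound E) (sound E′) (∈-++⁻ (elements E) x∈)
  ; complete = λ { (inj₁ Px) → ∈-++⁺ˡ (complete E Px) ; (inj₂ Qx) → ∈-++⁺ʳ (elements E) (complete E′ Qx) }
  }

recast : {A : Set} {P Q : Pred A 0ℓ} → (∀ {x} → P x → Q x) → (∀ {x} → Q x → P x) →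
         Enumeration P → Enumeration Q
recast to from E = record
  { elements = elements E ; unique = unique E ; sound = to ∘ sound E ; complete = complete E ∘ from }

size : {A : Set} {P : Pred A 0ℓ} → Enumeration P → ℤ
size E = total (elements E) (λ _ → 1ℤ)

-- Power series

Series : Set
Series = ℕ → ℤ

δ₀ : Series
δ₀ zero    = 1ℤ
δ₀ (suc _) = 0ℤ

-- Multiplication by z, by 1 - z and by 1 / (1 - z).

Z D S : Series → Series
Z f zero    = 0ℤ
Z f (suc t) = f t
D f t = f t ℤ.- Z f t
S f zero    = f zero
S f (suc t) = S f t ℤ.+ f (suc t)

-- Series are functions, compared pointwise, so compatibility with `≗` is demanded as the field
-- `respects`.
record Linear (T : Series → Series) : Set where
  field
    respects : ∀ {f g} → f ≗ g → T f ≗ T g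
    zeros    : T (λ _ → 0ℤ) ≗ λ _ → 0ℤ
    plus     : ∀ f g → T (λ t → f t ℤ.+ g t) ≗ λ t → T f t ℤ.+ T g t

open Linear

linear-total : ∀ {T} → Linear T → {A : Set} (xs : List A) (w : A → Series) →
               T (λ t → total xs (λ x → w x t)) ≗ λ t → total xs (λ x → T (w x) t)
linear-total L []       w t = zeros L t
linear-total {T} L (x ∷ xs) w t =
  trans (plus L (w x) (λ t → total xs (λ x → w x t)) t) (cong (ℤ._+_ (T (w x) t)) (linear-total L xs w t))

Z-linear : Linear Z
Z-linear = record
  { respects = λ { e zero → refl ; e (suc t) → e t }
  ; zeros    = λ { zero → refl ; (suc t) → refl }
  ; plus     = λ { f g zero → refl ; f g (suc t) → refl }
  }

D-linear : Linear D
D-linear = record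
  { respects = λ e t → cong₂ ℤ._-_ (e t) (respects Z-linear e t)
  ; zeros    = λ t → cong (λ a → 0ℤ ℤ.- a) (zeros Z-linear t)
  ; plus     = λ f g t → trans
      (cong (λ a → f t ℤ.+ g t ℤ.- a) (plus Z-linear f g t))
      (trans (cong (ℤ._+_ (f t ℤ.+ g t)) (ℤ.neg-distrib-+ (Z f t) (Z g t)))
             (interchange (f t) (g t) (ℤ.- Z f t) (ℤ.- Z g t)))
  }

fold-linear : ∀ {T} → Linear T → ∀ k → Linear (λ f → fold f T k)
fold-linear L zero    = record { respects = id ; zeros = λ _ → refl ; plus = λ _ _ _ → refl }
fold-linear {T} L (suc k) = record
  { respects = λ e → respects L (respects IH e)
  ; zeros    = λ t → trans (respects L (zeros IH) t) (zeros L t)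
  ; plus     = λ f g t → trans (respects L (plus IH f g) t) (plus L (fold f T k) (fold g T k) t)
  }
  where IH = fold-linear L k

D-Z : ∀ f → D (Z f) ≗ Z (D f)
D-Z f zero    = refl
D-Z f (suc t) = refl

S-Z : ∀ f → S (Z f) ≗ Z (S f)
S-Z f zero          = refl
S-Z f (suc zero)    = ℤ.+-identityˡ _
S-Z f (suc (suc t)) = cong (ℤ._+ f (suc t)) (S-Z f (suc t))

S-respects : ∀ {f g} → f ≗ g → S f ≗ S g
S-respects e zero    = e zero
S-respects e (suc t) = cong₂ ℤ._+_ (S-respects e t) (e (suc t))

S-linear : Linear S
S-linear = record { respects = S-respects ; zeros = zeros′ ; plus = plus′ }
  where
  zeros′ : S (λ _ → 0ℤ) ≗ λ _ → 0ℤ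
  zeros′ zero    = refl
  zeros′ (suc t) = cong (ℤ._+ 0ℤ) (zeros′ t)
  plus′ : ∀ f g → S (λ t → f t ℤ.+ g t) ≗ λ t → S f t ℤ.+ S g t
  plus′ f g zero    = refl
  plus′ f g (suc t) = trans (cong (ℤ._+ (f (suc t) ℤ.+ g (suc t))) (plus′ f g t))
                            (interchange (S f t) (S g t) (f (suc t)) (g (suc t)))

i+[j-i]≡j : ∀ a b → a ℤ.+ (b ℤ.- a) ≡ b
i+[j-i]≡j a b = begin
  a ℤ.+ (b ℤ.- a) ≡⟨ ℤ.+-comm a (b ℤ.- a) ⟩
  b ℤ.- a ℤ.+ a   ≡⟨ ℤ.+-assoc b (ℤ.- a) a ⟩
  b ℤ.+ (ℤ.- a ℤ.+ a) ≡⟨ cong (ℤ._+_ b) (ℤ.+-inverseˡ a) ⟩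
  b ℤ.+ 0ℤ        ≡⟨ ℤ.+-identityʳ b ⟩
  b               ∎
  where open ≡-Reasoning

S-D : ∀ f → S (D f) ≗ f
S-D f zero    = ℤ.+-identityʳ (f zero)
S-D f (suc t) = trans (cong (ℤ._+ D f (suc t)) (S-D f t)) (i+[j-i]≡j (f t) (f (suc t)))

D-S : ∀ f → D (S f) ≗ f
D-S f zero    = ℤ.+-identityʳ (f zero)
D-S f (suc t) = trans (ℤ.+-assoc (S f t) (f (suc t)) (ℤ.- S f t)) (i+[j-i]≡j (S f t) (f (suc t)))

fold-commute : {T U : Series → Series} → Linear U → (∀ f → T (U f) ≗ U (T f)) → ∀ k f → T (fold f U k) ≗ fold (T f) U k
fold-commute L c zero    f t = refl
fold-commute {T} {U} L c (suc k) f t = trans (c (fold f U k) t) (respects L (fold-commute L c k f) t)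

fold-D-Z : ∀ k f → fold (Z f) D k ≗ Z (fold f D k)
fold-D-Z zero    f t = refl
fold-D-Z (suc k) f t = trans (respects D-linear (fold-D-Z k f) t) (D-Z (fold f D k) t)

-- Eventually constant series

-- Meant mainly for partial sums: if `f` is a polynomial, then `S f` is eventually the constant
-- f(1). This limit replaces evaluation at 1.
Eventually : Series → ℤ → Set
Eventually f c = ∃ λ T → ∀ t → T ℕ.≤ t → f t ≡ c

eventually-cong : ∀ {f g c} → f ≗ g → Eventually g c → Eventually f c
eventually-cong e (T , p) = T , λ t T≤t → trans (e t) (p t T≤t)

eventually-unique : ∀ {f c c′} → Eventually f c → Eventually f c′ → c ≡ c′
eventually-unique (T , p) (T′ , p′) = trans (sym (p (T ⊔ T′) (ℕ.m≤m⊔n T T′))) (p′ (T ⊔ T′) (ℕ.m≤n⊔m T T′))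

eventually-Z : ∀ {f c} → Eventually f c → Eventually (Z f) c
eventually-Z (T , p) = suc T , λ { (suc t) (s≤s T≤t) → p t T≤t }

eventually-D : ∀ {f c} → Eventually f c → Eventually (D f) 0ℤ
eventually-D {c = c} (T , p) =
  suc T , λ { (suc t) (s≤s T≤t) →
    trans (cong₂ ℤ._-_ (p (suc t) (ℕ.m≤n⇒m≤1+n T≤t)) (p t T≤t)) (ℤ.+-inverseʳ c) }

eventually-fold : {T : Series → Series} {c : ℤ} → (∀ {f} → Eventually f c → Eventually (T f) c) →
                  ∀ k {f} → Eventually f c → Eventually (fold f T k) c
eventually-fold p zero    e = e
eventually-fold p (suc k) e = p (eventually-fold p k e)

eventually-total : {A : Set} (xs : List A) (w : A → Series) (c : A → ℤ) →
                   (∀ {x} → x ∈ₗ xs → Eventually (w x) (c x)) →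
                   Eventually (λ t → total xs (λ x → w x t)) (total xs c)
eventually-total []       w c p = 0 , λ _ _ → refl
eventually-total (x ∷ xs) w c p
  with T , q ← p (here refl) | T′ , q′ ← eventually-total xs w c (p ∘ there) =
  T ⊔ T′ , λ t le → cong₂ ℤ._+_ (q t (ℕ.≤-trans (ℕ.m≤m⊔n T T′) le)) (q′ t (ℕ.≤-trans (ℕ.m≤n⊔m T T′) le))

eventually-δ₀ : Eventually δ₀ 0ℤ
eventually-δ₀ = 1 , λ { (suc t) _ → refl }

eventually-Sδ₀ : Eventually (S δ₀) 1ℤ
eventually-Sδ₀ = 0 , λ t _ → eq t
  where
  eq : ∀ t → S δ₀ t ≡ 1ℤ
  eq zero    = refl
  eq (suc t) = cong (ℤ._+ 0ℤ) (eq t)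

monomial : ℕ → Series
monomial i = fold δ₀ Z i

eventually-S-monomial : ∀ i → Eventually (S (monomial i)) 1ℤ
eventually-S-monomial i =
  eventually-cong (fold-commute Z-linear S-Z i δ₀) (eventually-fold eventually-Z i eventually-Sδ₀)

-- A polynomial divisible by 1 - z vanishes at 1: `S` cancels one factor `D`, and what remains has
-- only finitely many nonzero coefficients.
eventually-S-multiple : ∀ i k → Eventually (S (fold (fold δ₀ D (suc k)) Z i)) 0ℤ
eventually-S-multiple i k = eventually-cong
  (λ t → trans (fold-commute Z-linear S-Z i _ t) (respects (fold-linear Z-linear i) (S-D (fold δ₀ D k)) t))
  (eventually-fold eventually-Z i (eventually-fold eventually-D k eventually-δ₀))

-- A nonzero limit of S (D^d P) says that P has a pole of order exactly d at 1.
PoleOrder : Series → ℕ → Set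
PoleOrder P d = ∃ λ c → c ≢ 0ℤ × Eventually (S (fold P D d)) c

poleOrder-≮ : ∀ {P d e} → PoleOrder P d → PoleOrder P e → ∀ k → e ≢ suc k ℕ.+ d
poleOrder-≮ {P} {d} (c , _ , p) (c′ , c′≢0 , p′) k refl = c′≢0 (eventually-unique p′ vanishing)
  where
  Q = fold P D d
  -- `S` cancels one of the extra factors, and `Q` is `D` of the eventually constant `S Q`, hence
  -- eventually zero, which further factors `D` preserve.
  vanishing : Eventually (S (fold P D (suc k ℕ.+ d))) 0ℤ
  vanishing = eventually-cong
    (λ t → trans (cong (λ f → S f t) (fold-+ P D (suc k) {d})) (S-D (fold Q D k) t))
    (eventually-fold eventually-D k (eventually-cong (λ t → sym (D-S Q t)) (eventually-D p)))

poleOrder-unique : ∀ {P d e} → PoleOrder P d → PoleOrder P e → d ≡ e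
poleOrder-unique {P} {d} {e} p q with ℕ.<-cmp d e
... | tri≈ _ d≡e _ = d≡e
... | tri< d<e _ _ with k , eq ← ℕ.m≤n⇒∃[o]m+o≡n d<e =
  contradiction (trans (sym eq) (cong suc (ℕ.+-comm d k))) (poleOrder-≮ p q k)
... | tri> _ _ e<d with k , eq ← ℕ.m≤n⇒∃[o]m+o≡n e<d =
  contradiction (trans (sym eq) (cong suc (ℕ.+-comm e k))) (poleOrder-≮ q p k)

-- Coefficients of polynomials

coeff-⊕ : ∀ p q k → coeff (p ⊕ q) k ≡ coeff p k ℤ.+ coeff q k
coeff-⊕ []      q       k       = sym (ℤ.+-identityˡ _)
coeff-⊕ (a ∷ p) []      k       = sym (ℤ.+-identityʳ _)
coeff-⊕ (a ∷ p) (b ∷ q) zero    = refl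
coeff-⊕ (a ∷ p) (b ∷ q) (suc k) = coeff-⊕ p q k

coeff-· : ∀ a p k → coeff (a · p) k ≡ a ℤ.* coeff p k
coeff-· a []      k       = sym (ℤ.*-zeroʳ a)
coeff-· a (b ∷ p) zero    = refl
coeff-· a (b ∷ p) (suc k) = coeff-· a p k

coeff-∑ : {A : Set} (xs : List A) (f : A → Poly) → coeff (∑ xs f) ≗ λ k → total xs (λ x → coeff (f x) k)
coeff-∑ []       f k = refl
coeff-∑ (x ∷ xs) f k = trans (coeff-⊕ (f x) (∑ xs f) k) (cong (ℤ._+_ (coeff (f x) k)) (coeff-∑ xs f k))

convolve : Series → Series → Series
convolve f g zero    = f zero ℤ.* g zero
convolve f g (suc k) = f zero ℤ.* g (suc k) ℤ.+ convolve (f ∘ suc) g k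

convolve-zero : ∀ g → convolve (λ _ → 0ℤ) g ≗ λ _ → 0ℤ
convolve-zero g zero    = refl
convolve-zero g (suc k) = trans (ℤ.+-identityˡ _) (convolve-zero g k)

convolve-cong : ∀ {f f′} g → f ≗ f′ → convolve f g ≗ convolve f′ g
convolve-cong g e zero    = cong (ℤ._* g zero) (e zero)
convolve-cong g e (suc k) = cong₂ ℤ._+_ (cong (ℤ._* g (suc k)) (e zero)) (convolve-cong g (e ∘ suc) k)

convolve-Z : ∀ f g → convolve (Z f) g ≗ Z (convolve f g)
convolve-Z f g zero    = refl
convolve-Z f g (suc k) = ℤ.+-identityˡ _

convolve-δ₀ : ∀ g → convolve δ₀ g ≗ g
convolve-δ₀ g zero    = ℤ.*-identityˡ (g zero)
convolve-δ₀ g (suc k) =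
  trans (cong₂ ℤ._+_ (ℤ.*-identityˡ (g (suc k))) (convolve-zero g k)) (ℤ.+-identityʳ (g (suc k)))

convolve-monomial : ∀ i g → convolve (monomial i) g ≗ fold g Z i
convolve-monomial zero    g   = convolve-δ₀ g
convolve-monomial (suc i) g t =
  trans (convolve-Z (monomial i) g t) (respects Z-linear (convolve-monomial i g) t)

coeff-⊛ : ∀ p q → coeff (p ⊛ q) ≗ convolve (coeff p) (coeff q)
coeff-⊛ []      q k = sym (convolve-zero (coeff q) k)
coeff-⊛ (a ∷ p) q k = trans (coeff-⊕ (a · q) (0ℤ ∷ p ⊛ q) k) (shifted k)
  where
  shifted : ∀ k → coeff (a · q) k ℤ.+ coeff (0ℤ ∷ p ⊛ q) k ≡ convolve (coeff (a ∷ p)) (coeff q) k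
  shifted zero    = trans (ℤ.+-identityʳ _) (coeff-· a q zero)
  shifted (suc k) = cong₂ ℤ._+_ (coeff-· a q (suc k)) (coeff-⊛ p q k)

coeff-constant-1 : coeff (constant 1ℤ) ≗ δ₀
coeff-constant-1 zero    = refl
coeff-constant-1 (suc k) = refl

coeff-z^ : ∀ i → coeff (z^ i) ≗ monomial i
coeff-z^ zero    = coeff-constant-1
coeff-z^ (suc i) k = begin
  coeff ((0ℤ ∷ 1ℤ ∷ []) ⊛ (z^ i)) k         ≡⟨ coeff-⊛ (0ℤ ∷ 1ℤ ∷ []) (z^ i) k ⟩
  convolve (coeff (0ℤ ∷ 1ℤ ∷ [])) (coeff (z^ i)) k ≡⟨ convolve-cong _ z-coeff k ⟩
  convolve (Z δ₀) (coeff (z^ i)) k         ≡⟨ convolve-Z δ₀ _ k ⟩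
  Z (convolve δ₀ (coeff (z^ i))) k         ≡⟨ respects Z-linear (convolve-δ₀ _) k ⟩
  Z (coeff (z^ i)) k                       ≡⟨ respects Z-linear (coeff-z^ i) k ⟩
  monomial (suc i) k                       ∎
  where
  open ≡-Reasoning
  z-coeff : coeff (0ℤ ∷ 1ℤ ∷ []) ≗ Z δ₀
  z-coeff zero          = refl
  z-coeff (suc zero)    = refl
  z-coeff (suc (suc k)) = refl

coeff-1-z^ : ∀ j → coeff (1-z ^^ j) ≗ fold δ₀ D j
coeff-1-z^ zero    = coeff-constant-1
coeff-1-z^ (suc j) k = trans (coeff-⊛ 1-z p k) (trans (times k) (respects D-linear (coeff-1-z^ j) k))
  where
  p = 1-z ^^ j
  times : convolve (coeff 1-z) (coeff p) ≗ D (coeff p)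
  times zero          = trans (ℤ.*-identityˡ (coeff p 0)) (sym (ℤ.+-identityʳ (coeff p 0)))
  times (suc zero)    = cong₂ ℤ._+_ (ℤ.*-identityˡ (coeff p 1)) (ℤ.-1*i≡-i (coeff p 0))
  times (suc (suc k)) = cong₂ ℤ._+_ (ℤ.*-identityˡ (coeff p (suc (suc k))))
    (trans (cong₂ ℤ._+_ (ℤ.-1*i≡-i (coeff p (suc k))) (convolve-zero (coeff p) k))
           (ℤ.+-identityʳ (ℤ.- coeff p (suc k))))

coeff-z^1-z^ : ∀ i j → coeff (z^ i ⊛ 1-z ^^ j) ≗ fold (fold δ₀ D j) Z i
coeff-z^1-z^ i j k = begin
  coeff (z^ i ⊛ 1-z ^^ j) k                 ≡⟨ coeff-⊛ (z^ i) (1-z ^^ j) k ⟩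
  convolve (coeff (z^ i)) (coeff (1-z ^^ j)) k ≡⟨ convolve-cong _ (coeff-z^ i) k ⟩
  convolve (monomial i) (coeff (1-z ^^ j)) k ≡⟨ convolve-monomial i _ k ⟩
  fold (coeff (1-z ^^ j)) Z i k              ≡⟨ respects (fold-linear Z-linear i) (coeff-1-z^ j) k ⟩
  fold (fold δ₀ D j) Z i k                   ∎
  where open ≡-Reasoning

-- h-polynomials

-- Both cases go through one induction: once `j` is met at the head, uniqueness makes it absent from
-- the tail, and the second case disposes of the rest.
total-indicator : {xs : List ℕ} → Unique xs → (w : ℕ → ℤ) → ∀ j →
                  (j ∈ₗ xs → total xs (λ i → w i ℤ.* indicator (j ℕ.≟ i)) ≡ w j)
                  × (All (j ≢_) xs → total xs (λ i → w i ℤ.* indicator (j ℕ.≟ i)) ≡ 0ℤ)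
total-indicator []                  w j = (λ ()) , λ _ → refl
total-indicator {x ∷ xs} (x∉ ∷ u) w j with j ℕ.≟ x | total-indicator u w j
... | yes refl | _ , absent = (λ _ → trans (cong₂ ℤ._+_ (ℤ.*-identityʳ (w x)) (absent x∉)) (ℤ.+-identityʳ _))
                            , λ { (j≢x ∷ _) → contradiction refl j≢x }
... | no j≢x | present , absent =
  (λ { (here j≡x) → contradiction j≡x j≢x ; (there j∈) → trans drop-zero (present j∈) })
  , λ { (_ ∷ j∉) → trans drop-zero (absent j∉) }
  where
  drop-zero : ∀ {a} → w x ℤ.* 0ℤ ℤ.+ a ≡ a
  drop-zero {a} = trans (cong (ℤ._+ a) (ℤ.*-zeroʳ (w x))) (ℤ.+-identityˡ a)

-- Passes from the f-vector to one summand per face. The definition of `h` collects the faces by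
-- size, whereas the Hilbert series has a term for each face.
total-by-size : {A : Set} (size : A → ℕ) (xs : List A) (K : ℕ) (w : ℕ → ℤ) →
                (∀ {x} → x ∈ₗ xs → size x ℕ.< K) →
                total (upTo K) (λ i → + length (filter (λ x → size x ℕ.≟ i) xs) ℤ.* w i)
                ≡ total xs (w ∘ size)
total-by-size size xs K w bound = begin
  total (upTo K) (λ i → + length (filter (λ x → size x ℕ.≟ i) xs) ℤ.* w i)
    ≡⟨ total-cong (upTo K) (λ {i} _ → expand i) ⟩
  total (upTo K) (λ i → total xs (λ x → w i ℤ.* indicator (size x ℕ.≟ i)))
    ≡⟨ total-swap (upTo K) xs _ ⟩
  total xs (λ x → total (upTo K) (λ i → w i ℤ.* indicator (size x ℕ.≟ i)))
    ≡⟨ total-cong xs (λ {x} x∈ → proj₁ (total-indicator (Unique.upTo⁺ K) w (size x)) (∈-upTo⁺ (bound x∈))) ⟩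
  total xs (w ∘ size) ∎
  where
  open ≡-Reasoning
  expand : ∀ i → + length (filter (λ x → size x ℕ.≟ i) xs) ℤ.* w i
                 ≡ total xs (λ x → w i ℤ.* indicator (size x ℕ.≟ i))
  expand i = begin
    + length (filter (λ x → size x ℕ.≟ i) xs) ℤ.* w i
      ≡⟨ ℤ.*-comm _ (w i) ⟩
    w i ℤ.* + length (filter (λ x → size x ℕ.≟ i) xs)
      ≡⟨ cong (ℤ._*_ (w i)) (length-total (filter (λ x → size x ℕ.≟ i) xs)) ⟩
    w i ℤ.* total (filter (λ x → size x ℕ.≟ i) xs) (λ _ → 1ℤ)
      ≡⟨ cong (ℤ._*_ (w i)) (trans (total-filter (λ x → size x ℕ.≟ i) xs (λ _ → 1ℤ))
           (total-cong xs λ _ → ℤ.*-identityˡ _)) ⟩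
    w i ℤ.* total xs (λ x → indicator (size x ℕ.≟ i))
      ≡⟨ total-*ˡ (w i) xs _ ⟨
    total xs (λ x → w i ℤ.* indicator (size x ℕ.≟ i)) ∎

∣face∣≤rank : ∀ {N} (Ω : Complex N) {G} → G ∈ₗ faces Ω → ∣ G ∣ ℕ.≤ rank Ω
∣face∣≤rank Ω = bound (faces Ω)
  where
  bound : ∀ Gs {G} → G ∈ₗ Gs → ∣ G ∣ ℕ.≤ foldr _⊔_ 0 (map ∣_∣ Gs)
  bound (G ∷ Gs) (here refl) = ℕ.m≤m⊔n ∣ G ∣ _
  bound (G ∷ Gs) (there G∈)  = ℕ.≤-trans (bound Gs G∈) (ℕ.m≤n⊔m ∣ G ∣ _)

coeff-h : ∀ {N} (Ω : Complex N) → coeff (h Ω) ≗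
          λ t → total (faces Ω) (λ G → fold (fold δ₀ D (rank Ω ∸ ∣ G ∣)) Z ∣ G ∣ t)
coeff-h Ω t = begin
  coeff (h Ω) t
    ≡⟨ coeff-∑ (upTo (suc (rank Ω))) (λ i → (+ faceCount Ω i) · (z^ i ⊛ 1-z ^^ (rank Ω ∸ i))) t ⟩
  total (upTo (suc (rank Ω))) (λ i → coeff ((+ faceCount Ω i) · (z^ i ⊛ 1-z ^^ (rank Ω ∸ i))) t)
    ≡⟨ total-cong (upTo (suc (rank Ω))) (λ {i} _ → trans (coeff-· (+ faceCount Ω i) (z^ i ⊛ 1-z ^^ (rank Ω ∸ i)) t)
         (cong (ℤ._*_ (+ faceCount Ω i)) (coeff-z^1-z^ i (rank Ω ∸ i) t))) ⟩
  total (upTo (suc (rank Ω))) (λ i → + faceCount Ω i ℤ.* fold (fold δ₀ D (rank Ω ∸ i)) Z i t)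
    ≡⟨ total-by-size ∣_∣ (faces Ω) (suc (rank Ω)) (λ i → fold (fold δ₀ D (rank Ω ∸ i)) Z i t)
         (s≤s ∘ ∣face∣≤rank Ω) ⟩
  total (faces Ω) (λ G → fold (fold δ₀ D (rank Ω ∸ ∣ G ∣)) Z ∣ G ∣ t) ∎
  where open ≡-Reasoning

lookup-ext : {A : Set} {m : ℕ} {x y : Vec A m} → (∀ i → lookup x i ≡ lookup y i) → x ≡ y
lookup-ext {x = x} {y} e =
  trans (sym (Vec.tabulate∘lookup x)) (trans (Vec.tabulate-cong e) (Vec.tabulate∘lookup y))

sum-replicate-0 : ∀ m → Vec.sum (Vec.replicate m 0) ≡ 0
sum-replicate-0 zero    = refl
sum-replicate-0 (suc m) = sum-replicate-0 m

-- Vectors supported on a given set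

Vanish : {m : ℕ} → Subset m → Pred (Vec ℕ m) 0ℓ
Vanish F q = ∀ i → lookup F i ≡ outside → lookup q i ≡ 0

Vanish? : {m : ℕ} (F : Subset m) → Decidable (Vanish F)
Vanish? F q = Fin.all? λ i → (lookup F i Bool.≟ outside) →-dec (lookup q i ℕ.≟ 0)

vanish-∷ : ∀ {m b a} {F : Subset m} {q} → (b ≡ outside → a ≡ 0) → Vanish F q → Vanish (b ∷ F) (a ∷ q)
vanish-∷ p v zero    = p
vanish-∷ p v (suc i) = v i

Within : {m : ℕ} → Subset m → ℕ → Pred (Vec ℕ m) 0ℓ
Within F t q = Vanish F q × Vec.sum q ≡ t

increment : {m : ℕ} → Vec ℕ (suc m) → Vec ℕ (suc m)
increment (a ∷ q) = suc a ∷ q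

prepend-0 : ∀ {m b t} {F : Subset m} → Bijective (Within F t) (λ q → head q ≡ 0 × Within (b ∷ F) t q) (0 ∷_)
prepend-0 = record
  { image      = λ (v , e) → refl , vanish-∷ (λ _ → refl) v , e
  ; injective  = λ _ _ → Vec.∷-injectiveʳ
  ; surjective = λ { {_ ∷ q} (refl , v , e) → q , (v ∘ suc , e) , refl }
  }

increment-bijective : ∀ {m t} {F : Subset m} →
  Bijective (Within (inside ∷ F) t) (λ q → head q ≢ 0 × Within (inside ∷ F) (suc t) q) increment
increment-bijective = record
  { image      = λ { {_ ∷ _} (v , e) → (λ ()) , vanish-∷ (λ ()) (v ∘ suc) , cong suc e }
  ; injective  = λ { {_ ∷ _} {_ ∷ _} _ _ e →
                     cong₂ _∷_ (ℕ.suc-injective (Vec.∷-injectiveˡ e)) (Vec.∷-injectiveʳ e) }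
  ; surjective = λ { {zero  ∷ q} (0≢0 , _)   → contradiction refl 0≢0
                   ; {suc a ∷ q} (_ , v , e) →
                       a ∷ q , (vanish-∷ (λ ()) (v ∘ suc) , ℕ.suc-injective e) , refl }
  }

-- Built by recursion rather than by filtering a box, so that the sizes visibly obey the recurrence
-- for division by 1 - z: a vector with a free first entry starts with 0, or is an `increment` of
-- one whose sum is smaller by one.
within : {m : ℕ} (F : Subset m) (t : ℕ) → Enumeration (Within F t)
within [] zero = record
  { elements = [] ∷ [] ; unique = All.[] ∷ [] ; sound = λ { (here refl) → (λ ()) , refl }
  ; complete = λ { {[]} _ → here refl } }
within [] (suc t) = record
  { elements = [] ; unique = [] ; sound = λ () ; complete = λ { {[]} (_ , ()) } }
within (outside ∷ F) t =
  recast proj₂ (λ { {_ ∷ _} (v , e) → v zero refl , v , e }) (mapped (0 ∷_) (within F t) prepend-0)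
within (inside ∷ F) zero =
  recast proj₂ (λ { {a ∷ _} (v , e) → ℕ.m+n≡0⇒m≡0 a e , v , e }) (mapped (0 ∷_) (within F zero) prepend-0)
within (inside ∷ F) (suc t) =
  recast (λ {q} → Sum.[ proj₂ , proj₂ ]) (λ {q} → split {q})
    (appended (mapped (0 ∷_) (within F (suc t)) prepend-0)
              (mapped increment (within (inside ∷ F) t) increment-bijective)
              (λ (h≡0 , _) (h≢0 , _) → h≢0 h≡0))
  where
  split : ∀ {q} → Within (inside ∷ F) (suc t) q →
          (head q ≡ 0 × Within (inside ∷ F) (suc t) q) ⊎ (head q ≢ 0 × Within (inside ∷ F) (suc t) q)
  split {zero  ∷ q} w = inj₁ (refl , w)
  split {suc a ∷ q} w = inj₂ ((λ ()) , w)

-- The series 1 / (1 - z)^|F|; `fold-D-W` says so without division.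
W : {m : ℕ} → Subset m → Series
W F t = size (within F t)

W-outside : ∀ {m} (F : Subset m) → W (outside ∷ F) ≗ W F
W-outside F t = total-map (0 ∷_) (elements (within F t)) _

D-W-inside : ∀ {m} (F : Subset m) → D (W (inside ∷ F)) ≗ W F
D-W-inside F zero    = trans (ℤ.+-identityʳ _) (total-map (0 ∷_) (elements (within F zero)) _)
D-W-inside F (suc t) = begin
  W (inside ∷ F) (suc t) ℤ.- W (inside ∷ F) t
    ≡⟨ cong (ℤ._- W (inside ∷ F) t) (trans (total-++ (map (0 ∷_) (elements (within F (suc t)))) _ _)
         (cong₂ ℤ._+_ (total-map (0 ∷_) (elements (within F (suc t))) _)
                      (total-map increment (elements (within (inside ∷ F) t)) _))) ⟩
  W F (suc t) ℤ.+ W (inside ∷ F) t ℤ.- W (inside ∷ F) t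
    ≡⟨ ℤ.+-assoc (W F (suc t)) _ _ ⟩
  W F (suc t) ℤ.+ (W (inside ∷ F) t ℤ.- W (inside ∷ F) t)
    ≡⟨ cong (ℤ._+_ (W F (suc t))) (ℤ.+-inverseʳ (W (inside ∷ F) t)) ⟩
  W F (suc t) ℤ.+ 0ℤ
    ≡⟨ ℤ.+-identityʳ _ ⟩
  W F (suc t) ∎
  where open ≡-Reasoning

fold-D-W : ∀ {m} (F : Subset m) → fold (W F) D ∣ F ∣ ≗ δ₀
fold-D-W []            zero    = refl
fold-D-W []            (suc t) = refl
fold-D-W (outside ∷ F) t = trans (respects (fold-linear D-linear ∣ F ∣) (W-outside F) t) (fold-D-W F t)
fold-D-W (inside ∷ F)  t = begin
  D (fold (W (inside ∷ F)) D k) t ≡⟨ fold-commute {T = D} D-linear (λ _ _ → refl) k (W (inside ∷ F)) t ⟩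
  fold (D (W (inside ∷ F))) D k t ≡⟨ respects (fold-linear D-linear k) (D-W-inside F) t ⟩
  fold (W F) D k t                ≡⟨ fold-D-W F t ⟩
  δ₀ t                                ∎
  where
  open ≡-Reasoning
  k = ∣ F ∣

-- Translates b + c q, with the vectors q supported on F

affine : {m : ℕ} → ℕ → Vec ℕ m → Vec ℕ m → Vec ℕ m
affine c = zipWith (λ b a → b ℕ.+ a ℕ.* c)

lookup-affine : ∀ {m} c (b q : Vec ℕ m) i → lookup (affine c b q) i ≡ lookup b i ℕ.+ lookup q i ℕ.* c
lookup-affine c b q i = Vec.lookup-zipWith _ i b q

affine-injective : ∀ {m} c .{{_ : NonZero c}} (b : Vec ℕ m) {q q′} → affine c b q ≡ affine c b q′ → q ≡ q′
affine-injective c b {q} {q′} e = lookup-ext λ i → ℕ.*-cancelʳ-≡ _ _ c (ℕ.+-cancelˡ-≡ (lookup b i) _ _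
  (trans (sym (lookup-affine c b q i)) (trans (cong (λ y → lookup y i) e) (lookup-affine c b q′ i))))

sum-affine : ∀ {m} c (b q : Vec ℕ m) → Vec.sum (affine c b q) ≡ Vec.sum b ℕ.+ Vec.sum q ℕ.* c
sum-affine c []      []      = refl
sum-affine c (b ∷ bs) (a ∷ q) = begin
  b ℕ.+ a ℕ.* c ℕ.+ Vec.sum (affine c bs q)              ≡⟨ cong (b ℕ.+ a ℕ.* c ℕ.+_) (sum-affine c bs q) ⟩
  b ℕ.+ a ℕ.* c ℕ.+ (Vec.sum bs ℕ.+ Vec.sum q ℕ.* c)     ≡⟨ ℕ.+-assoc b (a ℕ.* c) _ ⟩
  b ℕ.+ (a ℕ.* c ℕ.+ (Vec.sum bs ℕ.+ Vec.sum q ℕ.* c))   ≡⟨ cong (b ℕ.+_) (ℕ.+-assoc (a ℕ.* c) (Vec.sum bs) _) ⟨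
  b ℕ.+ (a ℕ.* c ℕ.+ Vec.sum bs ℕ.+ Vec.sum q ℕ.* c)     ≡⟨ cong (λ s → b ℕ.+ (s ℕ.+ Vec.sum q ℕ.* c)) (ℕ.+-comm (a ℕ.* c) (Vec.sum bs)) ⟩
  b ℕ.+ (Vec.sum bs ℕ.+ a ℕ.* c ℕ.+ Vec.sum q ℕ.* c)     ≡⟨ cong (b ℕ.+_) (ℕ.+-assoc (Vec.sum bs) (a ℕ.* c) _) ⟩
  b ℕ.+ (Vec.sum bs ℕ.+ (a ℕ.* c ℕ.+ Vec.sum q ℕ.* c))   ≡⟨ ℕ.+-assoc b (Vec.sum bs) _ ⟨
  b ℕ.+ Vec.sum bs ℕ.+ (a ℕ.* c ℕ.+ Vec.sum q ℕ.* c)     ≡⟨ cong (b ℕ.+ Vec.sum bs ℕ.+_) (ℕ.*-distribʳ-+ c a (Vec.sum q)) ⟨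
  b ℕ.+ Vec.sum bs ℕ.+ (a ℕ.+ Vec.sum q) ℕ.* c           ∎
  where open ≡-Reasoning

-- `e` is the degree of the base point `b`, so these sets have the series z^e / (1 - z)^|F|. There
-- are two uses: a multiset with support exactly `G` is `ones G` plus any `q` on `G`, with `c` equal
-- to 1; a point of the dilate is a residue plus `r` times `q`, with `c` equal to `r`.
Translate : {m : ℕ} → ℕ → Vec ℕ m → Subset m → ℕ → ℕ → Pred (Vec ℕ m) 0ℓ
Translate c b F e t y = ∃ λ q → y ≡ affine c b q × Vanish F q × e ℕ.+ Vec.sum q ≡ t

translate : {m : ℕ} (c : ℕ) .{{_ : NonZero c}} (b : Vec ℕ m) (F : Subset m) (e t : ℕ) →
            Enumeration (Translate c b F e t)
translate c b F zero    t       = mapped (affine c b) (within F t) record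
  { image      = λ {q} w → q , refl , w
  ; injective  = λ _ _ → affine-injective c b
  ; surjective = λ (q , e , w) → q , w , sym e
  }
translate c b F (suc e) zero    = record
  { elements = [] ; unique = [] ; sound = λ () ; complete = λ { (_ , _ , _ , ()) } }
translate c b F (suc e) (suc t) =
  recast (λ (q , e , v , s) → q , e , v , cong suc s) (λ (q , e , v , s) → q , e , v , ℕ.suc-injective s)
    (translate c b F e t)

size-translate : ∀ {m} c .{{_ : NonZero c}} (b : Vec ℕ m) F e t →
                 size (translate c b F e t) ≡ fold (W F) Z e t
size-translate c b F zero    t       = total-map (affine c b) (elements (within F t)) _
size-translate c b F (suc e) zero    = refl
size-translate c b F (suc e) (suc t) = size-translate c b F e t

translates-total : ∀ {m} {A : Set} c .{{_ : NonZero c}} (as : List A) (b : A → Vec ℕ m) (F : A → Subset m)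
                   (e : A → ℕ) t →
                   total (concatMap (λ a → elements (translate c (b a) (F a) (e a) t)) as) (λ _ → 1ℤ)
                   ≡ total as (λ a → fold (W (F a)) Z (e a) t)
translates-total c as b F e t = trans (total-concatMap _ as _)
  (total-cong as λ {a} _ → size-translate c (b a) (F a) (e a) t)

-- Multisets of vertices whose support is a face

ones : {N : ℕ} → Subset N → Vec ℕ N
ones = Vec.map (λ b → if b then 1 else 0)

sum-ones : ∀ {N} (G : Subset N) → Vec.sum (ones G) ≡ ∣ G ∣
sum-ones []            = refl
sum-ones (inside ∷ G)  = cong suc (sum-ones G)
sum-ones (outside ∷ G) = sum-ones G

support-affine-ones : ∀ {N} (G : Subset N) q → Vanish G q → support (affine 1 (ones G) q) ≡ G
support-affine-ones []            []      v = refl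
support-affine-ones (inside ∷ G)  (a ∷ q) v = cong (inside ∷_) (support-affine-ones G q (v ∘ suc))
support-affine-ones (outside ∷ G) (a ∷ q) v with refl ← v zero refl =
  cong (outside ∷_) (support-affine-ones G q (v ∘ suc))

affine-ones-support : ∀ {N} (μ : Vec ℕ N) →
                      μ ≡ affine 1 (ones (support μ)) (Vec.map ℕ.pred μ) × Vanish (support μ) (Vec.map ℕ.pred μ)
affine-ones-support []          = refl , λ ()
affine-ones-support (zero ∷ μ)  = let e , v = affine-ones-support μ in cong (0 ∷_) e , vanish-∷ (λ _ → refl) v
affine-ones-support (suc a ∷ μ) =
  let e , v = affine-ones-support μ in cong₂ _∷_ (cong suc (sym (ℕ.*-identityʳ a))) e , vanish-∷ (λ ()) v

FaceMultiset : {N : ℕ} → Complex N → ℕ → Pred (Vec ℕ N) 0ℓ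
FaceMultiset Ω t μ = Face Ω (support μ) × Vec.sum μ ≡ t

faceEnumeration : {N : ℕ} (Ω : Complex N) → Enumeration (Face Ω)
faceEnumeration {N} Ω = filtered (elements (subsets N)) (unique (subsets N)) (Face? Ω) (λ _ → complete (subsets N) _)

faceMultisets : {N : ℕ} (Ω : Complex N) (t : ℕ) → Enumeration (FaceMultiset Ω t)
faceMultisets Ω t =
  recast (λ (face , tr) → face , to tr) (λ (face , e) → face , from e)
    (fibred support (λ { {G} _ (q , refl , v , _) → support-affine-ones G q v })
      (faceEnumeration Ω) (λ G → translate 1 (ones G) G ∣ G ∣ t))
  where
  sum-formula : ∀ {N} (G : Subset N) q → Vec.sum (affine 1 (ones G) q) ≡ ∣ G ∣ ℕ.+ Vec.sum q
  sum-formula G q = trans (sum-affine 1 (ones G) q) (cong₂ ℕ._+_ (sum-ones G) (ℕ.*-identityʳ _))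
  to : ∀ {N} {G : Subset N} {μ} → Translate 1 (ones G) G ∣ G ∣ t μ → Vec.sum μ ≡ t
  to {G = G} (q , refl , v , e) = trans (sum-formula G q) e
  from : ∀ {N} {μ : Vec ℕ N} → Vec.sum μ ≡ t → Translate 1 (ones (support μ)) (support μ) ∣ support μ ∣ t μ
  from {μ = μ} e with eq , v ← affine-ones-support μ =
    Vec.map ℕ.pred μ , eq , v , trans (sym (sum-formula (support μ) _)) (trans (cong Vec.sum (sym eq)) e)

-- The Hilbert series of the face ring.
multisetSeries : {N : ℕ} → Complex N → Series
multisetSeries Ω t = size (faceMultisets Ω t)

multisetSeries-faces : ∀ {N} (Ω : Complex N) →
                       multisetSeries Ω ≗ λ t → total (faces Ω) (λ G → fold (W G) Z ∣ G ∣ t)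
multisetSeries-faces Ω t = translates-total 1 (faces Ω) ones id ∣_∣ t

-- Each face contributes z^|G| / (1 - z)^|G|, whose denominator uses up |G| of the `rank Ω` factors.
-- The right side is that of `coeff-h`, so the h-polynomial is the Hilbert series times (1 -
-- z)^rank.
fold-D-multisetSeries : ∀ {N} (Ω : Complex N) →
  fold (multisetSeries Ω) D (rank Ω) ≗ λ t → total (faces Ω) (λ G → fold (fold δ₀ D (rank Ω ∸ ∣ G ∣)) Z ∣ G ∣ t)
fold-D-multisetSeries Ω t = begin
  fold (multisetSeries Ω) D (rank Ω) t
    ≡⟨ respects L (multisetSeries-faces Ω) t ⟩
  fold (λ t → total (faces Ω) (λ G → fold (W G) Z ∣ G ∣ t)) D (rank Ω) t
    ≡⟨ linear-total L (faces Ω) (λ G → fold (W G) Z ∣ G ∣) t ⟩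
  total (faces Ω) (λ G → fold (fold (W G) Z ∣ G ∣) D (rank Ω) t)
    ≡⟨ total-cong (faces Ω) (λ {G} G∈ → summand G (∣face∣≤rank Ω G∈)) ⟩
  total (faces Ω) (λ G → fold (fold δ₀ D (rank Ω ∸ ∣ G ∣)) Z ∣ G ∣ t) ∎
  where
  open ≡-Reasoning
  L = fold-linear D-linear (rank Ω)
  summand : ∀ G → ∣ G ∣ ℕ.≤ rank Ω →
            fold (fold (W G) Z ∣ G ∣) D (rank Ω) t ≡ fold (fold δ₀ D (rank Ω ∸ ∣ G ∣)) Z ∣ G ∣ t
  summand G G≤ = begin
    fold (fold (W G) Z g) D (rank Ω) t
      ≡⟨ fold-commute Z-linear (fold-D-Z (rank Ω)) g (W G) t ⟩
    fold (fold (W G) D (rank Ω)) Z g t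
      ≡⟨ cong (λ k → fold (fold (W G) D k) Z g t) (sym (ℕ.m∸n+n≡m G≤)) ⟩
    fold (fold (W G) D (rank Ω ∸ g ℕ.+ g)) Z g t
      ≡⟨ cong (λ f → fold f Z g t) (fold-+ (W G) D (rank Ω ∸ g)) ⟩
    fold (fold (fold (W G) D g) D (rank Ω ∸ g)) Z g t
      ≡⟨ respects (fold-linear Z-linear g)
           (respects (fold-linear D-linear (rank Ω ∸ g)) (fold-D-W G)) t ⟩
    fold (fold δ₀ D (rank Ω ∸ g)) Z g t ∎
    where
    g = ∣ G ∣

-- At 1, a face of maximal size contributes 1 and a smaller one 0, since a factor 1 - z is left
-- over. The limit is therefore the number of faces of size `rank Ω`. It is positive because a
-- maximum over a nonempty list is attained, and the face `⊥` makes the list nonempty.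
multisetSeries-poleOrder : ∀ {N} (Ω : Complex N) → Face Ω ⊥ → PoleOrder (multisetSeries Ω) (rank Ω)
multisetSeries-poleOrder Ω face-⊥ =
  total (faces Ω) limit , limit≢0 , eventually-cong (λ t → trans (respects S-linear (fold-D-multisetSeries Ω) t)
      (linear-total S-linear (faces Ω) _ t))
    (eventually-total (faces Ω) _ limit λ {G} G∈ → summand ∣ G ∣ (rank Ω) (∣face∣≤rank Ω G∈))
  where
  limit : Subset _ → ℤ
  limit G = indicator (∣ G ∣ ℕ.≟ rank Ω)
  summand : ∀ i d → i ℕ.≤ d → Eventually (S (fold (fold δ₀ D (d ∸ i)) Z i)) (indicator (i ℕ.≟ d))
  summand i d i≤d with i ℕ.≟ d
  ... | yes refl = subst (λ k → Eventually (S (fold (fold δ₀ D k) Z i)) 1ℤ) (sym (ℕ.n∸n≡0 i)) (eventually-S-monomial i)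
  ... | no i≢d with k , refl ← ℕ.m≤n⇒∃[o]m+o≡n (ℕ.≤∧≢⇒< i≤d i≢d) =
    subst (λ j → Eventually (S (fold (fold δ₀ D j) Z i)) 0ℤ)
          (sym (trans (cong (_∸ i) (sym (ℕ.+-suc i k))) (ℕ.m+n∸m≡n i (suc k)))) (eventually-S-multiple i k)
  attained : ∀ Gs {G} → G ∈ₗ Gs → ∃ λ G′ → G′ ∈ₗ Gs × ∣ G′ ∣ ≡ foldr _⊔_ 0 (map ∣_∣ Gs)
  attained (G ∷ [])      _ = G , here refl , sym (ℕ.⊔-identityʳ _)
  attained (G ∷ G′ ∷ Gs) _ with ℕ.⊔-sel ∣ G ∣ (foldr _⊔_ 0 (map ∣_∣ (G′ ∷ Gs))) | attained (G′ ∷ Gs) (here refl)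
  ... | inj₁ e | _           = G , here refl , sym e
  ... | inj₂ e | M , M∈ , e′ = M , there M∈ , trans e′ (sym e)
  limit-nonneg : ∀ G → 0ℤ ℤ.≤ limit G
  limit-nonneg G with ∣ G ∣ ℕ.≟ rank Ω
  ... | yes _ = ℤ.+≤+ z≤n
  ... | no _  = ℤ.≤-refl
  total-nonneg : ∀ Gs → 0ℤ ℤ.≤ total Gs limit
  total-nonneg []       = ℤ.≤-refl
  total-nonneg (G ∷ Gs) = ℤ.+-mono-≤ (limit-nonneg G) (total-nonneg Gs)
  limit≡1 : ∀ {G} → ∣ G ∣ ≡ rank Ω → limit G ≡ 1ℤ
  limit≡1 {G} e with ∣ G ∣ ℕ.≟ rank Ω
  ... | yes _ = refl
  ... | no ≢  = contradiction e ≢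
  total-pos : ∀ Gs {G} → G ∈ₗ Gs → ∣ G ∣ ≡ rank Ω → 1ℤ ℤ.≤ total Gs limit
  total-pos (G ∷ Gs) (here refl) e = ℤ.+-mono-≤ (ℤ.≤-reflexive (sym (limit≡1 {G} e))) (total-nonneg Gs)
  total-pos (G ∷ Gs) (there G∈)  e = ℤ.+-mono-≤ (limit-nonneg G) (total-pos Gs G∈ e)
  limit≢0 : total (faces Ω) limit ≢ 0ℤ
  limit≢0 ≡0 with G , G∈ , e ← attained (faces Ω) (complete (faceEnumeration Ω) face-⊥)
             with total-pos (faces Ω) G∈ e
  ... | 1≤ with ℤ.+≤+ () ← subst (1ℤ ℤ.≤_) ≡0 1≤

open Linear


-- Points of the dilated simplex and their residues

Residue : {m : ℕ} → ℕ → Subset m → Pred (Vec ℕ m) 0ℓ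
Residue r F δ = (∀ i → lookup δ i ℕ.< r) × r Div.∣ Vec.sum δ × Vanish F δ

residues : {m : ℕ} (r : ℕ) (F : Subset m) → Enumeration (Residue r F)
residues {m} r F = filtered (vectors (upTo r) m) (vectors-unique (Unique.upTo⁺ r) m)
  (λ δ → Fin.all? (λ i → lookup δ i ℕ.<? r) ×-dec (r Div.∣? Vec.sum δ) ×-dec Vanish? F δ)
  (λ (δ<r , _) → vectors-complete λ i → ∈-upTo⁺ (δ<r i))

module _ (r : ℕ) .{{_ : NonZero r}} where

  level : {m : ℕ} → Vec ℕ m → ℕ
  level δ = Vec.sum δ / r

  remainders quotients : {m : ℕ} → Vec ℕ m → Vec ℕ m
  remainders = Vec.map (_% r)
  quotients  = Vec.map (_/ r)

  DilatePoint : {m : ℕ} → Subset m → ℕ → Pred (Vec ℕ m) 0ℓ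
  DilatePoint F t y = Vanish F y × Vec.sum y ≡ t ℕ.* r

  remainders-affine : ∀ {m} {δ : Vec ℕ m} q → (∀ i → lookup δ i ℕ.< r) → remainders (affine r δ q) ≡ δ
  remainders-affine {δ = δ} q δ<r = lookup-ext λ i → begin
    lookup (remainders (affine r δ q)) i     ≡⟨ Vec.lookup-map i (_% r) (affine r δ q) ⟩
    lookup (affine r δ q) i % r              ≡⟨ cong (_% r) (lookup-affine r δ q i) ⟩
    (lookup δ i ℕ.+ lookup q i ℕ.* r) % r    ≡⟨ [m+kn]%n≡m%n (lookup δ i) (lookup q i) r ⟩
    lookup δ i % r                           ≡⟨ m<n⇒m%n≡m (δ<r i) ⟩
    lookup δ i                               ∎
    where open ≡-Reasoning

  affine-remainders-quotients : ∀ {m} (y : Vec ℕ m) → y ≡ affine r (remainders y) (quotients y)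
  affine-remainders-quotients y = lookup-ext λ i → sym (begin
    lookup (affine r (remainders y) (quotients y)) i
      ≡⟨ lookup-affine r (remainders y) (quotients y) i ⟩
    lookup (remainders y) i ℕ.+ lookup (quotients y) i ℕ.* r
      ≡⟨ cong₂ (λ a b → a ℕ.+ b ℕ.* r) (Vec.lookup-map i (_% r) y) (Vec.lookup-map i (_/ r) y) ⟩
    lookup y i % r ℕ.+ lookup y i / r ℕ.* r
      ≡⟨ m≡m%n+[m/n]*n (lookup y i) r ⟨
    lookup y i ∎)
    where open ≡-Reasoning

  sum-affine-level : ∀ {m} (δ : Vec ℕ m) q → r Div.∣ Vec.sum δ →
                     Vec.sum (affine r δ q) ≡ (level δ ℕ.+ Vec.sum q) ℕ.* r
  sum-affine-level δ q r∣δ = begin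
    Vec.sum (affine r δ q)                      ≡⟨ sum-affine r δ q ⟩
    Vec.sum δ ℕ.+ Vec.sum q ℕ.* r               ≡⟨ cong (ℕ._+ Vec.sum q ℕ.* r) (m/n*n≡m r∣δ) ⟨
    level δ ℕ.* r ℕ.+ Vec.sum q ℕ.* r           ≡⟨ ℕ.*-distribʳ-+ r (level δ) (Vec.sum q) ⟨
    (level δ ℕ.+ Vec.sum q) ℕ.* r               ∎
    where open ≡-Reasoning

  dilatePoints : {m : ℕ} (F : Subset m) (t : ℕ) → Enumeration (DilatePoint F t)
  dilatePoints F t =
    recast (λ (res , tr) → to res tr) (λ {y} → from y)
      (fibred remainders (λ { (δ<r , _) (q , refl , _) → remainders-affine q δ<r })
        (residues r F) (λ δ → translate r δ F (level δ) t))
    where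
    to : ∀ {δ y} → Residue r F δ → Translate r δ F (level δ) t y → DilatePoint F t y
    to {δ} (_ , r∣δ , v) (q , refl , v′ , e) =
      (λ i i∉F → trans (lookup-affine r δ q i) (cong₂ (λ a b → a ℕ.+ b ℕ.* r) (v i i∉F) (v′ i i∉F)))
      , trans (sum-affine-level δ q r∣δ) (cong (ℕ._* r) e)
    from : ∀ y → DilatePoint F t y →
           Residue r F (remainders y) × Translate r (remainders y) F (level (remainders y)) t y
    from y (v , e) =
      ((λ i → subst (ℕ._< r) (sym (Vec.lookup-map i (_% r) y)) (m%n<n _ r)) , r∣δ
        , λ i i∉F → trans (Vec.lookup-map i (_% r) y) (trans (cong (_% r) (v i i∉F)) (m<n⇒m%n≡m (ℕ.>-nonZero⁻¹ r))))
      , q , affine-remainders-quotients y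
      , (λ i i∉F → trans (Vec.lookup-map i (_/ r) y) (trans (cong (_/ r) (v i i∉F)) (0/n≡0 r)))
      , ℕ.*-cancelʳ-≡ _ _ r (trans (sym (sum-affine-level (remainders y) q r∣δ)) (trans (cong Vec.sum (sym (affine-remainders-quotients y))) e))
      where
      q = quotients y
      r∣δ : r Div.∣ Vec.sum (remainders y)
      -- The sum of `y` is t r, and it exceeds the sum of the remainders by r times the sum of the
      -- quotients.
      r∣δ = Div.∣m+n∣m⇒∣n {m = Vec.sum q ℕ.* r}
        (subst (r Div.∣_)
          (trans (sym e) (trans (cong Vec.sum (affine-remainders-quotients y))
            (trans (sum-affine r (remainders y) q) (ℕ.+-comm (Vec.sum (remainders y)) _))))
          (Div.n∣m*n t))
        (Div.n∣m*n (Vec.sum q))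

  dilateSeries : {m : ℕ} → Subset m → Series
  dilateSeries F t = size (dilatePoints F t)

  fold-D-dilateSeries : ∀ {m} (F : Subset m) →
    fold (dilateSeries F) D (∣ F ∣) ≗ λ t → total (elements (residues r F)) (λ δ → monomial (level δ) t)
  fold-D-dilateSeries F t = begin
    fold (dilateSeries F) D k t
      ≡⟨ respects L (λ t → translates-total r (elements (residues r F)) id (λ _ → F) level t) t ⟩
    fold (λ t → total (elements (residues r F)) (λ δ → fold (W F) Z (level δ) t)) D k t
      ≡⟨ linear-total L (elements (residues r F)) (λ δ → fold (W F) Z (level δ)) t ⟩
    total (elements (residues r F)) (λ δ → fold (fold (W F) Z (level δ)) D k t)
      ≡⟨ total-cong (elements (residues r F)) (λ {δ} _ → trans
           (fold-commute Z-linear (fold-D-Z k) (level δ) (W F) t)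
           (respects (fold-linear Z-linear (level δ)) (fold-D-W F) t)) ⟩
    total (elements (residues r F)) (λ δ → monomial (level δ) t) ∎
    where
    open ≡-Reasoning
    k = ∣ F ∣
    L = fold-linear D-linear k

  -- Each residue contributes a monomial, with value 1 at 1. So the limit is the number of residues,
  -- which is not 0 because the zero vector is one.
  dilateSeries-poleOrder : ∀ {m} (F : Subset m) → PoleOrder (dilateSeries F) (∣ F ∣)
  dilateSeries-poleOrder {m} F =
    size (residues r F) , size≢0 (elements (residues r F)) (complete (residues r F) {Vec.replicate m 0} zero-residue)
    , eventually-cong (λ t → trans (respects S-linear (fold-D-dilateSeries F) t)
                                   (linear-total S-linear (elements (residues r F)) _ t))
        (eventually-total (elements (residues r F)) _ (λ _ → 1ℤ) (λ {δ} _ → eventually-S-monomial (level δ)))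
    where
    size≢0 : ∀ {A : Set} (xs : List A) {x} → x ∈ₗ xs → total xs (λ _ → 1ℤ) ≢ 0ℤ
    size≢0 (x ∷ xs) _ e with () ← trans (length-total (x ∷ xs)) e
    zero-residue : Residue r F (Vec.replicate m 0)
    zero-residue = (λ i → subst (ℕ._< r) (sym (Vec.lookup-replicate i 0)) (ℕ.>-nonZero⁻¹ r))
      , subst (r Div.∣_) (sym (sum-replicate-0 m)) (r Div.∣0)
      , λ i _ → Vec.lookup-replicate i 0

-- The h-polynomial clears the denominator with exponent `rank Ω`, the residues do so with exponent
-- |F|. Both exponents are pole orders of one series, hence equal, and then both numerators agree.
coeff-h-dilate : ∀ {m N} (r : ℕ) .{{_ : NonZero r}} (F : Subset m) (Ω : Complex N) → Face Ω ⊥ →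
                 multisetSeries Ω ≗ dilateSeries r F →
                 coeff (h Ω) ≗ λ t → total (elements (residues r F)) (λ δ → monomial (level r δ) t)
coeff-h-dilate r F Ω face-⊥ e t = begin
  coeff (h Ω) t                            ≡⟨ coeff-h Ω t ⟩
  _                                        ≡⟨ fold-D-multisetSeries Ω t ⟨
  fold (multisetSeries Ω) D (rank Ω) t     ≡⟨ respects (fold-linear D-linear (rank Ω)) e t ⟩
  fold (dilateSeries r F) D (rank Ω) t     ≡⟨ cong (λ k → fold (dilateSeries r F) D k t) rank≡ ⟩
  fold (dilateSeries r F) D (∣ F ∣) t      ≡⟨ fold-D-dilateSeries r F t ⟩
  total (elements (residues r F)) (λ δ → monomial (level r δ) t) ∎
  where
  open ≡-Reasoning
  transport : ∀ {d} → PoleOrder (multisetSeries Ω) d → PoleOrder (dilateSeries r F) d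
  transport {d} (c , c≢0 , ev) =
    c , c≢0 , eventually-cong (respects S-linear (respects (fold-linear D-linear d) (sym ∘ e))) ev
  rank≡ : rank Ω ≡ ∣ F ∣
  rank≡ = poleOrder-unique (transport {rank Ω} (multisetSeries-poleOrder Ω face-⊥)) (dilateSeries-poleOrder r F)

-- Sums weighted by a multiset

dot : {N : ℕ} → Vec ℕ N → (Fin N → ℕ) → ℕ
dot []      f = 0
dot (a ∷ μ) f = a ℕ.* f zero ℕ.+ dot μ (f ∘ suc)

dot-cong : ∀ {N} (μ : Vec ℕ N) {f g} → f ≗ g → dot μ f ≡ dot μ g
dot-cong []      e = refl
dot-cong (a ∷ μ) e = cong₂ ℕ._+_ (cong (a ℕ.*_) (e zero)) (dot-cong μ (e ∘ suc))

dot-+ : ∀ {N} (μ : Vec ℕ N) f g → dot μ (λ v → f v ℕ.+ g v) ≡ dot μ f ℕ.+ dot μ g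
dot-+ []      f g = refl
dot-+ (a ∷ μ) f g = trans
  (cong₂ ℕ._+_ (ℕ.*-distribˡ-+ a (f zero) (g zero)) (dot-+ μ (f ∘ suc) (g ∘ suc)))
  (+-interchange (a ℕ.* f zero) (a ℕ.* g zero) _ _)

dot-const : ∀ {N} (μ : Vec ℕ N) c → dot μ (λ _ → c) ≡ Vec.sum μ ℕ.* c
dot-const []      c = refl
dot-const (a ∷ μ) c = trans (cong (a ℕ.* c ℕ.+_) (dot-const μ c)) (sym (ℕ.*-distribʳ-+ c a (Vec.sum μ)))

dot-zero : ∀ {N} (μ : Vec ℕ N) → dot μ (λ _ → 0) ≡ 0
dot-zero μ = trans (dot-const μ 0) (ℕ.*-zeroʳ (Vec.sum μ))

dot-replicate-0 : ∀ N (f : Fin N → ℕ) → dot (Vec.replicate N 0) f ≡ 0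
dot-replicate-0 zero    f = refl
dot-replicate-0 (suc N) f = dot-replicate-0 N (f ∘ suc)

dot-mono : ∀ {N} (μ : Vec ℕ N) {f g} → (∀ v → lookup μ v ≢ 0 → f v ℕ.≤ g v) → dot μ f ℕ.≤ dot μ g
dot-mono []          p = z≤n
dot-mono (zero ∷ μ)  p = dot-mono μ (p ∘ suc)
dot-mono (suc a ∷ μ) p = ℕ.+-mono-≤ (ℕ.*-monoʳ-≤ (suc a) (p zero (λ ()))) (dot-mono μ (p ∘ suc))

dot≡0 : ∀ {N} (μ : Vec ℕ N) {f} → dot μ f ≡ 0 → ∀ v → lookup μ v ≢ 0 → f v ≡ 0
dot≡0 (zero ∷ μ)  e zero    0≢0 = contradiction refl 0≢0
dot≡0 (suc a ∷ μ) e zero    _   = ℕ.m+n≡0⇒m≡0 _ (ℕ.m+n≡0⇒m≡0 _ e)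
dot≡0 (a ∷ μ)     e (suc v) ≢0  = dot≡0 μ (ℕ.m+n≡0⇒n≡0 (a ℕ.* _) e) v ≢0

dot-insert : ∀ {N} (μ : Vec ℕ N) u f → dot (updateAt μ u suc) f ≡ f u ℕ.+ dot μ f
dot-insert (a ∷ μ) zero    f = ℕ.+-assoc (f zero) (a ℕ.* f zero) _
dot-insert (a ∷ μ) (suc u) f = trans (cong (a ℕ.* f zero ℕ.+_) (dot-insert μ u (f ∘ suc)))
  (trans (sym (ℕ.+-assoc (a ℕ.* f zero) (f (suc u)) _))
  (trans (cong (ℕ._+ dot μ (f ∘ suc)) (ℕ.+-comm (a ℕ.* f zero) (f (suc u)))) (ℕ.+-assoc (f (suc u)) _ _)))

sum-insert : ∀ {N} (μ : Vec ℕ N) u → Vec.sum (updateAt μ u suc) ≡ suc (Vec.sum μ)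
sum-insert (a ∷ μ) zero    = refl
sum-insert (a ∷ μ) (suc u) = trans (cong (a ℕ.+_) (sum-insert μ u)) (ℕ.+-suc a _)

insert-preserves : ∀ {N} (μ : Vec ℕ N) u {v} → lookup μ v ≢ 0 → lookup (updateAt μ u suc) v ≢ 0
insert-preserves (a ∷ μ) zero    {zero}  _  ()
insert-preserves (a ∷ μ) zero    {suc v} ≢0 = ≢0
insert-preserves (a ∷ μ) (suc u) {zero}  ≢0 = ≢0
insert-preserves (a ∷ μ) (suc u) {suc v} ≢0 = insert-preserves μ u ≢0

insert-reflects : ∀ {N} (μ : Vec ℕ N) u v → lookup (updateAt μ u suc) v ≢ 0 → v ≡ u ⊎ lookup μ v ≢ 0
insert-reflects (a ∷ μ) zero    zero    _  = inj₁ refl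
insert-reflects (a ∷ μ) zero    (suc v) ≢0 = inj₂ ≢0
insert-reflects (a ∷ μ) (suc u) zero    ≢0 = inj₂ ≢0
insert-reflects (a ∷ μ) (suc u) (suc v) ≢0 = Sum.map₁ (cong suc) (insert-reflects μ u v ≢0)

extract : ∀ {N} (μ : Vec ℕ N) u → lookup μ u ≢ 0 → ∃ λ μ′ → μ ≡ updateAt μ′ u suc
extract (zero  ∷ μ) zero    0≢0 = contradiction refl 0≢0
extract (suc a ∷ μ) zero    _   = a ∷ μ , refl
extract (a     ∷ μ) (suc u) ≢0  = let μ′ , e = extract μ u ≢0 in a ∷ μ′ , cong (a ∷_) e

occurring : ∀ {N} (μ : Vec ℕ N) {t} → Vec.sum μ ≡ suc t → ∃ λ v → lookup μ v ≢ 0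
occurring (suc a ∷ μ) e = zero , λ ()
occurring (zero ∷ μ)  e = let v , ≢0 = occurring μ e in suc v , ≢0

sum≡0 : ∀ {N} (μ : Vec ℕ N) → Vec.sum μ ≡ 0 → ∀ v → lookup μ v ≡ 0
sum≡0 μ e v = ℕ.n≤0⇒n≡0 (subst (lookup μ v ℕ.≤_) e (lookup≤sum μ v))

-- Multisets supported on a chain

module _ {N m : ℕ} (X : Fin N → Fin m → ℕ) where

  -- With prefix sums for `X`, this is `Step` from `u` up to `v`, written as inequalities between
  -- natural numbers.
  Near : Fin N → Fin N → Set
  Near v u = ∀ i → X u i ℕ.≤ X v i × X v i ℕ.≤ suc (X u i)

  Chain : Vec ℕ N → Set
  Chain μ = ∀ u v → lookup μ u ≢ 0 → lookup μ v ≢ 0 → Near u v ⊎ Near v u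

  chain-tail : ∀ μ u → Chain (updateAt μ u suc) → Chain μ
  chain-tail μ u chain v w ≢0 ≢0′ = chain v w (insert-preserves μ u ≢0) (insert-preserves μ u ≢0′)

  minimum : ∀ μ {t} → Vec.sum μ ≡ suc t → Chain μ →
            ∃ λ u → lookup μ u ≢ 0 × (∀ v → lookup μ v ≢ 0 → Near v u)
  minimum μ e chain =
    let v , ≢0          = occurring μ e
        u , u∈ , u-min = least occurrences ∈⇒≢0 (≢0⇒∈ ≢0)
    in u , ∈⇒≢0 u∈ , λ w w≢0 → near (∈⇒≢0 u∈) w≢0 (u-min (≢0⇒∈ w≢0))
    where
    occurs? : Decidable (λ v → lookup μ v ≢ 0)
    occurs? v = ¬? (lookup μ v ℕ.≟ 0)
    occurrences : List (Fin N)
    occurrences = filter occurs? (allFin N)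
    ∈⇒≢0 : ∀ {v} → v ∈ₗ occurrences → lookup μ v ≢ 0
    ∈⇒≢0 v∈ = proj₂ (∈-filter⁻ occurs? {xs = allFin N} v∈)
    ≢0⇒∈ : ∀ {v} → lookup μ v ≢ 0 → v ∈ₗ occurrences
    ≢0⇒∈ ≢0 = ∈-filter⁺ occurs? (∈-allFin _) ≢0
    -- Nearness is not transitive, as two unit steps may add up to 2. The search therefore keeps
    -- only the order, and `near` recovers the bound by one from the chain condition on each single
    -- pair.
    least : ∀ vs → (∀ {v} → v ∈ₗ vs → lookup μ v ≢ 0) → ∀ {v} → v ∈ₗ vs →
         ∃ λ u → u ∈ₗ vs × (∀ {w} → w ∈ₗ vs → ∀ i → X u i ℕ.≤ X w i)
    least (v ∷ [])      _  _ = v , here refl , λ { (here refl) i → ℕ.≤-refl }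
    least (v ∷ v′ ∷ vs) ≢0 _
      with u , u∈ , u-min ← least (v′ ∷ vs) (≢0 ∘ there) (here refl)
      with chain u v (≢0 (there u∈)) (≢0 (here refl))
    ... | inj₁ v≤u = v , here refl , λ { (here refl) i → ℕ.≤-refl
                                       ; (there w∈)  i → ℕ.≤-trans (proj₁ (v≤u i)) (u-min w∈ i) }
    ... | inj₂ u≤v = u , there u∈ , λ { (here refl) i → proj₁ (u≤v i) ; (there w∈) i → u-min w∈ i }
    near : ∀ {u w} → lookup μ u ≢ 0 → lookup μ w ≢ 0 → (∀ i → X u i ℕ.≤ X w i) → Near w u
    near {u} {w} u≢0 w≢0 u≤w with chain u w u≢0 w≢0
    ... | inj₁ w≤u = λ i → u≤w i , ℕ.m≤n⇒m≤1+n (proj₁ (w≤u i))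
    ... | inj₂ w≥u = w≥u

  -- The smallest element of a chain is the rounded down average.
  minimum-bounds : ∀ μ u → (∀ v → lookup (updateAt μ u suc) v ≢ 0 → Near v u) → ∀ i →
    let V = dot (updateAt μ u suc) (λ v → X v i) in
    suc (Vec.sum μ) ℕ.* X u i ℕ.≤ V × V ℕ.< suc (Vec.sum μ) ℕ.* suc (X u i)
  minimum-bounds μ u near i =
    subst (suc t ℕ.* A ℕ.≤_) (sym V≡) (ℕ.+-monoʳ-≤ A (subst (ℕ._≤ V′) (dot-const μ A)
      (dot-mono μ λ v ≢0 → proj₁ (near v (insert-preserves μ u ≢0) i))))
    -- Strict, because the inserted copy of `u` contributes `A` and not `suc A`.
    , subst (ℕ._< suc t ℕ.* suc A) (sym V≡) (s≤s (ℕ.+-monoʳ-≤ A (subst (V′ ℕ.≤_) (dot-const μ (suc A))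
      (dot-mono μ λ v ≢0 → proj₂ (near v (insert-preserves μ u ≢0) i)))))
    where
    t  = Vec.sum μ
    A  = X u i
    V′ = dot μ (λ v → X v i)
    V≡ : dot (updateAt μ u suc) (λ v → X v i) ≡ A ℕ.+ V′
    V≡ = dot-insert μ u (λ v → X v i)

  -- For a common size k and a common sum V, the bounds k X(u) ≤ V < k (X(w) + 1) leave only X(u) ≤
  -- X(w). Used in both directions, this identifies the two minima.
  minimum-≤ : ∀ {μ ν u w} → (∀ v → lookup (updateAt μ u suc) v ≢ 0 → Near v u) →
          (∀ v → lookup (updateAt ν w suc) v ≢ 0 → Near v w) →
          Vec.sum (updateAt μ u suc) ≡ Vec.sum (updateAt ν w suc) →
          (∀ i → dot (updateAt μ u suc) (λ v → X v i) ≡ dot (updateAt ν w suc) (λ v → X v i)) →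
          ∀ i → X u i ℕ.≤ X w i
  minimum-≤ {μ} {ν} {u} {w} u-min w-min same e i = ℕ.s≤s⁻¹ (ℕ.*-cancelˡ-< (suc (Vec.sum μ)) _ _ (begin-strict
    suc (Vec.sum μ) ℕ.* X u i        ≤⟨ proj₁ (minimum-bounds μ u u-min i) ⟩
    dot (updateAt μ u suc) (λ v → X v i) ≡⟨ e i ⟩
    dot (updateAt ν w suc) (λ v → X v i) <⟨ proj₂ (minimum-bounds ν w w-min i) ⟩
    suc (Vec.sum ν) ℕ.* suc (X w i)  ≡⟨ cong (ℕ._* suc (X w i)) (trans (sym (sum-insert ν w)) (trans (sym same) (sum-insert μ u))) ⟩
    suc (Vec.sum μ) ℕ.* suc (X w i)  ∎))
    where open ℕ.≤-Reasoning

  module _ (X-injective : ∀ {u v} → (∀ i → X u i ≡ X v i) → u ≡ v) where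

    -- Equal sums force equal minima; removing one copy of the common minimum leaves two chains of
    -- size one less, again with equal sums.
    chain-unique : ∀ t μ ν → Vec.sum μ ≡ t → Vec.sum ν ≡ t → Chain μ → Chain ν →
                   (∀ i → dot μ (λ v → X v i) ≡ dot ν (λ v → X v i)) → μ ≡ ν
    chain-unique zero    μ ν eμ eν _ _ _ = lookup-ext λ v → trans (sum≡0 μ eμ v) (sym (sum≡0 ν eν v))
    chain-unique (suc t) μ ν eμ eν cμ cν e
      with u , u∈ , u-min ← minimum μ eμ cμ | w , w∈ , w-min ← minimum ν eν cν
      with μ′ , refl ← extract μ u u∈ | ν′ , refl ← extract ν w w∈
      with refl ← X-injective {u} {w} (λ i → ℕ.≤-antisym
             (minimum-≤ {μ′} {ν′} u-min w-min (trans eμ (sym eν)) e i) (minimum-≤ {ν′} {μ′} w-min u-min (trans eν (sym eμ)) (sym ∘ e) i)) =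
      cong (λ μ → updateAt μ u suc) (chain-unique t μ′ ν′
        (ℕ.suc-injective (trans (sym (sum-insert μ′ u)) eμ)) (ℕ.suc-injective (trans (sym (sum-insert ν′ u)) eν))
        (chain-tail μ′ u cμ) (chain-tail ν′ u cν)
        (λ i → ℕ.+-cancelˡ-≡ (X u i) _ _ (trans (sym (dot-insert μ′ u _)) (trans (e i) (dot-insert ν′ u _)))))

-- Prefix sums

prefix : {m : ℕ} → (Fin m → ℕ) → Fin m → ℕ
prefix f zero    = f zero
prefix f (suc i) = f zero ℕ.+ prefix (f ∘ suc) i

lookup-φ : ∀ {m} (x : Vec ℕ m) i → lookup (φ x) i ≡ prefix (lookup x) i
lookup-φ (a ∷ x) zero    = refl
lookup-φ (a ∷ x) (suc i) = trans (Vec.lookup-map i (a ℕ.+_) (φ x)) (cong (a ℕ.+_) (lookup-φ x i))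

prefix-injective : ∀ {m} (f g : Fin m → ℕ) → prefix f ≗ prefix g → f ≗ g
prefix-injective f g e zero    = e zero
prefix-injective f g e (suc i) = prefix-injective (f ∘ suc) (g ∘ suc)
  (λ i → ℕ.+-cancelˡ-≡ (f zero) _ _ (trans (e (suc i)) (cong (ℕ._+ prefix (g ∘ suc) i) (sym (e zero))))) i

prefix-cong : ∀ {m} {f g : Fin m → ℕ} → f ≗ g → prefix f ≗ prefix g
prefix-cong e zero    = e zero
prefix-cong e (suc i) = cong₂ ℕ._+_ (e zero) (prefix-cong (e ∘ suc) i)

prefix-dot : ∀ {N m} (μ : Vec ℕ N) (x : Fin N → Fin m → ℕ) i →
             prefix (λ i → dot μ (λ v → x v i)) i ≡ dot μ (λ v → prefix (x v) i)
prefix-dot μ x zero    = refl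
prefix-dot μ x (suc i) = trans (cong (_ ℕ.+_) (prefix-dot μ (λ v → x v ∘ suc) i)) (sym (dot-+ μ _ _))

prefix≡0 : ∀ {m} {f : Fin m → ℕ} → (∀ i → f i ≡ 0) → ∀ i → prefix f i ≡ 0
prefix≡0 e zero    = e zero
prefix≡0 e (suc i) = cong₂ ℕ._+_ (e zero) (prefix≡0 (e ∘ suc) i)

sum-dot : ∀ {N m} (μ : Vec ℕ N) (x : Fin N → Fin m → ℕ) →
          Vec.sum (tabulate λ i → dot μ (λ v → x v i)) ≡ dot μ (λ v → Vec.sum (tabulate (x v)))
sum-dot {m = zero}  μ x = sym (dot-zero μ)
sum-dot {m = suc m} μ x = trans (cong (dot μ (λ v → x v zero) ℕ.+_) (sum-dot μ (λ v → x v ∘ suc))) (sym (dot-+ μ _ _))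

-- When g 0 = 0, the prefix sums of cut g 0 y are those of y, transformed by g.
cut : {m : ℕ} → (ℕ → ℕ) → ℕ → Vec ℕ m → Vec ℕ m
cut g a []      = []
cut g a (b ∷ y) = (g (a ℕ.+ b) ∸ g a) ∷ cut g (a ℕ.+ b) y

module _ {g : ℕ → ℕ} (g-mono : ∀ {a b} → a ℕ.≤ b → g a ℕ.≤ g b) where

  prefix-cut : ∀ {m} a (y : Vec ℕ m) i → g a ℕ.+ prefix (lookup (cut g a y)) i ≡ g (a ℕ.+ prefix (lookup y) i)
  prefix-cut a (b ∷ y) zero    = ℕ.m+[n∸m]≡n (g-mono (ℕ.m≤m+n a b))
  prefix-cut a (b ∷ y) (suc i) = begin
    g a ℕ.+ (g (a ℕ.+ b) ∸ g a ℕ.+ p)   ≡⟨ ℕ.+-assoc (g a) _ p ⟨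
    g a ℕ.+ (g (a ℕ.+ b) ∸ g a) ℕ.+ p   ≡⟨ cong (ℕ._+ p) (ℕ.m+[n∸m]≡n (g-mono (ℕ.m≤m+n a b))) ⟩
    g (a ℕ.+ b) ℕ.+ p                   ≡⟨ prefix-cut (a ℕ.+ b) y i ⟩
    g (a ℕ.+ b ℕ.+ prefix (lookup y) i) ≡⟨ cong g (ℕ.+-assoc a b _) ⟩
    g (a ℕ.+ (b ℕ.+ prefix (lookup y) i)) ∎
    where
    open ≡-Reasoning
    p = prefix (lookup (cut g (a ℕ.+ b) y)) i

  sum-cut : ∀ {m} a (y : Vec ℕ m) → g a ℕ.+ Vec.sum (cut g a y) ≡ g (a ℕ.+ Vec.sum y)
  sum-cut a []      = trans (ℕ.+-identityʳ (g a)) (cong g (sym (ℕ.+-identityʳ a)))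
  sum-cut a (b ∷ y) = begin
    g a ℕ.+ (g (a ℕ.+ b) ∸ g a ℕ.+ p)   ≡⟨ ℕ.+-assoc (g a) _ p ⟨
    g a ℕ.+ (g (a ℕ.+ b) ∸ g a) ℕ.+ p   ≡⟨ cong (ℕ._+ p) (ℕ.m+[n∸m]≡n (g-mono (ℕ.m≤m+n a b))) ⟩
    g (a ℕ.+ b) ℕ.+ p                   ≡⟨ sum-cut (a ℕ.+ b) y ⟩
    g (a ℕ.+ b ℕ.+ Vec.sum y)           ≡⟨ cong g (ℕ.+-assoc a b _) ⟩
    g (a ℕ.+ (b ℕ.+ Vec.sum y))         ∎
    where
    open ≡-Reasoning
    p = Vec.sum (cut g (a ℕ.+ b) y)

-- Taking away one rounded-down share

n∸n/k : ∀ k n → n ∸ n / suc k ≡ n % suc k ℕ.+ n / suc k ℕ.* k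
n∸n/k k n = begin
  n ∸ q                             ≡⟨ cong (_∸ q) (m≡m%n+[m/n]*n n (suc k)) ⟩
  n % suc k ℕ.+ q ℕ.* suc k ∸ q     ≡⟨ cong (λ s → n % suc k ℕ.+ s ∸ q) (trans (ℕ.*-suc q k) (ℕ.+-comm q (q ℕ.* k))) ⟩
  n % suc k ℕ.+ (q ℕ.* k ℕ.+ q) ∸ q ≡⟨ cong (_∸ q) (ℕ.+-assoc (n % suc k) (q ℕ.* k) q) ⟨
  n % suc k ℕ.+ q ℕ.* k ℕ.+ q ∸ q   ≡⟨ ℕ.m+n∸n≡m _ q ⟩
  n % suc k ℕ.+ q ℕ.* k             ∎
  where
  open ≡-Reasoning
  q = n / suc k

-- While the quotient stays fixed, nothing but the number itself changes. When the quotient grows,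
-- the remainder loses at most `k`, and the term quotient times `k` gains at least that much.
-- Without this monotonicity the truncated subtraction in `cut` would lose information.
∸-/-mono : ∀ k {a b} → a ℕ.≤ b → a ∸ a / suc k ℕ.≤ b ∸ b / suc k
∸-/-mono k {a} {b} a≤b with ℕ.m≤n⇒m<n∨m≡n (/-monoˡ-≤ (suc k) a≤b)
... | inj₂ q≡q′ = subst (λ q → a ∸ a / suc k ℕ.≤ b ∸ q) q≡q′ (ℕ.∸-monoˡ-≤ (a / suc k) a≤b)
... | inj₁ q<q′ = begin
  a ∸ a / suc k                     ≡⟨ n∸n/k k a ⟩
  a % suc k ℕ.+ a / suc k ℕ.* k     ≤⟨ ℕ.+-monoˡ-≤ (a / suc k ℕ.* k) (ℕ.s≤s⁻¹ (m%n<n a (suc k))) ⟩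
  suc (a / suc k) ℕ.* k             ≤⟨ ℕ.*-monoˡ-≤ k q<q′ ⟩
  b / suc k ℕ.* k                   ≤⟨ ℕ.m≤n+m _ (b % suc k) ⟩
  b % suc k ℕ.+ b / suc k ℕ.* k     ≡⟨ n∸n/k k b ⟨
  b ∸ b / suc k                     ∎
  where open ℕ.≤-Reasoning

-- Existence: split off the vertex whose prefix sums are the rounded down averages.

module _ {N m r : ℕ} .{{_ : NonZero r}} (p : Fin N → Vec ℕ m)
         (p-complete : ∀ x → Vec.sum x ≡ r → ∃ λ v → p v ≡ x) where

  private
    X : Fin N → Fin m → ℕ
    X v = prefix (lookup (p v))

  -- Says that X v i differs from the average Y i / t by less than 1, cleared of denominators.
  -- `Chain` alone does not compare the vertices already found with the next one; this invariant
  -- does.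
  Spread : ℕ → (Fin m → ℕ) → Vec ℕ N → Set
  Spread t Y μ = ∀ v → lookup μ v ≢ 0 → ∀ i → Y i ℕ.< t ℕ.* suc (X v i) × t ℕ.* X v i ℕ.< Y i ℕ.+ t

  chain-exists : ∀ t (y : Vec ℕ m) → Vec.sum y ≡ t ℕ.* r →
    ∃ λ μ → Vec.sum μ ≡ t × Chain X μ × (∀ i → dot μ (λ v → X v i) ≡ prefix (lookup y) i)
            × Spread t (prefix (lookup y)) μ
  chain-exists zero y e = Vec.replicate N 0 , sum-replicate-0 N
    , (λ u v ≢0 _ → contradiction (Vec.lookup-replicate u 0) ≢0)
    , (λ i → trans (dot-replicate-0 N _) (sym (prefix≡0 (sum≡0 y e) i)))
    , (λ v ≢0 → contradiction (Vec.lookup-replicate v 0) ≢0)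
  chain-exists (suc t) y e =
    let μ , eμ , cμ , dμ , spread = chain-exists t y′ sum-y′
    in updateAt μ u suc
       , trans (sum-insert μ u) (cong suc eμ)
       , chain μ cμ spread
       , (λ i → trans (dot-insert μ u _) (trans (cong₂ ℕ._+_ (Xu i) (dμ i)) (A+Y′ i)))
       , spread′ μ spread
    where
    k = suc t
    Y Y′ A : Fin m → ℕ
    floor rest : ℕ → ℕ
    floor n = n / k
    rest n  = n ∸ n / k
    floor-mono : ∀ {a b} → a ℕ.≤ b → floor a ℕ.≤ floor b
    floor-mono = /-monoˡ-≤ k
    x  = cut floor 0 y
    y′ = cut rest 0 y
    Y  = prefix (lookup y)
    Y′ = prefix (lookup y′)
    A i = Y i / k
    -- The whole sum is k r, so rounding down is exact there and the cut vector has sum `r`: it is a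
    -- vertex.
    sum-floor : Vec.sum y / k ≡ r
    sum-floor = trans (cong (_/ k) (trans e (ℕ.*-comm k r))) (m*n/n≡m r k)
    sum-x : Vec.sum x ≡ r
    sum-x = trans (sum-cut {floor} floor-mono 0 y) sum-floor
    sum-y′ : Vec.sum y′ ≡ t ℕ.* r
    sum-y′ = trans (sum-cut {rest} (∸-/-mono t) 0 y) (trans (cong₂ _∸_ e sum-floor) (ℕ.m+n∸m≡n r (t ℕ.* r)))
    u : Fin N
    u = proj₁ (p-complete x sum-x)
    Xu : ∀ i → X u i ≡ A i
    Xu i = trans (cong (λ x → prefix (lookup x) i) (proj₂ (p-complete x sum-x))) (prefix-cut {floor} floor-mono 0 y i)
    A+Y′ : ∀ i → A i ℕ.+ Y′ i ≡ Y i
    A+Y′ i = trans (cong (A i ℕ.+_) (prefix-cut {rest} (∸-/-mono t) 0 y i)) (ℕ.m+[n∸m]≡n (m/n≤m (Y i) k))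
    Y′≡ : ∀ i → Y′ i ≡ Y i % k ℕ.+ A i ℕ.* t
    Y′≡ i = trans (prefix-cut {rest} (∸-/-mono t) 0 y i) (n∸n/k t (Y i))
    -- Since Y i % k ≤ t, the average of the rest lies between A i and A i + 1. An integer at
    -- distance less than 1 from it is above A i - 1 and below A i + 2.
    near : ∀ μ → Spread t Y′ μ → ∀ v → lookup μ v ≢ 0 → Near X v u
    near μ spread v ≢0 i with spread v ≢0 i
    ... | lower , upper rewrite Xu i =
      ℕ.s≤s⁻¹ (ℕ.*-cancelˡ-< t _ _ (begin-strict
        t ℕ.* A i                ≡⟨ ℕ.*-comm t (A i) ⟩
        A i ℕ.* t                ≤⟨ ℕ.m≤n+m _ (Y i % k) ⟩
        Y i % k ℕ.+ A i ℕ.* t    ≡⟨ Y′≡ i ⟨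
        Y′ i                     <⟨ lower ⟩
        t ℕ.* suc (X v i)        ∎))
      , ℕ.s≤s⁻¹ (ℕ.*-cancelˡ-< t _ _ (begin-strict
        t ℕ.* X v i                    <⟨ upper ⟩
        Y′ i ℕ.+ t                     ≡⟨ cong (ℕ._+ t) (Y′≡ i) ⟩
        Y i % k ℕ.+ A i ℕ.* t ℕ.+ t    ≤⟨ ℕ.+-monoˡ-≤ t (ℕ.+-monoˡ-≤ (A i ℕ.* t) (ℕ.s≤s⁻¹ (m%n<n (Y i) k))) ⟩
        suc (A i) ℕ.* t ℕ.+ t          ≡⟨ ℕ.+-comm (suc (A i) ℕ.* t) t ⟩
        suc (suc (A i)) ℕ.* t          ≡⟨ ℕ.*-comm (suc (suc (A i))) t ⟩
        t ℕ.* suc (suc (A i))          ∎))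
      where open ℕ.≤-Reasoning
    chain : ∀ μ → Chain X μ → Spread t Y′ μ → Chain X (updateAt μ u suc)
    chain μ cμ spread v w v≢0 w≢0 with insert-reflects μ u v v≢0 | insert-reflects μ u w w≢0
    ... | inj₁ refl | inj₁ refl = inj₁ λ i → ℕ.≤-refl , ℕ.n≤1+n _
    ... | inj₁ refl | inj₂ w∈   = inj₂ (near μ spread w w∈)
    ... | inj₂ v∈   | inj₁ refl = inj₁ (near μ spread v v∈)
    ... | inj₂ v∈   | inj₂ w∈   = cμ v w v∈ w∈
    spread′ : ∀ μ → Spread t Y′ μ → Spread k Y (updateAt μ u suc)
    spread′ μ spread v ≢0 i with insert-reflects μ u v ≢0
    ... | inj₁ refl rewrite Xu i =
      (begin-strict
        Y i                           ≡⟨ m≡m%n+[m/n]*n (Y i) k ⟩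
        Y i % k ℕ.+ A i ℕ.* k         <⟨ ℕ.+-monoˡ-< (A i ℕ.* k) (m%n<n (Y i) k) ⟩
        suc (A i) ℕ.* k               ≡⟨ ℕ.*-comm (suc (A i)) k ⟩
        k ℕ.* suc (A i)               ∎)
      , (begin-strict
        k ℕ.* A i                     ≡⟨ ℕ.*-comm k (A i) ⟩
        A i ℕ.* k                     ≤⟨ m/n*n≤m (Y i) k ⟩
        Y i                           <⟨ ℕ.m<m+n (Y i) (s≤s z≤n) ⟩
        Y i ℕ.+ k                     ∎)
      where open ℕ.≤-Reasoning
    -- The bounds for `Y` are those for `Y′` enlarged by the share A i, and nearness to `u` compares
    -- that share with X v i.
    ... | inj₂ v∈ with spread v v∈ i | near μ spread v v∈ i
    ...   | lower , upper | A≤X , X≤1+A rewrite Xu i =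
      (begin-strict
        Y i                                ≡⟨ A+Y′ i ⟨
        A i ℕ.+ Y′ i                       <⟨ ℕ.+-mono-≤-< (ℕ.m≤n⇒m≤1+n A≤X) lower ⟩
        suc (X v i) ℕ.+ t ℕ.* suc (X v i)  ∎)
      , (begin-strict
        X v i ℕ.+ t ℕ.* X v i              <⟨ ℕ.+-mono-≤-< X≤1+A upper ⟩
        suc (A i) ℕ.+ (Y′ i ℕ.+ t)         ≡⟨ ℕ.+-assoc (suc (A i)) (Y′ i) t ⟨
        suc (A i ℕ.+ Y′ i) ℕ.+ t           ≡⟨ cong (λ s → suc s ℕ.+ t) (A+Y′ i) ⟩
        suc (Y i) ℕ.+ t                    ≡⟨ ℕ.+-suc (Y i) t ⟨
        Y i ℕ.+ k                          ∎)
      where open ℕ.≤-Reasoning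

-- Edgewise subdivisions

⊖≡0 : ∀ a b → a ⊖ b ≡ 0ℤ → a ≡ b
⊖≡0 a b e = ℤ.+-injective (ℤ.i-j≡0⇒i≡j (+ a) (+ b) (trans (ℤ.m-n≡m⊖n a b) e))

⊖≡1 : ∀ a b → a ⊖ b ≡ 1ℤ → a ≡ suc b
⊖≡1 a b e = trans (ℤ.+-injective (trans (sym (i+[j-i]≡j (+ b) (+ a)))
  (cong (ℤ._+_ (+ b)) (trans (ℤ.m-n≡m⊖n a b) e)))) (ℕ.+-comm b 1)

module _ (m r : ℕ) .{{_ : NonZero r}} where

  private
    N′ = edgewiseSize m r

  Y : Fin N′ → Fin m → ℕ
  Y v = prefix (lookup (point m r v))

  step⇒near : ∀ u v → Step (point m r u) (point m r v) → Near Y u v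
  step⇒near u v step i with step i
  ... | inj₁ e rewrite lookup-φ (point m r u) i | lookup-φ (point m r v) i | ⊖≡0 (Y u i) (Y v i) e =
    ℕ.≤-refl , ℕ.n≤1+n _
  ... | inj₂ e rewrite lookup-φ (point m r u) i | lookup-φ (point m r v) i | ⊖≡1 (Y u i) (Y v i) e =
    ℕ.n≤1+n _ , ℕ.≤-refl

  near⇒step : ∀ u v → Near Y u v → Step (point m r u) (point m r v)
  near⇒step u v near i rewrite lookup-φ (point m r u) i | lookup-φ (point m r v) i
    with Y u i | near i
  ... | a | Yv≤a , a≤1+Yv with ℕ.m≤n⇒m<n∨m≡n a≤1+Yv
  ...   | inj₁ a<1+Yv rewrite ℕ.≤-antisym (ℕ.s≤s⁻¹ a<1+Yv) Yv≤a = inj₁ (ℤ.n⊖n≡0 (Y v i))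
  ...   | inj₂ refl = inj₂ (trans (ℤ.⊖-≥ Yv≤a) (cong +_ (ℕ.m+n∸n≡m 1 (Y v i))))

  point-sum : ∀ v → Vec.sum (point m r v) ≡ r
  point-sum v = sound (edgewiseVertices m r) (∈-lookup v)

  point-complete : ∀ x → Vec.sum x ≡ r → ∃ λ v → point m r v ≡ x
  point-complete x e = let x∈ = complete (edgewiseVertices m r) e in Any.index x∈ , sym (Any.lookup-index x∈)

  point-injective : ∀ {u v} → (∀ i → Y u i ≡ Y v i) → u ≡ v
  point-injective {u} {v} e = lookup-injective (unique (edgewiseVertices m r)) u v
    (lookup-ext (prefix-injective _ _ e))
    where
    lookup-injective : ∀ {A : Set} {xs : List A} → Unique xs → ∀ i j → List.lookup xs i ≡ List.lookup xs j → i ≡ j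
    lookup-injective (x∉ ∷ u) zero    zero    _ = refl
    lookup-injective (x∉ ∷ u) zero    (suc j) e = contradiction e (All.lookup x∉ (∈-lookup j))
    lookup-injective (x∉ ∷ u) (suc i) zero    e = contradiction (sym e) (All.lookup x∉ (∈-lookup i))
    lookup-injective (x∉ ∷ u) (suc i) (suc j) e = cong suc (lookup-injective u i j e)

  combine : Vec ℕ N′ → Vec ℕ m
  combine μ = tabulate λ i → dot μ (λ v → lookup (point m r v) i)

  lookup-combine : ∀ μ i → lookup (combine μ) i ≡ dot μ (λ v → lookup (point m r v) i)
  lookup-combine μ i = Vec.lookup∘tabulate _ i

  prefix-combine : ∀ μ i → prefix (lookup (combine μ)) i ≡ dot μ (λ v → Y v i)
  prefix-combine μ i = trans (prefix-cong (lookup-combine μ) i) (prefix-dot μ (λ v → lookup (point m r v)) i)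

  sum-combine : ∀ μ → Vec.sum (combine μ) ≡ Vec.sum μ ℕ.* r
  sum-combine μ = trans (sum-dot μ (λ v → lookup (point m r v)))
    (trans (dot-cong μ (λ v → trans (cong Vec.sum (Vec.tabulate∘lookup (point m r v))) (point-sum v))) (dot-const μ r))

  lookup-support⁺ : ∀ {n} (x : Vec ℕ n) {i} → lookup x i ≢ 0 → i ∈ support x
  lookup-support⁺ x {i} ≢0 = Vec.lookup⇒[]= i _ (trans (Vec.lookup-map i (0 ℕ.<ᵇ_) x) (positive (lookup x i) ≢0))
    where
    positive : ∀ a → a ≢ 0 → (0 ℕ.<ᵇ a) ≡ true
    positive zero    0≢0 = contradiction refl 0≢0
    positive (suc a) _   = refl

  lookup-support⁻ : ∀ {n} (x : Vec ℕ n) {i} → i ∈ support x → lookup x i ≢ 0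
  lookup-support⁻ x {i} i∈ e
    with () ← trans (sym (Vec.[]=⇒lookup i∈)) (trans (Vec.lookup-map i (0 ℕ.<ᵇ_) x) (cong (0 ℕ.<ᵇ_) e))

  module _ (F : Subset m) where

    private
      Ω = restriction (edgewise m r) F

    carrier⇒vanish : ∀ μ → carrier (edgewise m r) (support μ) ⊆ F → Vanish F (combine μ)
    carrier⇒vanish μ ⊆F i i∉F = trans (lookup-combine μ i)
      (ℕ.n≤0⇒n≡0 (subst (dot μ (λ v → lookup (point m r v) i) ℕ.≤_) (dot-zero μ)
        (dot-mono μ (λ v ≢0 → ℕ.≤-reflexive (off v ≢0)))))
      where
      off : ∀ v → lookup μ v ≢ 0 → lookup (point m r v) i ≡ 0
      off v ≢0 with lookup (point m r v) i ℕ.≟ 0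
      ... | yes ≡0 = ≡0
      ... | no ≢0′ with () ← trans (sym (Vec.[]=⇒lookup (⊆F (∈-⋃⁺ (supports m r (support μ))
            (∈-map⁺ (support ∘ point m r) (∈-filter⁺ (_∈? support μ) (∈-allFin v) (lookup-support⁺ μ ≢0)))
            (lookup-support⁺ (point m r v) ≢0′))))) i∉F

    -- Natural numbers do not cancel: if a coordinate of the combination is 0, it is 0 at every
    -- vertex that occurs.
    vanish⇒carrier : ∀ μ → Vanish F (combine μ) → carrier (edgewise m r) (support μ) ⊆ F
    vanish⇒carrier μ vanish {i} i∈
      with p , p∈ , i∈p ← ∈-⋃⁻ (supports m r (support μ)) i∈
      with v , v∈ , refl ← ∈-map⁻ (support ∘ point m r) p∈
      with lookup F i in eq
    ... | true  = Vec.lookup⇒[]= i F eq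
    ... | false = contradiction
      (dot≡0 μ (trans (sym (lookup-combine μ i)) (vanish i eq)) v
        (lookup-support⁻ μ (proj₂ (∈-filter⁻ (_∈? support μ) {xs = allFin N′} v∈))))
      (lookup-support⁻ (point m r v) i∈p)

    face⇒chain : ∀ {μ} → Face (edgewiseComplex m r) (support μ) → Chain Y μ
    face⇒chain {μ} face u v u≢0 v≢0 = Sum.map (step⇒near u v) (step⇒near v u)
      (face u v (lookup-support⁺ μ u≢0) (lookup-support⁺ μ v≢0))

    chain⇒face : ∀ {μ} → Chain Y μ → Face (edgewiseComplex m r) (support μ)
    chain⇒face {μ} chain u v u∈ v∈ = Sum.map (near⇒step u v) (near⇒step v u)
      (chain u v (lookup-support⁻ μ u∈) (lookup-support⁻ μ v∈))

    combine-bijective : ∀ t → Bijective (FaceMultiset Ω t) (DilatePoint r F t) combine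
    combine-bijective t = record
      { image      = λ {μ} ((_ , ⊆F) , e) → carrier⇒vanish μ ⊆F , trans (sum-combine μ) (cong (ℕ._* r) e)
      ; injective  = λ {μ} {ν} ((f , _) , e) ((f′ , _) , e′) same →
          chain-unique Y point-injective t μ ν e e′ (face⇒chain f) (face⇒chain f′)
            (λ i → trans (sym (prefix-combine μ i))
              (trans (cong (λ y → prefix (lookup y) i) same) (prefix-combine ν i)))
      ; surjective = λ {y} (v , e) →
          -- The multiset is found in the whole simplex. That it lies over `F` follows afterwards,
          -- since `y` vanishes off `F`.
          let μ , eμ , chain , dots , _ = chain-exists (point m r) point-complete t y e
              same = lookup-ext (prefix-injective _ _ λ i → trans (prefix-combine μ i) (dots i))
          in μ , ((chain⇒face chain , vanish⇒carrier μ (subst (Vanish F) (sym same) v)) , eμ) , same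
      }

-- Inclusion-exclusion

refined : {A : Set} {P Q : Pred A 0ℓ} → Enumeration P → Decidable Q → Enumeration (λ x → P x × Q x)
refined E Q? = record
  { elements = filter Q? (elements E)
  ; unique   = Unique.filter⁺ Q? (unique E)
  ; sound    = λ x∈ → let x∈E , Qx = ∈-filter⁻ Q? {xs = elements E} x∈ in sound E x∈E , Qx
  ; complete = λ (Px , Qx) → ∈-filter⁺ Q? (complete E Px) Qx
  }

Full : {m : ℕ} → Pred (Vec ℕ m) 0ℓ
Full δ = ∀ i → lookup δ i ≢ 0

Full? : {m : ℕ} → Decidable (Full {m})
Full? δ = Fin.all? λ i → ¬? (lookup δ i ℕ.≟ 0)

sign : {m : ℕ} → Subset m → ℤ
sign {m} F = -1ℤ ℤ.^ (m ∸ ∣ F ∣)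

sign-outside : ∀ {m} (F : Subset m) → sign (outside ∷ F) ≡ ℤ.- sign F
sign-outside {m} F = trans (cong (-1ℤ ℤ.^_) (ℕ.+-∸-assoc 1 (∣p∣≤n F))) (ℤ.-1*i≡-i (sign F))

indicator-no : {P : Set} (P? : Dec P) → ¬ P → indicator P? ≡ 0ℤ
indicator-no (yes p) ¬p = contradiction p ¬p
indicator-no (no _)  _  = refl

-- The sets off which `δ` vanishes are those containing its support, and their signs cancel unless
-- the support is everything. In the induction, the sets without the first index cancel those with
-- it if the first entry is 0, and contribute nothing otherwise.
alternating : ∀ {m} (δ : Vec ℕ m) →
              total (elements (subsets m)) (λ F → sign F ℤ.* indicator (Vanish? F δ)) ≡ indicator (Full? δ)
alternating [] = refl
alternating {suc m} (a ∷ δ) = begin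
  total (map (inside ∷_) Fs ++ map (outside ∷_) Fs ++ []) w
    ≡⟨ total-++ (map (inside ∷_) Fs) _ w ⟩
  total (map (inside ∷_) Fs) w ℤ.+ total (map (outside ∷_) Fs ++ []) w
    ≡⟨ cong₂ ℤ._+_ (total-map (inside ∷_) Fs w)
         (trans (total-++ (map (outside ∷_) Fs) [] w)
                (trans (ℤ.+-identityʳ _) (total-map (outside ∷_) Fs w))) ⟩
  total Fs (w ∘ (inside ∷_)) ℤ.+ total Fs (w ∘ (outside ∷_))
    ≡⟨ cong₂ ℤ._+_
         (trans (total-cong Fs λ {F} _ → cong (ℤ._*_ (sign F))
                  (indicator-cong (Vanish? (inside ∷ F) (a ∷ δ)) (Vanish? F δ) (_∘ suc) (vanish-∷ (λ ()))))
                (alternating δ))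
         (total-cong Fs λ {F} _ → cong (ℤ._* indicator (Vanish? (outside ∷ F) (a ∷ δ))) (sign-outside F)) ⟩
  indicator (Full? δ) ℤ.+ total Fs (λ F → ℤ.- sign F ℤ.* indicator (Vanish? (outside ∷ F) (a ∷ δ)))
    ≡⟨ remaining a ⟩
  indicator (Full? (a ∷ δ)) ∎
  where
  open ≡-Reasoning
  Fs : List (Subset m)
  Fs = elements (subsets m)
  w : Subset (suc m) → ℤ
  w F = sign F ℤ.* indicator (Vanish? F (a ∷ δ))
  remaining : ∀ a → indicator (Full? δ) ℤ.+ total Fs (λ F → ℤ.- sign F ℤ.* indicator (Vanish? (outside ∷ F) (a ∷ δ)))
                    ≡ indicator (Full? (a ∷ δ))
  remaining zero = begin
    indicator (Full? δ) ℤ.+ total Fs (λ F → ℤ.- sign F ℤ.* indicator (Vanish? (outside ∷ F) (0 ∷ δ)))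
      ≡⟨ cong (ℤ._+_ (indicator (Full? δ))) (trans
           (total-cong Fs λ {F} _ → trans
             (cong₂ ℤ._*_ (sym (ℤ.-1*i≡-i (sign F)))
               (indicator-cong (Vanish? (outside ∷ F) (0 ∷ δ)) (Vanish? F δ) (_∘ suc) (vanish-∷ (λ _ → refl))))
             (ℤ.*-assoc -1ℤ (sign F) _))
           (trans (total-*ˡ -1ℤ Fs _) (cong (ℤ._*_ -1ℤ) (alternating δ)))) ⟩
    indicator (Full? δ) ℤ.+ -1ℤ ℤ.* indicator (Full? δ)
      ≡⟨ cong (ℤ._+_ (indicator (Full? δ))) (ℤ.-1*i≡-i (indicator (Full? δ))) ⟩
    indicator (Full? δ) ℤ.- indicator (Full? δ)
      ≡⟨ ℤ.+-inverseʳ (indicator (Full? δ)) ⟩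
    0ℤ
      ≡⟨ indicator-no (Full? (0 ∷ δ)) (λ full → full zero refl) ⟨
    indicator (Full? (0 ∷ δ)) ∎
  remaining (suc a) = begin
    indicator (Full? δ) ℤ.+ total Fs (λ F → ℤ.- sign F ℤ.* indicator (Vanish? (outside ∷ F) (suc a ∷ δ)))
      ≡⟨ cong (ℤ._+_ (indicator (Full? δ))) (trans
           (total-cong Fs λ {F} _ → trans
             (cong (ℤ._*_ (ℤ.- sign F))
               (indicator-no (Vanish? (outside ∷ F) (suc a ∷ δ)) (λ v → contradiction (v zero refl) λ ())))
             (ℤ.*-zeroʳ (ℤ.- sign F)))
           (total-zero Fs)) ⟩
    indicator (Full? δ) ℤ.+ 0ℤ
      ≡⟨ ℤ.+-identityʳ _ ⟩
    indicator (Full? δ)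
      ≡⟨ indicator-cong (Full? δ) (Full? (suc a ∷ δ)) (λ { f zero () ; f (suc i) → f i }) (_∘ suc) ⟩
    indicator (Full? (suc a ∷ δ)) ∎

-- The common index set of all three polynomials: the steps of closed walks modulo r.
Cycle : {m : ℕ} → ℕ → Pred (Vec ℕ m) 0ℓ
Cycle r δ = (∀ i → lookup δ i ≢ 0 × lookup δ i ℕ.< r) × r Div.∣ Vec.sum δ

-- Listed as a filter of `residues r ⊤`, so that the sum left by inclusion-exclusion is literally a
-- sum over this list by `total-filter`.
cycles : (m r : ℕ) → Enumeration (Cycle {m} r)
cycles m r = recast
  (λ ((δ<r , r∣δ , _) , full) → (λ i → full i , δ<r i) , r∣δ)
  (λ {δ} (bounds , r∣δ) → (proj₂ ∘ bounds , r∣δ , vanish-⊤ δ) , proj₁ ∘ bounds)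
  (refined (residues r ⊤) Full?)
  where
  vanish-⊤ : (δ : Vec ℕ m) → Vanish ⊤ δ
  vanish-⊤ δ i e with () ← trans (sym (Vec.lookup-replicate i inside)) e

-- Each h-polynomial becomes a sum over residues supported on `F`. The empty `F` fits in: its only
-- residue is the zero vector, so the h-polynomial is 1 there.
coeff-localH-edgewise : ∀ m r .{{_ : NonZero r}} →
  coeff (localH (edgewise m r)) ≗ λ t → total (elements (cycles m r)) (λ δ → monomial (level r δ) t)
coeff-localH-edgewise m r t = begin
  coeff (localH (edgewise m r)) t
    ≡⟨ coeff-∑ Fs (λ F → sign F · h (restriction (edgewise m r) F)) t ⟩
  total Fs (λ F → coeff (sign F · h (restriction (edgewise m r) F)) t)
    ≡⟨ total-cong Fs (λ {F} _ → trans (coeff-· (sign F) (h (restriction (edgewise m r) F)) t)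
         (cong (ℤ._*_ (sign F)) (trans
           (coeff-h-dilate r F (restriction (edgewise m r) F) (face-⊥ F) (same-series F) t)
           (sieve F)))) ⟩
  total Fs (λ F → sign F ℤ.* total δs (λ δ → w δ ℤ.* indicator (Vanish? F δ)))
    ≡⟨ total-cong Fs (λ {F} _ → trans (sym (total-*ˡ (sign F) δs _))
         (total-cong δs λ {δ} _ → x∙yz≈y∙xz (sign F) (w δ) (indicator (Vanish? F δ)))) ⟩
  total Fs (λ F → total δs (λ δ → w δ ℤ.* (sign F ℤ.* indicator (Vanish? F δ))))
    ≡⟨ total-swap Fs δs _ ⟩
  total δs (λ δ → total Fs (λ F → w δ ℤ.* (sign F ℤ.* indicator (Vanish? F δ))))
    ≡⟨ total-cong δs (λ {δ} _ → trans (total-*ˡ (w δ) Fs _) (cong (ℤ._*_ (w δ)) (alternating δ))) ⟩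
  total δs (λ δ → w δ ℤ.* indicator (Full? δ))
    ≡⟨ total-filter Full? δs w ⟨
  total (elements (cycles m r)) w ∎
  where
  open ≡-Reasoning
  Fs = elements (subsets m)
  δs = elements (residues r (⊤ {m}))
  w : Vec ℕ m → ℤ
  w δ = monomial (level r δ) t
  face-⊥ : ∀ F → Face (restriction (edgewise m r) F) ⊥
  face-⊥ F = (λ u v u∈⊥ → contradiction u∈⊥ ∉⊥) , over
    where
    over : carrier (edgewise m r) ⊥ ⊆ F
    over i∈ with p , p∈ , _ ← ∈-⋃⁻ (supports m r ⊥) i∈ with v , v∈ , _ ← ∈-map⁻ (support ∘ point m r) p∈ =
      contradiction (proj₂ (∈-filter⁻ (_∈? ⊥) {xs = allFin (edgewiseSize m r)} v∈)) ∉⊥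
  same-series : ∀ F → multisetSeries (restriction (edgewise m r) F) ≗ dilateSeries r F
  same-series F t = total-bijective (faceMultisets (restriction (edgewise m r) F) t) (dilatePoints r F t)
    (combine-bijective m r F t) (λ _ → 1ℤ)
  -- Moves the dependence on `F` from the index set into an indicator, so that the two sums can be
  -- exchanged.
  sieve : ∀ F → total (elements (residues r F)) w ≡ total δs (λ δ → w δ ℤ.* indicator (Vanish? F δ))
  sieve F = trans
    (total-≐ (residues r F) (refined (residues r ⊤) (Vanish? F))
      (λ { (δ<r , r∣δ , v) → (δ<r , r∣δ , λ i e → contradiction (trans (sym (Vec.lookup-replicate i inside)) e) λ ()) , v })
      (λ ((δ<r , r∣δ , _) , v) → δ<r , r∣δ , v) w)
    (total-filter (Vanish? F) δs w)

-- The lattice points of the open parallelepiped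

-- For `a` equal to 0 and `b` equal to `r` times the height, these are `r` times the coefficients in
-- terms of the vertices. The recursion copies `differences`, so scaling commutes with it clause by
-- clause.
integerDifferences : {n : ℕ} → ℤ → Vec ℤ n → ℤ → Fin (suc n) → ℤ
integerDifferences a []      b zero    = b ℤ.- a
integerDifferences a (z ∷ x) b zero    = z ℤ.- a
integerDifferences a (z ∷ x) b (suc j) = integerDifferences z x b j

-- The last of the n + 1 steps yields no coordinate: its end point is `r` times the height.
positions : {n : ℕ} → ℕ → Vec ℕ (suc n) → Vec ℤ n
positions {zero}  a _       = []
positions {suc n} a (c ∷ δ) = + (a ℕ.+ c) ∷ positions (a ℕ.+ c) δ

m+n-m≡n : ∀ a c → + (a ℕ.+ c) ℤ.- + a ≡ + c
m+n-m≡n a c = trans (ℤ.m-n≡m⊖n (a ℕ.+ c) a) (trans (ℤ.⊖-≥ (ℕ.m≤m+n a c)) (cong +_ (ℕ.m+n∸m≡n a c)))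

integerDifferences-positions : ∀ {n} a (δ : Vec ℕ (suc n)) j →
  integerDifferences (+ a) (positions a δ) (+ (a ℕ.+ Vec.sum δ)) j ≡ + lookup δ j
integerDifferences-positions {zero}  a (c ∷ []) zero    =
  trans (cong (λ s → + (a ℕ.+ s) ℤ.- + a) (ℕ.+-identityʳ c)) (m+n-m≡n a c)
integerDifferences-positions {suc n} a (c ∷ δ)  zero    = m+n-m≡n a c
integerDifferences-positions {suc n} a (c ∷ δ)  (suc j) =
  trans (cong (λ s → integerDifferences (+ (a ℕ.+ c)) (positions (a ℕ.+ c) δ) (+ s) j)
              (sym (ℕ.+-assoc a c (Vec.sum δ))))
        (integerDifferences-positions (a ℕ.+ c) δ j)

positive-step : ∀ a z → 0ℤ ℤ.< z ℤ.- + a → ∃ λ c → z ≡ + (a ℕ.+ c)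
positive-step a z p with z ℤ.- + a in eq | p
... | + c | _ = c , trans (sym (i+[j-i]≡j (+ a) z)) (cong (ℤ._+_ (+ a)) eq)

steps : ∀ {n} a (x : Vec ℤ n) b → (∀ j → 0ℤ ℤ.< integerDifferences (+ a) x b j) →
        ∃ λ δ → positions a δ ≡ x × + (a ℕ.+ Vec.sum δ) ≡ b
steps a []      b p with c , refl ← positive-step a b (p zero) =
  c ∷ [] , refl , cong (λ s → + (a ℕ.+ s)) (ℕ.+-identityʳ c)
steps a (z ∷ x) b p with c , refl ← positive-step a z (p zero) =
  let δ , e , e′ = steps (a ℕ.+ c) x b (p ∘ suc)
  in c ∷ δ , cong (_ ∷_) e , trans (cong +_ (sym (ℕ.+-assoc a c (Vec.sum δ)))) e′

module _ (r : ℕ) .{{_ : NonZero r}} where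

  scaled : ℤ → ℚ
  scaled z = toℚ z ℚ.* (1ℤ ℚ./ r)

  scaled-- : ∀ a b → scaled a ℚ.- scaled b ≡ scaled (a ℤ.- b)
  scaled-- a b = sym (move {scaled (a ℤ.- b)} (begin
    scaled (a ℤ.- b) ℚ.+ scaled b            ≡⟨ ℚ.*-distribʳ-+ (1ℤ ℚ./ r) (toℚ (a ℤ.- b)) (toℚ b) ⟨
    (toℚ (a ℤ.- b) ℚ.+ toℚ b) ℚ.* (1ℤ ℚ./ r)   ≡⟨ cong (ℚ._* (1ℤ ℚ./ r)) (toℚ-+ (a ℤ.- b) b) ⟩
    scaled (a ℤ.- b ℤ.+ b)                   ≡⟨ cong scaled (trans (ℤ.+-comm (a ℤ.- b) b) (i+[j-i]≡j b a)) ⟩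
    scaled a                                 ∎))
    where open ≡-Reasoning

  scaled-0 : scaled 0ℤ ≡ 0ℚ
  scaled-0 = ℚ.*-zeroˡ (1ℤ ℚ./ r)

  scaled-r : scaled (+ r) ≡ 1ℚ
  scaled-r = toℚ-inverse r

  scaled-mono-≤ : ∀ a b → a ℤ.≤ b → scaled a ℚ.≤ scaled b
  scaled-mono-≤ a b a≤b = ℚ.*-monoʳ-≤-nonNeg (1ℤ ℚ./ r) {{ℚ.normalize-nonNeg 1 r}} (toℚ-mono-≤ a b a≤b)

  scaled-cancel-≤ : ∀ a b → scaled a ℚ.≤ scaled b → a ℤ.≤ b
  scaled-cancel-≤ a b le =
    toℚ-reflects-≤ a b (ℚ.*-cancelʳ-≤-pos (1ℤ ℚ./ r) {{ℚ.normalize-pos 1 r}} le)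

  scaled-mono-< : ∀ a b → a ℤ.< b → scaled a ℚ.< scaled b
  scaled-mono-< a b a<b = ℚ.≰⇒> λ b≤a → ℤ.<⇒≱ a<b (scaled-cancel-≤ b a b≤a)

  scaled-cancel-< : ∀ a b → scaled a ℚ.< scaled b → a ℤ.< b
  scaled-cancel-< a b lt = ℤ.≰⇒> λ b≤a → ℚ.<-irrefl refl (ℚ.<-≤-trans lt (scaled-mono-≤ b a b≤a))

  differences-scaled : ∀ {n} a (x : Vec ℤ n) b j →
    differences (scaled a) (Vec.map scaled x) (scaled b) j ≡ scaled (integerDifferences a x b j)
  differences-scaled a []      b zero    = scaled-- b a
  differences-scaled a (z ∷ x) b zero    = scaled-- z a
  differences-scaled a (z ∷ x) b (suc j) = differences-scaled z x b j

  module _ {n : ℕ} where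

    private
      s : Fin n → ℕ
      s _ = r
      Lattice = Π°-lattice (lectureHall-isLatticeSimplex s)

    -- A constant `s` gives all ratios the denominator `r`. With the height written as h r / r as
    -- well, every coefficient is an integer z over `r`, and 0 < c < 1 becomes 0 < z < r.
    coefficients-scaled : ∀ (x : Vec ℤ n) h j →
      coefficients s (Vec.map toℚ x) (toℚ h) j ≡ scaled (integerDifferences 0ℤ x (h ℤ.* + r) j)
    coefficients-scaled x h j = begin
      differences 0ℚ (ratios s (Vec.map toℚ x)) (toℚ h) j
        ≡⟨ cong (λ y → differences 0ℚ y (toℚ h) j) ratios-scaled ⟩
      differences 0ℚ (Vec.map scaled x) (toℚ h) j
        ≡⟨ cong₂ (λ a b → differences a (Vec.map scaled x) b j) (sym scaled-0) height ⟩
      differences (scaled 0ℤ) (Vec.map scaled x) (scaled (h ℤ.* + r)) j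
        ≡⟨ differences-scaled 0ℤ x (h ℤ.* + r) j ⟩
      scaled (integerDifferences 0ℤ x (h ℤ.* + r) j) ∎
      where
      open ≡-Reasoning
      ratios-scaled : ratios s (Vec.map toℚ x) ≡ Vec.map scaled x
      ratios-scaled = lookup-ext λ i → trans (Vec.lookup∘tabulate (λ i → lookup (Vec.map toℚ x) i ℚ.* (1ℤ ℚ./ r)) i)
        (trans (cong (ℚ._* (1ℤ ℚ./ r)) (Vec.lookup-map i toℚ x)) (sym (Vec.lookup-map i scaled x)))
      height : toℚ h ≡ scaled (h ℤ.* + r)
      height = begin
        toℚ h                                   ≡⟨ ℚ.*-identityʳ (toℚ h) ⟨
        toℚ h ℚ.* 1ℚ                            ≡⟨ cong (toℚ h ℚ.*_) scaled-r ⟨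
        toℚ h ℚ.* (toℚ (+ r) ℚ.* (1ℤ ℚ./ r))      ≡⟨ ℚ.*-assoc (toℚ h) (toℚ (+ r)) (1ℤ ℚ./ r) ⟨
        toℚ h ℚ.* toℚ (+ r) ℚ.* (1ℤ ℚ./ r)        ≡⟨ cong (ℚ._* (1ℤ ℚ./ r)) (toℚ-* h (+ r)) ⟩
        scaled (h ℤ.* + r)                      ∎

    StrictSteps : Vec ℤ n × ℤ → Set
    StrictSteps (x , h) = ∀ j → let z = integerDifferences 0ℤ x (h ℤ.* + r) j in 0ℤ ℤ.< z × z ℤ.< + r

    lattice⇒strict : ∀ xh → Lattice xh → StrictSteps xh
    lattice⇒strict (x , h) (c , p , e , e′) j =
      scaled-cancel-< 0ℤ z (subst₂ ℚ._<_ (sym scaled-0) c≡ (proj₁ (p j)))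
      , scaled-cancel-< z (+ r) (subst₂ ℚ._<_ c≡ (sym scaled-r) (proj₂ (p j)))
      where
      z = integerDifferences 0ℤ x (h ℤ.* + r) j
      c≡ : c j ≡ scaled z
      c≡ = trans (coefficients-unique s c e (sym e′) j) (coefficients-scaled x h j)

    strict⇒lattice : ∀ xh → StrictSteps xh → Lattice xh
    strict⇒lattice (x , h) p = coefficients s x′ h′
      , (λ j → let z = integerDifferences 0ℤ x (h ℤ.* + r) j in
          subst₂ ℚ._<_ scaled-0 (sym (coefficients-scaled x h j)) (scaled-mono-< 0ℤ z (proj₁ (p j)))
        , subst₂ ℚ._<_ (sym (coefficients-scaled x h j)) scaled-r (scaled-mono-< z (+ r) (proj₂ (p j))))
      , coefficients-combination s x′ h′ , sym (coefficients-sum s x′ h′)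
      where
      x′ = Vec.map toℚ x
      h′ = toℚ h

    latticePoint : Vec ℕ (suc n) → Vec ℤ n × ℤ
    latticePoint δ = positions 0 δ , + level r δ

    latticePoint-differences : ∀ (δ : Vec ℕ (suc n)) → r Div.∣ Vec.sum δ → ∀ j →
      integerDifferences 0ℤ (positions 0 δ) (+ level r δ ℤ.* + r) j ≡ + lookup δ j
    latticePoint-differences δ r∣δ j = trans
      (cong (λ b → integerDifferences 0ℤ (positions 0 δ) b j)
        (trans (sym (ℤ.pos-* (level r δ) r)) (cong +_ (m/n*n≡m r∣δ))))
      (integerDifferences-positions 0 δ j)

    latticePoint-bijective : Bijective (Cycle r) Lattice latticePoint
    latticePoint-bijective = record
      { image      = λ {δ} (bounds , r∣δ) → strict⇒lattice (latticePoint δ) λ j →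
          subst (λ z → 0ℤ ℤ.< z × z ℤ.< + r) (sym (latticePoint-differences δ r∣δ j))
            (ℤ.+<+ (ℕ.n≢0⇒n>0 (proj₁ (bounds j))) , ℤ.+<+ (proj₂ (bounds j)))
      ; injective  = λ {δ} {δ′} (_ , r∣δ) (_ , r∣δ′) e → lookup-ext λ j → ℤ.+-injective
          (trans (sym (latticePoint-differences δ r∣δ j))
          (trans (cong (λ (x , h) → integerDifferences 0ℤ x (h ℤ.* + r) j) e)
                 (latticePoint-differences δ′ r∣δ′ j)))
      ; surjective = λ {xh} l → preimage xh (lattice⇒strict xh l)
      }
      where
      preimage : ∀ xh → StrictSteps xh → ∃ λ δ → Cycle r δ × latticePoint δ ≡ xh
      preimage (x , h) p with δ , refl , e ← steps 0 x (h ℤ.* + r) (proj₁ ∘ p) =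
        δ , ((λ j → bound (subst (λ z → 0ℤ ℤ.< z × z ℤ.< + r) (value j) (p j))) , r∣δ)
        , cong (positions 0 δ ,_) (ℤ.*-cancelʳ-≡ (+ level r δ) h (+ r)
            (trans (sym (ℤ.pos-* (level r δ) r)) (trans (cong +_ (m/n*n≡m r∣δ)) e)))
        where
        value : ∀ j → integerDifferences 0ℤ (positions 0 δ) (h ℤ.* + r) j ≡ + lookup δ j
        value j = trans (cong (λ b → integerDifferences 0ℤ (positions 0 δ) b j) (sym e))
                        (integerDifferences-positions 0 δ j)
        bound : ∀ {c} → 0ℤ ℤ.< + c × + c ℤ.< + r → c ≢ 0 × c ℕ.< r
        bound (ℤ.+<+ 0<c , ℤ.+<+ c<r) = ℕ.n>0⇒n≢0 0<c , c<r
        -- The height is still an arbitrary integer here, so its absolute value serves as the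
        -- quotient.
        r∣δ : r Div.∣ Vec.sum δ
        r∣δ = Div.divides ℤ.∣ h ∣ (trans (cong ℤ.∣_∣ e) (ℤ.abs-* h (+ r)))

  coeff-d : ∀ n → coeff (d {n} (λ _ → r)) ≗ λ t → total (elements (cycles (suc n) r)) (λ δ → monomial (level r δ) t)
  coeff-d n t = begin
    coeff (d {n} (λ _ → r)) t
      ≡⟨ coeff-∑ (elements points) (λ xh → z^ ℤ.∣ proj₂ xh ∣) t ⟩
    total (elements points) (λ xh → coeff (z^ ℤ.∣ proj₂ xh ∣) t)
      ≡⟨ total-bijective (cycles (suc n) r) points latticePoint-bijective (λ xh → coeff (z^ ℤ.∣ proj₂ xh ∣) t) ⟨
    total (elements (cycles (suc n) r)) (λ δ → coeff (z^ level r δ) t)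
      ≡⟨ total-cong (elements (cycles (suc n) r)) (λ {δ} _ → coeff-z^ (level r δ) t) ⟩
    total (elements (cycles (suc n) r)) (λ δ → monomial (level r δ) t) ∎
    where
    open ≡-Reasoning
    points = latticePoints {n} (λ _ → r)

-- Smirnoff words

count : {P : Set} → Dec P → ℕ
count (yes _) = 1
count (no  _) = 0

length-filter-∷ : {A : Set} {P : Pred A 0ℓ} (P? : Decidable P) (x : A) (xs : List A) →
                  length (filter P? (x ∷ xs)) ≡ count (P? x) ℕ.+ length (filter P? xs)
length-filter-∷ P? x xs with P? x
... | yes _ = refl
... | no  _ = refl

length-filter-map : {A B : Set} {P : Pred B 0ℓ} (P? : Decidable P) (f : A → B) (xs : List A) →
                    length (filter P? (List.map f xs)) ≡ length (filter (P? ∘ f) xs)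
length-filter-map P? f []       = refl
length-filter-map P? f (x ∷ xs) with P? (f x)
... | yes _ = cong suc (length-filter-map P? f xs)
... | no  _ = length-filter-map P? f xs

module _ {r : ℕ} where

  drop : Fin r → Fin r → ℕ
  drop a b = count (b Fin.<? a)

  des-∷ : ∀ {m} a b (ω : Vec (Fin r) m) → des (a ∷ b ∷ ω) ≡ drop a b ℕ.+ des (b ∷ ω)
  des-∷ {m} a b ω = trans (length-filter-∷ descent? zero (List.tabulate suc)) (cong (drop a b ℕ.+_)
    (trans (cong (length ∘ filter descent?) (sym (List.map-tabulate id suc))) (length-filter-map descent? suc (allFin m))))
    where
    descent? : Decidable (λ i → lookup (a ∷ b ∷ ω) (suc i) Fin.< lookup (a ∷ b ∷ ω) (inject₁ i))
    descent? i = lookup (a ∷ b ∷ ω) (suc i) Fin.<? lookup (a ∷ b ∷ ω) (inject₁ i)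

  -- This is b - a modulo `r`. Written with `drop` instead of `%`, it shows that `r` is added
  -- exactly at the descents.
  gap : Fin r → Fin r → ℕ
  gap a b = toℕ b ℕ.+ drop a b ℕ.* r ∸ toℕ a

  gap-eq : ∀ a b → toℕ a ℕ.+ gap a b ≡ toℕ b ℕ.+ drop a b ℕ.* r
  gap-eq a b = ℕ.m+[n∸m]≡n bound
    where
    bound : toℕ a ℕ.≤ toℕ b ℕ.+ drop a b ℕ.* r
    bound with b Fin.<? a
    ... | yes _  = ℕ.≤-trans (ℕ.<⇒≤ (Fin.toℕ<n a)) (ℕ.≤-trans (ℕ.≤-reflexive (sym (ℕ.+-identityʳ r))) (ℕ.m≤n+m _ (toℕ b)))
    ... | no b≮a = ℕ.≤-trans (ℕ.≮⇒≥ b≮a) (ℕ.m≤m+n _ _)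

  gap<r : ∀ a b → gap a b ℕ.< r
  gap<r a b = ℕ.+-cancelˡ-< (toℕ a) _ _ (subst (ℕ._< toℕ a ℕ.+ r) (sym (gap-eq a b)) bound)
    where
    bound : toℕ b ℕ.+ drop a b ℕ.* r ℕ.< toℕ a ℕ.+ r
    bound with b Fin.<? a
    ... | yes b<a = ℕ.+-mono-<-≤ b<a (ℕ.≤-reflexive (ℕ.+-identityʳ r))
    ... | no _    = subst (ℕ._< toℕ a ℕ.+ r) (sym (ℕ.+-identityʳ (toℕ b)))
                      (ℕ.<-≤-trans (Fin.toℕ<n b) (ℕ.m≤n+m r (toℕ a)))

  module _ .{{_ : NonZero r}} where

    congruent : ∀ (b b′ : Fin r) k k′ → toℕ b ℕ.+ k ℕ.* r ≡ toℕ b′ ℕ.+ k′ ℕ.* r → b ≡ b′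
    congruent b b′ k k′ e = Fin.toℕ-injective (begin
      toℕ b                        ≡⟨ reduce b k ⟨
      (toℕ b ℕ.+ k ℕ.* r) % r      ≡⟨ cong (_% r) e ⟩
      (toℕ b′ ℕ.+ k′ ℕ.* r) % r    ≡⟨ reduce b′ k′ ⟩
      toℕ b′                       ∎)
      where
      open ≡-Reasoning
      reduce : ∀ (b : Fin r) k → (toℕ b ℕ.+ k ℕ.* r) % r ≡ toℕ b
      reduce b k = trans ([m+kn]%n≡m%n (toℕ b) k r) (m<n⇒m%n≡m (Fin.toℕ<n b))

    gap-injective : ∀ a {b b′} → gap a b ≡ gap a b′ → b ≡ b′
    gap-injective a {b} {b′} e = congruent b b′ (drop a b) (drop a b′)
      (trans (sym (gap-eq a b)) (trans (cong (toℕ a ℕ.+_) e) (gap-eq a b′)))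

    -- The next letter is a + c reduced modulo `r`; reduction subtracts `r` exactly when there is a
    -- descent.
    gap-surjective : ∀ a {c} → c ℕ.< r → ∃ λ b → gap a b ≡ c
    gap-surjective a {c} c<r with toℕ a ℕ.+ c ℕ.<? r
    ... | yes a+c<r = b , ℕ.+-cancelˡ-≡ (toℕ a) _ _ (trans (gap-eq a b)
            (trans (cong (λ k → toℕ b ℕ.+ k ℕ.* r) no-drop) (trans (ℕ.+-identityʳ (toℕ b)) b≡)))
      where
      b  = fromℕ< a+c<r
      b≡ : toℕ b ≡ toℕ a ℕ.+ c
      b≡ = Fin.toℕ-fromℕ< a+c<r
      no-drop : drop a b ≡ 0
      no-drop with b Fin.<? a
      ... | yes b<a = contradiction (subst (ℕ._< toℕ a) b≡ b<a) (ℕ.m+n≮m (toℕ a) c)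
      ... | no _    = refl
    ... | no a+c≮r = b , ℕ.+-cancelˡ-≡ (toℕ a) _ _ (trans (gap-eq a b)
            (trans (cong (λ k → toℕ b ℕ.+ k ℕ.* r) one-drop)
            (trans (cong₂ ℕ._+_ b≡ (ℕ.+-identityʳ r)) (ℕ.m∸n+n≡m r≤a+c))))
      where
      r≤a+c : r ℕ.≤ toℕ a ℕ.+ c
      r≤a+c = ℕ.≮⇒≥ a+c≮r
      wrapped : toℕ a ℕ.+ c ∸ r ℕ.< toℕ a
      wrapped = ℕ.+-cancelʳ-< r _ _ (subst (ℕ._< toℕ a ℕ.+ r) (sym (ℕ.m∸n+n≡m r≤a+c)) (ℕ.+-monoʳ-< (toℕ a) c<r))
      bound : toℕ a ℕ.+ c ∸ r ℕ.< r
      bound = ℕ.<-trans wrapped (Fin.toℕ<n a)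
      b  = fromℕ< bound
      b≡ : toℕ b ≡ toℕ a ℕ.+ c ∸ r
      b≡ = Fin.toℕ-fromℕ< bound
      one-drop : drop a b ≡ 1
      one-drop with b Fin.<? a
      ... | yes _  = refl
      ... | no b≮a = contradiction (subst (ℕ._< toℕ a) (sym b≡) wrapped) b≮a

    gap-self : ∀ a → gap a a ≡ 0
    gap-self a with a Fin.<? a
    ... | yes a<a = contradiction a<a (ℕ.n≮n (toℕ a))
    ... | no _    = trans (cong (_∸ toℕ a) (ℕ.+-identityʳ (toℕ a))) (ℕ.n∸n≡0 (toℕ a))

    gaps : ∀ {m} → Vec (Fin r) (suc m) → Vec ℕ m
    gaps (a ∷ [])    = []
    gaps (a ∷ b ∷ ω) = gap a b ∷ gaps (b ∷ ω)

    lookup-gaps : ∀ {m} (ω : Vec (Fin r) (suc m)) i → lookup (gaps ω) i ≡ gap (lookup ω (inject₁ i)) (lookup ω (suc i))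
    lookup-gaps (a ∷ b ∷ ω) zero    = refl
    lookup-gaps (a ∷ b ∷ ω) (suc i) = lookup-gaps (b ∷ ω) i

    -- The differences telescope, and each descent leaves one additional `r`. For a word from 0 to 0
    -- the sum is thus `r` times the number of descents.
    sum-gaps : ∀ {m} a (ω : Vec (Fin r) m) → toℕ a ℕ.+ Vec.sum (gaps (a ∷ ω)) ≡ toℕ (last (a ∷ ω)) ℕ.+ des (a ∷ ω) ℕ.* r
    sum-gaps a []      = refl
    sum-gaps a (b ∷ ω) = begin
      toℕ a ℕ.+ (gap a b ℕ.+ s)                     ≡⟨ ℕ.+-assoc (toℕ a) (gap a b) s ⟨
      toℕ a ℕ.+ gap a b ℕ.+ s                       ≡⟨ cong (ℕ._+ s) (gap-eq a b) ⟩
      toℕ b ℕ.+ drop a b ℕ.* r ℕ.+ s                ≡⟨ cong (ℕ._+ s) (ℕ.+-comm (toℕ b) _) ⟩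
      drop a b ℕ.* r ℕ.+ toℕ b ℕ.+ s                ≡⟨ ℕ.+-assoc (drop a b ℕ.* r) (toℕ b) s ⟩
      drop a b ℕ.* r ℕ.+ (toℕ b ℕ.+ s)              ≡⟨ cong (drop a b ℕ.* r ℕ.+_) (sum-gaps b ω) ⟩
      drop a b ℕ.* r ℕ.+ (l ℕ.+ des (b ∷ ω) ℕ.* r)  ≡⟨ ℕ.+-assoc (drop a b ℕ.* r) l _ ⟨
      drop a b ℕ.* r ℕ.+ l ℕ.+ des (b ∷ ω) ℕ.* r    ≡⟨ cong (ℕ._+ des (b ∷ ω) ℕ.* r) (ℕ.+-comm (drop a b ℕ.* r) l) ⟩
      l ℕ.+ drop a b ℕ.* r ℕ.+ des (b ∷ ω) ℕ.* r    ≡⟨ ℕ.+-assoc l (drop a b ℕ.* r) _ ⟩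
      l ℕ.+ (drop a b ℕ.* r ℕ.+ des (b ∷ ω) ℕ.* r)  ≡⟨ cong (l ℕ.+_) (ℕ.*-distribʳ-+ r (drop a b) (des (b ∷ ω))) ⟨
      l ℕ.+ (drop a b ℕ.+ des (b ∷ ω)) ℕ.* r        ≡⟨ cong (λ k → l ℕ.+ k ℕ.* r) (des-∷ a b ω) ⟨
      l ℕ.+ des (a ∷ b ∷ ω) ℕ.* r                   ∎
      where
      open ≡-Reasoning
      s = Vec.sum (gaps (b ∷ ω))
      l = toℕ (last (b ∷ ω))

    gaps-injective : ∀ {m} a (ω ω′ : Vec (Fin r) m) → gaps (a ∷ ω) ≡ gaps (a ∷ ω′) → ω ≡ ω′
    gaps-injective a []      []        e = refl
    gaps-injective a (b ∷ ω) (b′ ∷ ω′) e with refl ← gap-injective a (Vec.∷-injectiveˡ e) =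
      cong (b ∷_) (gaps-injective b ω ω′ (Vec.∷-injectiveʳ e))

    gaps-surjective : ∀ {m} a (δ : Vec ℕ m) → (∀ i → lookup δ i ℕ.< r) → ∃ λ ω → gaps (a ∷ ω) ≡ δ
    gaps-surjective a []      δ<r = [] , refl
    gaps-surjective a (c ∷ δ) δ<r =
      let b , e  = gap-surjective a (δ<r zero)
          ω , e′ = gaps-surjective b δ (δ<r ∘ suc)
      in b ∷ ω , cong₂ _∷_ e e′

    sum-smirnoff : ∀ {m} {ω : Vec (Fin r) (suc m)} → Smirnoff m r ω → Vec.sum (gaps ω) ≡ des ω ℕ.* r
    sum-smirnoff {ω = a ∷ ω} (smirnoff first last _) =
      trans (cong (ℕ._+ Vec.sum (gaps (a ∷ ω))) (sym first))
        (trans (sum-gaps a ω) (cong (ℕ._+ des (a ∷ ω) ℕ.* r) last))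

    -- A gap is 0 only between equal neighbours, and the sum is divisible by `r` exactly when a walk
    -- starting at 0 returns to 0. A walk is determined by its first letter and its gaps.
    gaps-bijective : ∀ m → Bijective (Smirnoff m r) (Cycle r) gaps
    gaps-bijective m = record
      { image      = λ {ω} sm →
          (λ i → subst (λ c → c ≢ 0 × c ℕ.< r) (sym (lookup-gaps ω i))
            ((λ ≡0 → Smirnoff.distinct sm i (gap-injective (lookup ω (inject₁ i)) (trans (gap-self (lookup ω (inject₁ i))) (sym ≡0))))
            , gap<r (lookup ω (inject₁ i)) (lookup ω (suc i))))
          , Div.divides (des ω) (sum-smirnoff sm)
      ; injective  = λ { {a ∷ ω} {a′ ∷ ω′} sm sm′ e → same-head a a′ ω ω′
                           (trans (Smirnoff.first-zero sm) (sym (Smirnoff.first-zero sm′))) e }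
      ; surjective = preimage
      }
      where
      same-head : ∀ a a′ (ω ω′ : Vec (Fin r) m) → toℕ a ≡ toℕ a′ → gaps (a ∷ ω) ≡ gaps (a′ ∷ ω′) → a ∷ ω ≡ a′ ∷ ω′
      same-head a a′ ω ω′ same e with refl ← Fin.toℕ-injective same = cong (a ∷_) (gaps-injective a ω ω′ e)
      preimage : ∀ {δ} → Cycle r δ → ∃ λ ω → Smirnoff m r ω × gaps ω ≡ δ
      preimage {δ} (bounds , Div.divides k sum≡) =
        let ω , e = gaps-surjective 0′ δ (proj₂ ∘ bounds) in 0′ ∷ ω , smirnoff toℕ-0′ (closes ω e) (distinct ω e) , e
        where
        0′ : Fin r
        0′ = fromℕ< (ℕ.>-nonZero⁻¹ r)
        toℕ-0′ : toℕ 0′ ≡ 0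
        toℕ-0′ = Fin.toℕ-fromℕ< _
        -- The last letter is congruent to 0 modulo `r`, and letters are smaller than `r`.
        closes : ∀ ω → gaps (0′ ∷ ω) ≡ δ → toℕ (last (0′ ∷ ω)) ≡ 0
        closes ω e = trans (cong toℕ (congruent (last (0′ ∷ ω)) 0′ (des (0′ ∷ ω)) k
          (trans (sym (sum-gaps 0′ ω)) (cong (toℕ 0′ ℕ.+_) (trans (cong Vec.sum e) sum≡))))) toℕ-0′
        distinct : ∀ ω → gaps (0′ ∷ ω) ≡ δ → ∀ i → lookup (0′ ∷ ω) (inject₁ i) ≢ lookup ω i
        distinct ω e i same = proj₁ (bounds i) (trans (sym (trans (sym (lookup-gaps (0′ ∷ ω) i)) (cong (λ δ → lookup δ i) e)))
          (trans (cong (gap (lookup (0′ ∷ ω) (inject₁ i))) (sym same)) (gap-self (lookup (0′ ∷ ω) (inject₁ i)))))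

coeff-SW : ∀ m r .{{_ : NonZero r}} →
  coeff (∑[ ω ∈ elements (SW m r) ] z^ des ω) ≗ λ t → total (elements (cycles m r)) (λ δ → monomial (level r δ) t)
coeff-SW m r t = begin
  coeff (∑[ ω ∈ elements (SW m r) ] z^ des ω) t
    ≡⟨ coeff-∑ (elements (SW m r)) (λ ω → z^ des ω) t ⟩
  total (elements (SW m r)) (λ ω → coeff (z^ des ω) t)
    ≡⟨ total-cong (elements (SW m r)) (λ {ω} ω∈ → trans (coeff-z^ (des ω) t)
         (cong (λ k → monomial k t) (des≡level (sound (SW m r) ω∈)))) ⟩
  total (elements (SW m r)) (λ ω → monomial (level r (gaps ω)) t)
    ≡⟨ total-bijective (SW m r) (cycles m r) (gaps-bijective m) (λ δ → monomial (level r δ) t) ⟩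
  total (elements (cycles m r)) (λ δ → monomial (level r δ) t) ∎
  where
  open ≡-Reasoning
  des≡level : ∀ {ω} → Smirnoff m r ω → des ω ≡ level r (gaps ω)
  des≡level {ω} sm = sym (trans (cong (_/ r) (sum-smirnoff sm)) (m*n/n≡m (des ω) r))

theorem4p4 : (n r : ℕ) .{{_ : NonZero r}} →
    (d {n} (λ _ → r) ≈ ∑[ ω ∈ elements (SW (suc n) r) ] z^ des ω) ×
    (localH (edgewise (suc n) r) ≈
      ℓ* (lectureHall-isLatticeSimplex {n} (λ _ → r)) (latticePoints {n} (λ _ → r)))
theorem4p4 n r =
  (λ k → trans (coeff-d r n k) (sym (coeff-SW (suc n) r k))) ,
  (λ k → trans (coeff-localH-edgewise (suc n) r k) (sym (coeff-d r n k)))
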